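{- Let $\mathbb{K}$ be a field of characteristic zero, let $n=k+1$, let $\lambda\vdash n$, $\mu\vdash k$ with $\mu\subset\lambda$, let $T$ be a Young tableau of shape $\lambda$ with entries $1,\dots,n$, and let $S$ be its Young subtableau of shape $\mu$. Suppose the unique entry of $T$ not in $S$ is $a$, located in position $(u,v)$, so $\lambda_i=\mu_i$ for $i\neq u$ and $\lambda_u=v=\mu_u+1$. Let $\tilde S$ be the tableau obtained from $S$ by removing its first $v$ columns (its shape $\tilde\mu$ has $\tilde\mu_i=\mu_i-v$ for $i<u$ and $\tilde\mu_i=0$ otherwise). Divide $\tilde S$ into blocks $\tilde B_1,\dots,\tilde B_{\tilde m}$, listed from left to right, where each block is a maximal set of consecutive columns of $\tilde S$ having the same size; let $\tilde l_i$ be the number of columns of $\tilde B_i$ and $\tilde h_i$ the common size of these columns. Set $\tilde r_i=\tilde l_1+\cdots+\tilde l_i+u-\tilde h_i$ (the length of the hook of $\mu$ centered at $(\tilde h_i,v)$) and $\tilde x_i=\sum_{b\in\tilde B_i}(a,b)\in\mathbb{K}[\mathfrak{S}_n]$. Then \[\mathfrak{c}_\lambda(T)\cdot\mathfrak{c}_\mu(S)=\mathfrak{c}_\lambda(T)\cdot\alpha_\mu\cdot\prod_{i=1}^{\tilde m}\Big(1-\frac{\tilde x_i}{\tilde r_i}\Big),\] where the product is taken in the order $i=1,2,\dots,\tilde m$ from left to right (and equals $1$ if $\tilde m=0$).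
   Context: Permutations are multiplied by composition, $(\sigma\tau)(x)=\sigma(\tau(x))$; $(a,b)$ denotes a transposition. A Young tableau of shape $\lambda$ is a bijection from $D_\lambda=\{(i,j):1\leq j\leq\lambda_i\}$ to its set of entries, drawn as left-justified rows; $R_i(T)$, $C_j(T)$ are the sets of entries in row $i$, column $j$. The Young subtableau of shape $\mu\subset\lambda$ is the restriction to $D_\mu$. For a set $X$, $\mathfrak{a}(X)=\sum_{\sigma\in\mathfrak{S}_X}\sigma$, $\mathfrak{b}(X)=\sum_{\tau\in\mathfrak{S}_X}\mathrm{sgn}(\tau)\tau$; $\mathfrak{c}_\lambda(T)=\prod_i\mathfrak{a}(R_i(T))\cdot\prod_j\mathfrak{b}(C_j(T))$. The hook of $\mu$ at $(x,y)$ is $\{(x,j)\in D_\mu:j\geq y\}\cup\{(i,y)\in D_\mu:i\geq x\}$ and $\alpha_\mu$ is the product of the sizes of all hooks of $\mu$. -}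

module Defs where

open import Level using (Level; _⊔_) renaming (suc to lsuc)
open import Algebra.Bundles using (CommutativeRing)
open import Data.Nat as ℕ using (ℕ; zero; suc; _+_; _∸_; _≤_; _<_; _<?_; _%_)
open import Data.Nat.Properties using () renaming (_≟_ to _≟ℕ_)
open import Data.Fin as Fin using (Fin)
open import Data.Fin.Properties using (all?)
open import Data.Fin.Permutation using (Permutation; _⟨$⟩ʳ_; _∘ₚ_; transpose) renaming (id to idₚ)
open import Data.List using (List; []; _∷_; [_]; _++_; map; concat; concatMap; mapMaybe;
  length; filter; zipWith; take; drop; foldr; upTo; allFin; cartesianProduct)
open import Data.Nat.ListAction using (sum; product)
open import Data.List.Relation.Unary.All using (All)
open import Data.List.Relation.Unary.Linked using (Linked)
open import Data.List.Relation.Binary.Permutation.Propositional using (_↭_)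
open import Data.Maybe using (Maybe; just; nothing; _>>=_)
open import Data.Product using (Σ; _×_; _,_; proj₁)
open import Relation.Nullary using (¬_; Dec; yes; no)
open import Relation.Nullary.Decidable using (_×-dec_)
open import Relation.Binary.PropositionalEquality using (_≡_)

record Field (c ℓ : Level) : Set (lsuc (c ⊔ ℓ)) where
  field
    commutativeRing : CommutativeRing c ℓ
  open CommutativeRing commutativeRing public
  field
    1≉0     : ¬ (1# ≈ 0#)
    inverse : ∀ x → ¬ (x ≈ 0#) → Σ Carrier (λ y → x * y ≈ 1#)

module _ {c ℓ} (F : Field c ℓ) where
  open Field F renaming (_+_ to _+ᴷ_; _*_ to _*ᴷ_; -_ to -ᴷ_)
  embed : ℕ → Carrier
  embed zero    = 0#
  embed (suc m) = 1# +ᴷ embed m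

  CharZero : Set ℓ
  CharZero = ∀ m → ¬ (embed (suc m) ≈ 0#)

-- Partitions, tableaux (all indices below are 0-based)

part : List ℕ → ℕ → ℕ
part []       _       = 0
part (x ∷ _)  zero    = x
part (_ ∷ xs) (suc i) = part xs i

IsPartition : ℕ → List ℕ → Set
IsPartition n lam = All (0 <_) lam × Linked (λ x y → y ≤ x) lam × sum lam ≡ n

_⊂ᴰ_ : List ℕ → List ℕ → Set
mu ⊂ᴰ lam = ∀ i → part mu i ≤ part lam i

-- A tableau is given by its list of rows; entries lie in Fin n
-- (Fin n = {0,...,n-1} stands for {1,...,n}).
Tableau : ℕ → Set
Tableau n = List (List (Fin n))

IsTableau : ∀ {n} → List ℕ → Tableau n → Set
IsTableau {n} lam T = map length T ≡ lam × concat T ↭ allFin n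

at : ∀ {A : Set} → List A → ℕ → Maybe A
at []       _       = nothing
at (x ∷ _)  zero    = just x
at (_ ∷ xs) (suc i) = at xs i

entry : ∀ {n} → Tableau n → ℕ → ℕ → Maybe (Fin n)
entry T i j = at T i >>= λ r → at r j

restrict : ∀ {n} → List ℕ → Tableau n → Tableau n
restrict mu T = zipWith take mu T

column : ∀ {n} → Tableau n → ℕ → List (Fin n)
column T j = mapMaybe (λ r → at r j) T

columns : ∀ {n} → Tableau n → List (List (Fin n))
columns T = map (column T) (upTo (part (map length T) 0))

-- size of the hook of mu at (x , y) (0-based):
-- arm part {(x,j) : j ≥ y} has μ_x - y cells, leg part {(i,y) : i ≥ x}
-- has #{i ≥ x : μ_i > y} cells, and they share the cell (x,y).
hookLength : List ℕ → ℕ → ℕ → ℕ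
hookLength mu x y =
  (part mu x ∸ y) + length (filter (λ i → y <? part mu i) (drop x (upTo (length mu)))) ∸ 1

cells : List ℕ → List (ℕ × ℕ)
cells mu = concatMap (λ x → map (λ y → (x , y)) (upTo (part mu x))) (upTo (length mu))

α : List ℕ → ℕ
α mu = product (map (λ { (x , y) → hookLength mu x y }) (cells mu))

blocks : ∀ {n} → List (List (Fin n)) → List (ℕ × List (List (Fin n)))
blocks [] = []
blocks (col ∷ cols) with blocks cols
... | [] = [ (length col , [ col ]) ]
... | (h , b) ∷ bs with length col ≟ℕ h
...   | yes _ = (h , col ∷ b) ∷ bs
...   | no  _ = (length col , [ col ]) ∷ (h , b) ∷ bs

-- The group algebra K[S_n], as formal K-linear combinations of
-- permutations, compared coefficientwise.

module GroupAlgebra {c ℓ} (F : Field c ℓ) (charZero : CharZero F) (n : ℕ) where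
  open Field F renaming (_+_ to _+ᴷ_; _*_ to _*ᴷ_; -_ to -ᴷ_)

  Perm : Set
  Perm = Permutation n n

  -- product with the paper's convention (σ · τ)(x) = σ(τ(x))
  -- (stdlib's _∘ₚ_ is diagrammatic: (π ∘ₚ ρ) ⟨$⟩ʳ i = ρ ⟨$⟩ʳ (π ⟨$⟩ʳ i))
  _·_ : Perm → Perm → Perm
  σ · τ = τ ∘ₚ σ

  _≟ₚ_ : (σ τ : Perm) → Dec (∀ i → σ ⟨$⟩ʳ i ≡ τ ⟨$⟩ʳ i)
  σ ≟ₚ τ = all? (λ i → σ ⟨$⟩ʳ i Fin.≟ τ ⟨$⟩ʳ i)

  KS : Set c
  KS = List (Carrier × Perm)

  coeff : KS → Perm → Carrier
  coeff [] σ = 0#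
  coeff ((x , τ) ∷ f) σ with τ ≟ₚ σ
  ... | yes _ = x +ᴷ coeff f σ
  ... | no  _ = coeff f σ

  infix 4 _≋_
  _≋_ : KS → KS → Set ℓ
  f ≋ g = ∀ σ → coeff f σ ≈ coeff g σ

  infixl 6 _⊕_
  _⊕_ : KS → KS → KS
  f ⊕ g = f ++ g

  infixl 7 _⊗_
  _⊗_ : KS → KS → KS
  f ⊗ g = concatMap (λ { (x , σ) → map (λ { (y , τ) → (x *ᴷ y , σ · τ) }) g }) f

  infixr 8 _⊙_
  _⊙_ : Carrier → KS → KS
  x ⊙ f = map (λ { (y , τ) → (x *ᴷ y , τ) }) f

  1ₐ : KS
  1ₐ = [ (1# , idₚ) ]

  ⟦_⟧ : Perm → KS
  ⟦ σ ⟧ = [ (1# , σ) ]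

  prod : List KS → KS
  prod = foldr _⊗_ 1ₐ

  ∑ : List KS → KS
  ∑ = concat

  inversions : Perm → ℕ
  inversions σ = length (filter (λ { (i , j) → (i Fin.<? j) ×-dec (σ ⟨$⟩ʳ j Fin.<? σ ⟨$⟩ʳ i) })
                               (cartesianProduct (allFin n) (allFin n)))

  sgn : Perm → Carrier
  sgn σ with inversions σ % 2
  ... | zero = 1#
  ... | suc _ = -ᴷ 1#

  -- the symmetric group S_X on a duplicate-free list X, each element listed once:
  -- σ ∈ S_{x∷X} is uniquely  (x , σ x) · τ  with τ ∈ S_X  ((x , x) = id).
  symGroupOn : List (Fin n) → List Perm
  symGroupOn []      = [ idₚ ]
  symGroupOn (x ∷ X) = concatMap (λ y → map (λ τ → transpose x y · τ) (symGroupOn X)) (x ∷ X)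

  𝔞 : List (Fin n) → KS
  𝔞 X = map (λ σ → (1# , σ)) (symGroupOn X)

  𝔟 : List (Fin n) → KS
  𝔟 X = map (λ σ → (sgn σ , σ)) (symGroupOn X)

  𝔠 : Tableau n → KS
  𝔠 T = prod (map 𝔞 T) ⊗ prod (map 𝔟 (columns T))

  -- 1/r for r ≥ 1 (r = suc m); well defined since char K = 0. (Unused value at 0.)
  inv : ℕ → Carrier
  inv zero    = 0#
  inv (suc m) = proj₁ (inverse (embed F (suc m)) (charZero m))

  -- factors (1 - x̃_i / r̃_i) for the blocks, where L is l̃_1+...+l̃_{i-1}
  -- and u0 is the 0-based row index (so the paper's u is suc u0):
  -- r̃_i = l̃_1 + ... + l̃_i + u - h̃_i,  x̃_i = ∑_{b ∈ B̃_i} (a , b)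
  factors : Fin n → ℕ → ℕ → List (ℕ × List (List (Fin n))) → List KS
  factors a u0 L [] = []
  factors a u0 L ((h , b) ∷ bs) =
    (1ₐ ⊕ (-ᴷ inv (L + length b + suc u0 ∸ h)) ⊙ ∑ (map (λ e → ⟦ transpose a e ⟧) (concat b)))
    ∷ factors a u0 (L + length b) bs

-- Write ⋆ x L for the sum of the transpositions (x , e) with e ∈ L, and c for Young symmetrizers. The
-- Garnir relations say that c(T) ⋆ x C = c(T) for every column C at least as long as, and different
-- from, the column of x in T; the mirror images for rows hold on the left of c(S).
--
-- Put w = c(T) Π (1 - x̃ᵢ / r̃ᵢ). Multiplying in the blocks one at a time, the Garnir relations of T give:
-- column transpositions of S act on w by their sign, and for x in the j-th column of S the sum ⋆ x L
-- over all entries L of the previous columns acts on w by their number. These two properties alone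
-- force w c(S) = α_μ w. To see this, build S by adding cells x column by column, so that
-- c(x ∷ L) = (1 + Y) c(L) (1 - Z) with Y and Z the stars of x in its row and column; here w (1 - Z) is a
-- multiple of w by antisymmetry, and w Y c(L) is a multiple of w c(L), which is computed from the
-- bottom row upwards by comparing w ⋆ x L with the row Garnir relations of c(L). The resulting factors
-- telescope to the hook lengths. Finally w c(S) = c(T) c(S): a term containing (a , b) with b in a block
-- is negated by (e , b), where e is the entry of S in the row of b and the column of a, because e and b
-- are row mates in S while e and a are column mates in T.

module Submission where

-- The algebra uses only relations between transpositions, in an abstract setting whose axioms
-- survive reversal of products; this is what makes the left-hand mirror images available without a
-- second proof. The obstacle is that w is no longer a Young symmetrizer once a factor has been
-- multiplied in, so the relations of c(T) cannot be quoted for it. What is carried along is a list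
-- of eigenvalue equations, and each new factor has to restore those that it disturbs. For x in its
-- block, let X be the star of x over the j preceding columns. Then w X = j w - w (a , x) and w x̃ X
-- = j w x̃ - r̃ w (a , x), so the terms in (a , x) cancel in w (1 + s x̃) X for s = -1 / r̃. This
-- is the origin of r̃. A second obstacle lies in w Y c(L): moving the star of x over L through Y
-- creates stars over all lower rows, multiplied by those already present. The claim is therefore
-- strengthened by an arbitrary product z of stars of x over higher rows, inserted in front of c(L).

open import Level using (_⊔_) renaming (suc to lsuc)
open import Algebra.Bundles using (Ring; Semiring)
open import Algebra.Construct.Flip.Op using () renaming (ring to flip-ring)
open import Data.Nat using (ℕ; suc; _<_; _≤_)
open import Relation.Binary.Definitions using (DecidableEquality)
open import Relation.Binary.PropositionalEquality as ≡ using (_≡_; _≢_; ≢-sym)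
open import Defs using (Field; CharZero; embed)

-- Normal forms over a noncommutative semiring: sorted sums of monomials, a monomial being a sorted
-- product of central atoms times a word in the remaining atoms.
module CentralSemiringSolver {c ℓ} (R : Semiring c ℓ) where

  open import Data.Bool using (Bool; true; false; if_then_else_; _∨_; _∧_)
  open import Data.Fin using (Fin; toℕ)
  open import Data.List using (List; []; _∷_; _++_; [_])
  open import Data.Nat using (ℕ; _<ᵇ_; _≡ᵇ_)
  open import Data.Product using (Σ; _×_; _,_; proj₁; proj₂)
  open import Data.Vec using (Vec; lookup)
  open import Data.Vec.N-ary using (N-ary; _$ⁿ_)
  import Data.Vec as Vec
  open import Relation.Binary.PropositionalEquality as ≡ using (_≡_)
  open Semiring R
  open import Relation.Binary.Reasoning.Setoid setoid

  Central : Carrier → Set _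
  Central x = ∀ y → x * y ≈ y * x

  CentralElement : Set _
  CentralElement = Σ Carrier Central

  infixl 6 _:+_
  infixl 7 _:*_
  data Expr (m k : ℕ) : Set where
    var       : Fin m → Expr m k
    cen       : Fin k → Expr m k
    :0 :1     : Expr m k
    _:+_ _:*_ : Expr m k → Expr m k → Expr m k

  private module _ {m k : ℕ} (ρ : Vec Carrier m) (γ : Vec CentralElement k) where

    ⟦_⟧ : Expr m k → Carrier
    ⟦ var i ⟧  = lookup ρ i
    ⟦ cen i ⟧  = proj₁ (lookup γ i)
    ⟦ :0 ⟧     = 0#
    ⟦ :1 ⟧     = 1#
    ⟦ e :+ f ⟧ = ⟦ e ⟧ + ⟦ f ⟧
    ⟦ e :* f ⟧ = ⟦ e ⟧ * ⟦ f ⟧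

    Mono : Set
    Mono = List (Fin k) × List (Fin m)

    less : ∀ {p} → List (Fin p) → List (Fin p) → Bool
    less _        []       = false
    less []       (_ ∷ _)  = true
    less (x ∷ xs) (y ∷ ys) = (toℕ x <ᵇ toℕ y) ∨ ((toℕ x ≡ᵇ toℕ y) ∧ less xs ys)

    lessᵐ : Mono → Mono → Bool
    lessᵐ (c , w) (c′ , w′) = less w w′ ∨ (if less w′ w then false else less c c′)

    insertᶜ : Fin k → List (Fin k) → List (Fin k)
    insertᶜ x []       = [ x ]
    insertᶜ x (y ∷ ys) = if toℕ y <ᵇ toℕ x then y ∷ insertᶜ x ys else x ∷ y ∷ ys

    insert : Mono → List Mono → List Mono
    insert p []       = [ p ]
    insert p (q ∷ qs) = if lessᵐ q p then q ∷ insert p qs else p ∷ q ∷ qs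

    mergeᶜ : List (Fin k) → List (Fin k) → List (Fin k)
    mergeᶜ []       ys = ys
    mergeᶜ (x ∷ xs) ys = insertᶜ x (mergeᶜ xs ys)

    -- Equal monomials stay side by side, so an integer coefficient is represented by repetition.
    merge : List Mono → List Mono → List Mono
    merge []       qs = qs
    merge (p ∷ ps) qs = insert p (merge ps qs)

    mulᵐ : Mono → Mono → Mono
    mulᵐ (c , w) (c′ , w′) = mergeᶜ c c′ , w ++ w′

    mulˡ : Mono → List Mono → List Mono
    mulˡ p []       = []
    mulˡ p (q ∷ qs) = insert (mulᵐ p q) (mulˡ p qs)

    mul : List Mono → List Mono → List Mono
    mul []       qs = []
    mul (p ∷ ps) qs = merge (mulˡ p qs) (mul ps qs)

    normalise : Expr m k → List Mono
    normalise (var i)  = [ [] , [ i ] ]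
    normalise (cen i)  = [ [ i ] , [] ]
    normalise :0       = []
    normalise :1       = [ [] , [] ]
    normalise (e :+ f) = merge (normalise e) (normalise f)
    normalise (e :* f) = mul (normalise e) (normalise f)

    ⟦_⟧ᶜ : List (Fin k) → Carrier
    ⟦ [] ⟧ᶜ     = 1#
    ⟦ x ∷ xs ⟧ᶜ = proj₁ (lookup γ x) * ⟦ xs ⟧ᶜ

    ⟦_⟧ʷ : List (Fin m) → Carrier
    ⟦ [] ⟧ʷ     = 1#
    ⟦ x ∷ xs ⟧ʷ = lookup ρ x * ⟦ xs ⟧ʷ

    ⟦_⟧ᵐ : Mono → Carrier
    ⟦ c , w ⟧ᵐ = ⟦ c ⟧ᶜ * ⟦ w ⟧ʷ

    ⟦_⟧ᵖ : List Mono → Carrier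
    ⟦ [] ⟧ᵖ     = 0#
    ⟦ p ∷ ps ⟧ᵖ = ⟦ p ⟧ᵐ + ⟦ ps ⟧ᵖ

    exchange : ∀ (_∙_ : Carrier → Carrier → Carrier) → (∀ x y z → (x ∙ y) ∙ z ≈ x ∙ (y ∙ z)) →
      (∀ {x y z} → x ≈ y → x ∙ z ≈ y ∙ z) → ∀ x y z → x ∙ y ≈ y ∙ x → x ∙ (y ∙ z) ≈ y ∙ (x ∙ z)
    exchange _∙_ assoc congʳ x y z xy = trans (sym (assoc x y z)) (trans (congʳ xy) (assoc y x z))

    ⟦⟧ᶜ-central : ∀ c → Central ⟦ c ⟧ᶜ
    ⟦⟧ᶜ-central []      y = trans (*-identityˡ y) (sym (*-identityʳ y))
    ⟦⟧ᶜ-central (x ∷ c) y = begin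
      proj₁ (lookup γ x) * ⟦ c ⟧ᶜ * y   ≈⟨ *-assoc _ _ _ ⟩
      proj₁ (lookup γ x) * (⟦ c ⟧ᶜ * y) ≈⟨ *-congˡ (⟦⟧ᶜ-central c y) ⟩
      proj₁ (lookup γ x) * (y * ⟦ c ⟧ᶜ) ≈⟨ exchange _*_ *-assoc *-congʳ _ _ _ (proj₂ (lookup γ x) y) ⟩
      y * (proj₁ (lookup γ x) * ⟦ c ⟧ᶜ) ∎

    insertᶜ-sound : ∀ x c → ⟦ insertᶜ x c ⟧ᶜ ≈ proj₁ (lookup γ x) * ⟦ c ⟧ᶜ
    insertᶜ-sound x []      = refl
    insertᶜ-sound x (y ∷ c) with toℕ y <ᵇ toℕ x
    ... | false = refl
    ... | true  = trans (*-congˡ (insertᶜ-sound x c))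
                    (exchange _*_ *-assoc *-congʳ _ _ _ (proj₂ (lookup γ y) _))

    mergeᶜ-sound : ∀ c c′ → ⟦ mergeᶜ c c′ ⟧ᶜ ≈ ⟦ c ⟧ᶜ * ⟦ c′ ⟧ᶜ
    mergeᶜ-sound []      c′ = sym (*-identityˡ _)
    mergeᶜ-sound (x ∷ c) c′ = trans (insertᶜ-sound x (mergeᶜ c c′))
      (trans (*-congˡ (mergeᶜ-sound c c′)) (sym (*-assoc _ _ _)))

    ++-sound : ∀ w w′ → ⟦ w ++ w′ ⟧ʷ ≈ ⟦ w ⟧ʷ * ⟦ w′ ⟧ʷ
    ++-sound []      w′ = sym (*-identityˡ _)
    ++-sound (x ∷ w) w′ = trans (*-congˡ (++-sound w w′)) (sym (*-assoc _ _ _))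

    mulᵐ-sound : ∀ p q → ⟦ mulᵐ p q ⟧ᵐ ≈ ⟦ p ⟧ᵐ * ⟦ q ⟧ᵐ
    mulᵐ-sound (c , w) (c′ , w′) = begin
      ⟦ mergeᶜ c c′ ⟧ᶜ * ⟦ w ++ w′ ⟧ʷ         ≈⟨ *-cong (mergeᶜ-sound c c′) (++-sound w w′) ⟩
      ⟦ c ⟧ᶜ * ⟦ c′ ⟧ᶜ * (⟦ w ⟧ʷ * ⟦ w′ ⟧ʷ)   ≈⟨ *-assoc _ _ _ ⟩
      ⟦ c ⟧ᶜ * (⟦ c′ ⟧ᶜ * (⟦ w ⟧ʷ * ⟦ w′ ⟧ʷ)) ≈⟨ *-congˡ (exchange _*_ *-assoc *-congʳ _ _ _ (⟦⟧ᶜ-central c′ _)) ⟩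
      ⟦ c ⟧ᶜ * (⟦ w ⟧ʷ * (⟦ c′ ⟧ᶜ * ⟦ w′ ⟧ʷ)) ≈⟨ *-assoc _ _ _ ⟨
      ⟦ c ⟧ᶜ * ⟦ w ⟧ʷ * (⟦ c′ ⟧ᶜ * ⟦ w′ ⟧ʷ)   ∎

    insert-sound : ∀ p ps → ⟦ insert p ps ⟧ᵖ ≈ ⟦ p ⟧ᵐ + ⟦ ps ⟧ᵖ
    insert-sound p []       = refl
    insert-sound p (q ∷ qs) with lessᵐ q p
    ... | false = refl
    ... | true  = trans (+-congˡ (insert-sound p qs)) (exchange _+_ +-assoc +-congʳ _ _ _ (+-comm _ _))

    merge-sound : ∀ ps qs → ⟦ merge ps qs ⟧ᵖ ≈ ⟦ ps ⟧ᵖ + ⟦ qs ⟧ᵖ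
    merge-sound []       qs = sym (+-identityˡ _)
    merge-sound (p ∷ ps) qs = trans (insert-sound p (merge ps qs))
      (trans (+-congˡ (merge-sound ps qs)) (sym (+-assoc _ _ _)))

    mulˡ-sound : ∀ p qs → ⟦ mulˡ p qs ⟧ᵖ ≈ ⟦ p ⟧ᵐ * ⟦ qs ⟧ᵖ
    mulˡ-sound p []       = sym (zeroʳ _)
    mulˡ-sound p (q ∷ qs) = trans (insert-sound (mulᵐ p q) (mulˡ p qs))
      (trans (+-cong (mulᵐ-sound p q) (mulˡ-sound p qs)) (sym (distribˡ _ _ _)))

    mul-sound : ∀ ps qs → ⟦ mul ps qs ⟧ᵖ ≈ ⟦ ps ⟧ᵖ * ⟦ qs ⟧ᵖ
    mul-sound []       qs = sym (zeroˡ _)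
    mul-sound (p ∷ ps) qs = trans (merge-sound (mulˡ p qs) (mul ps qs))
      (trans (+-cong (mulˡ-sound p qs) (mul-sound ps qs)) (sym (distribʳ _ _ _)))

    sound : ∀ e → ⟦ normalise e ⟧ᵖ ≈ ⟦ e ⟧
    sound (var i)  = trans (+-identityʳ _) (trans (*-identityˡ _) (*-identityʳ _))
    sound (cen i)  = trans (+-identityʳ _) (trans (*-identityʳ _) (*-identityʳ _))
    sound :0       = refl
    sound :1       = trans (+-identityʳ _) (*-identityʳ _)
    sound (e :+ f) = trans (merge-sound (normalise e) (normalise f)) (+-cong (sound e) (sound f))
    sound (e :* f) = trans (mul-sound (normalise e) (normalise f)) (*-cong (sound e) (sound f))

  Equation : ℕ → ℕ → Set
  Equation m k = Expr m k × Expr m k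

  infix 4 _:=_
  _:=_ : ∀ {m k} → Expr m k → Expr m k → Equation m k
  _:=_ = _,_

  equation : ∀ m k → N-ary m (Expr m k) (N-ary k (Expr m k) (Equation m k)) → Equation m k
  equation m k f = _$ⁿ_ {n = k} (_$ⁿ_ {n = m} f (Vec.tabulate var)) (Vec.tabulate cen)

  Solution : ∀ {m k} (ρ : Vec Carrier m) (γ : Vec CentralElement k) → Equation m k → Set _
  Solution ρ γ (e₁ , e₂) = ⟦_⟧ ρ γ e₁ ≈ ⟦_⟧ ρ γ e₂

  -- The normal forms depend on the expressions alone, so callers pass `≡.refl`. The syntax has no
  -- subtraction; negatives enter through the central atom -1.
  solve : ∀ {m k} (ρ : Vec Carrier m) (γ : Vec CentralElement k)
    (f : N-ary m (Expr m k) (N-ary k (Expr m k) (Equation m k))) →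
    normalise ρ γ (proj₁ (equation m k f)) ≡ normalise ρ γ (proj₂ (equation m k f)) →
    Solution ρ γ (equation m k f)
  solve {m} {k} ρ γ f eq with equation m k f
  ... | e₁ , e₂ = trans (sym (sound ρ γ e₁)) (trans (reflexive (≡.cong (⟦_⟧ᵖ ρ γ) eq)) (sound ρ γ e₂))

-- Algebras with transpositions

record TranspositionAlgebra {f ℓf} (F : Field f ℓf) (V : Set) c ℓ : Set (f ⊔ ℓf ⊔ lsuc (c ⊔ ℓ)) where
  module K = Field F
  field
    ring : Ring c ℓ
  open Ring ring public
  field
    ι            : K.Carrier → Carrier
    ι-cong       : ∀ {r s} → r K.≈ s → ι r ≈ ι s
    ι-+          : ∀ r s → ι (r K.+ s) ≈ ι r + ι s
    ι-*          : ∀ r s → ι (r K.* s) ≈ ι r * ι s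
    ι-0          : ι K.0# ≈ 0#
    ι-1          : ι K.1# ≈ 1#
    ι-central    : ∀ r x → ι r * x ≈ x * ι r
    t            : V → V → Carrier
    t-sym        : ∀ x y → t x y ≈ t y x
    t-involutive : ∀ x y → t x y * t x y ≈ 1#
    -- The family of these relations is stable under reversal: read backwards, and with x and y
    -- exchanged, it is again of this shape. `opposite` rests on this.
    t-braid      : ∀ {x y z} → x ≢ y → x ≢ z → y ≢ z → t x y * t y z ≈ t x z * t x y
    t-comm       : ∀ {x y z w} → x ≢ z → x ≢ w → y ≢ z → y ≢ w → t x y * t z w ≈ t z w * t x y

-- Distinct entries and label classes in lists

module ListLemmas where

  open import Data.List using (List; []; _∷_; _++_; filter)
  open import Data.List.Properties using (filter-accept; filter-reject)
  open import Data.List.Membership.Propositional using (_∈_)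
  open import Data.List.Membership.Propositional.Properties using (∈-∃++; ∈-filter⁺; ∈-filter⁻; ∈-++⁺ˡ)
  open import Data.List.Relation.Binary.Permutation.Propositional as ↭ using (_↭_; ↭-trans; ↭-prep)
  open import Data.List.Relation.Binary.Permutation.Propositional.Properties using (∈-resp-↭; All-resp-↭; shift)
  open import Data.List.Relation.Unary.All as All using (All; []; _∷_)
  open import Data.List.Relation.Unary.Any using (here; there)
  open import Data.List.Relation.Unary.AllPairs using ([]; _∷_)
  open import Data.List.Relation.Unary.Unique.Propositional using (Unique)
  open import Data.Empty using (⊥-elim)
  open import Data.Nat using (ℕ; _≟_)
  open import Data.Product using (∃; _×_; _,_; proj₁)

  module _ {V : Set} where

    infix 4 _#_
    -- Non-membership is phrased as a family of inequalities, the form in which the relations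
    -- between transpositions consume it.
    _#_ : V → List V → Set
    x # L = ∀ {e} → e ∈ L → x ≢ e

    #-tail : ∀ {x y L} → x # y ∷ L → x # L
    #-tail x# e∈ = x# (there e∈)

    head# : ∀ {x : V} {L} → Unique (x ∷ L) → x # L
    head# (x# ∷ _) = All.lookup x#

    #⇒All : ∀ {x : V} {L} → x # L → All (x ≢_) L
    #⇒All x# = All.tabulate x#

    tail-unique : ∀ {x : V} {L} → Unique (x ∷ L) → Unique L
    tail-unique (_ ∷ U) = U

    Unique-resp-↭ : ∀ {L M : List V} → L ↭ M → Unique L → Unique M
    Unique-resp-↭ ↭.refl         U                  = U
    Unique-resp-↭ (↭.prep x p)   (x# ∷ U)           = All-resp-↭ p x# ∷ Unique-resp-↭ p U
    Unique-resp-↭ (↭.swap x y p) ((x≢y ∷ x#) ∷ (y# ∷ U)) =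
      ((λ eq → x≢y (≡.sym eq)) ∷ All-resp-↭ p y#) ∷ (All-resp-↭ p x# ∷ Unique-resp-↭ p U)
    Unique-resp-↭ (↭.trans p q)  U                  = Unique-resp-↭ q (Unique-resp-↭ p U)

    pluck : ∀ {x : V} {L} → x ∈ L → ∃ λ L′ → L ↭ x ∷ L′
    pluck {x} x∈ with ∈-∃++ x∈
    ... | ys , zs , ≡.refl = ys ++ zs , shift x ys zs

    pluck₂ : ∀ {x y : V} {L} → x ≢ y → x ∈ L → y ∈ L → ∃ λ L′ → L ↭ x ∷ y ∷ L′
    pluck₂ x≢y x∈ y∈ with pluck x∈
    ... | L₁ , p with ∈-resp-↭ p y∈
    ... | here y≡x  = ⊥-elim (x≢y (≡.sym y≡x))
    ... | there y∈₁ with pluck y∈₁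
    ... | L₂ , q = L₂ , ↭-trans p (↭-prep _ q)

    unique-++⁻ˡ : ∀ (L : List V) {M} → Unique (L ++ M) → Unique L
    unique-++⁻ˡ []      U = []
    unique-++⁻ˡ (x ∷ L) U = #⇒All (λ e∈ → head# U (∈-++⁺ˡ e∈)) ∷ unique-++⁻ˡ L (tail-unique U)

    unique-++⁻ʳ : ∀ (L : List V) {M} → Unique (L ++ M) → Unique M
    unique-++⁻ʳ []      U = U
    unique-++⁻ʳ (x ∷ L) U = unique-++⁻ʳ L (tail-unique U)

    -- With `row` or `col` as labelling this is a row or a column of a tableau. One notion serves
    -- both, because the Garnir relations are used with the two roles interchanged.
    class : (V → ℕ) → ℕ → List V → List V
    class ρ k = filter (λ e → ρ e ≟ k)

    module _ (ρ : V → ℕ) where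

      class-accept : ∀ {k x} L → ρ x ≡ k → class ρ k (x ∷ L) ≡ x ∷ class ρ k L
      class-accept L eq = filter-accept (λ e → ρ e ≟ _) eq

      class-reject : ∀ {k x} L → ρ x ≢ k → class ρ k (x ∷ L) ≡ class ρ k L
      class-reject L neq = filter-reject (λ e → ρ e ≟ _) neq

      ∈-class⁺ : ∀ {k e L} → e ∈ L → ρ e ≡ k → e ∈ class ρ k L
      ∈-class⁺ = ∈-filter⁺ (λ e → ρ e ≟ _)

      ∈-class⁻ : ∀ {k e} L → e ∈ class ρ k L → e ∈ L × ρ e ≡ k
      ∈-class⁻ L = ∈-filter⁻ (λ e → ρ e ≟ _) {xs = L}

      #-class : ∀ {x k L} → x # L → x # class ρ k L
      #-class {L = L} x# e∈ = x# (proj₁ (∈-class⁻ L e∈))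

-- Sums of transpositions

module Stars {f ℓf c ℓ} {F : Field f ℓf} {V : Set} (𝔸 : TranspositionAlgebra F V c ℓ) where

  open TranspositionAlgebra 𝔸
  open CentralSemiringSolver semiring public
  open ListLemmas
  open import Data.List using (List; []; _∷_; _++_; length; foldr)
  open import Data.List.Membership.Propositional using (_∈_)
  open import Data.List.Relation.Binary.Permutation.Propositional as ↭ using (_↭_)
  open import Data.List.Relation.Unary.Any using (here; there)
  open import Data.List.Relation.Unary.Unique.Propositional using (Unique)
  open import Data.Nat using (ℕ; suc)
  open import Data.Product using (_,_)
  open import Data.Vec using ([]; _∷_)
  open import Relation.Binary.Reasoning.Setoid setoid
  open import Algebra.Properties.Ring ring using (+-cancelʳ)

  -- Linear combination without subtraction: suitable multiples of known equations are collected
  -- into `y ≈ x`, with `x` added on the left and `y` on the right, until the remaining identity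
  -- holds formally.
  cancel-by : ∀ {l r x y} → l + x ≈ r + y → y ≈ x → l ≈ r
  cancel-by {l} {r} {x} {y} eq y≈x = +-cancelʳ x l r (trans eq (+-congˡ y≈x))

  scalar : K.Carrier → CentralElement
  scalar r = ι r , ι-central r

  nat : ℕ → Carrier
  nat m = ι (embed F m)

  natural : ℕ → CentralElement
  natural m = scalar (embed F m)

  nat-suc : ∀ m → nat (suc m) ≈ 1# + nat m
  nat-suc m = trans (ι-+ _ _) (+-congʳ ι-1)

  ∑ : (V → Carrier) → List V → Carrier
  ∑ g = foldr (λ e s → g e + s) 0#

  -- Over all entries placed before x this is a Jucys-Murphy element, which explains why its
  -- eigenvalues below are contents of cells.
  ⋆ : V → List V → Carrier
  ⋆ x = ∑ (t x)

  ∑-cong : ∀ {g h} L → (∀ {e} → e ∈ L → g e ≈ h e) → ∑ g L ≈ ∑ h L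
  ∑-cong []      eq = refl
  ∑-cong (x ∷ L) eq = +-cong (eq (here ≡.refl)) (∑-cong L λ e∈ → eq (there e∈))

  ∑-++ : ∀ g L M → ∑ g (L ++ M) ≈ ∑ g L + ∑ g M
  ∑-++ g []      M = sym (+-identityˡ _)
  ∑-++ g (x ∷ L) M = trans (+-congˡ (∑-++ g L M)) (sym (+-assoc _ _ _))

  ∑-↭ : ∀ g {L M} → L ↭ M → ∑ g L ≈ ∑ g M
  ∑-↭ g ↭.refl         = refl
  ∑-↭ g (↭.prep x p)   = +-congˡ (∑-↭ g p)
  ∑-↭ g (↭.swap x y p) = trans (+-congˡ (+-congˡ (∑-↭ g p)))
    (solve (g x ∷ g y ∷ _ ∷ []) [] (λ x y z → x :+ (y :+ z) := y :+ (x :+ z)) ≡.refl)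
  ∑-↭ g (↭.trans p q)  = trans (∑-↭ g p) (∑-↭ g q)

  ∑-*ˡ : ∀ a g L → a * ∑ g L ≈ ∑ (λ e → a * g e) L
  ∑-*ˡ a g []      = zeroʳ a
  ∑-*ˡ a g (x ∷ L) = trans (distribˡ _ _ _) (+-congˡ (∑-*ˡ a g L))

  ∑-*ʳ : ∀ a g L → ∑ g L * a ≈ ∑ (λ e → g e * a) L
  ∑-*ʳ a g []      = zeroˡ a
  ∑-*ʳ a g (x ∷ L) = trans (distribʳ _ _ _) (+-congˡ (∑-*ʳ a g L))

  ∑-+ : ∀ g h L → ∑ (λ e → g e + h e) L ≈ ∑ g L + ∑ h L
  ∑-+ g h []      = sym (+-identityˡ _)
  ∑-+ g h (x ∷ L) = trans (+-congˡ (∑-+ g h L))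
    (solve (g x ∷ h x ∷ ∑ g L ∷ ∑ h L ∷ []) [] (λ x y z w → (x :+ y) :+ (z :+ w) := (x :+ z) :+ (y :+ w)) ≡.refl)

  ∑-const : ∀ a L → ∑ (λ _ → a) L ≈ nat (length L) * a
  ∑-const a []      = sym (trans (*-congʳ ι-0) (zeroˡ a))
  ∑-const a (x ∷ L) = sym (trans (*-congʳ (nat-suc (length L)))
    (trans (distribʳ _ _ _) (+-cong (*-identityˡ a) (sym (∑-const a L)))))

  ∑-intertwine : ∀ a b {g h} L → (∀ {e} → e ∈ L → a * g e ≈ h e * b) → a * ∑ g L ≈ ∑ h L * b
  ∑-intertwine a b {g} {h} L eq = trans (∑-*ˡ a g L) (trans (∑-cong L eq) (sym (∑-*ʳ b h L)))

  ⋆-disjoint : ∀ {x y z} L → z ≢ x → z ≢ y → x # L → y # L → t x y * ⋆ z L ≈ ⋆ z L * t x y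
  ⋆-disjoint L z≢x z≢y x# y# = ∑-intertwine _ _ L λ e∈ →
    t-comm (λ eq → z≢x (≡.sym eq)) (x# e∈) (λ eq → z≢y (≡.sym eq)) (y# e∈)

  -- Conjugation by (x , y) renames x to y and fixes every entry of L.
  ⋆-turn : ∀ {x y} L → x ≢ y → x # L → y # L → t x y * ⋆ x L ≈ ⋆ y L * t x y
  ⋆-turn {x} {y} L x≢y x# y# = ∑-intertwine _ _ L λ {e} e∈ → begin
    t x y * t x e ≈⟨ *-congʳ (t-sym x y) ⟩
    t y x * t x e ≈⟨ t-braid (λ eq → x≢y (≡.sym eq)) (y# e∈) (x# e∈) ⟩
    t y e * t y x ≈⟨ *-congˡ (t-sym y x) ⟩
    t y e * t x y ∎

  t-swap : ∀ {x y z} → x ≢ y → z ≢ x → z ≢ y → t x y * t z x ≈ t z y * t x y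
  t-swap {x} {y} {z} x≢y z≢x z≢y = begin
    t x y * t z x ≈⟨ *-cong (t-sym x y) (t-sym z x) ⟩
    t y x * t x z ≈⟨ t-braid (λ eq → x≢y (≡.sym eq)) (λ eq → z≢y (≡.sym eq)) (λ eq → z≢x (≡.sym eq)) ⟩
    t y z * t y x ≈⟨ *-cong (t-sym y z) (t-sym y x) ⟩
    t z y * t x y ∎

  t-swap′ : ∀ {x y z} → x ≢ y → z ≢ x → z ≢ y → t x y * t z y ≈ t z x * t x y
  t-swap′ {x} {y} x≢y z≢x z≢y = trans (*-congʳ (t-sym x y))
    (trans (t-swap (λ eq → x≢y (≡.sym eq)) z≢y z≢x) (*-congˡ (t-sym y x)))

  -- Conjugation by (x , y) exchanges the summands (z , x) and (z , y) and fixes all the others.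
  ⋆-inside : ∀ {x y z L} → Unique L → x ≢ y → x ∈ L → y ∈ L → z # L → t x y * ⋆ z L ≈ ⋆ z L * t x y
  ⋆-inside {x} {y} {z} {L} U x≢y x∈ y∈ z# with pluck₂ x≢y x∈ y∈
  ... | M , p = begin
    t x y * ⋆ z L                   ≈⟨ *-congˡ (∑-↭ (t z) p) ⟩
    t x y * (t z x + (t z y + ⋆ z M)) ≈⟨ distribˡ _ _ _ ⟩
    t x y * t z x + t x y * (t z y + ⋆ z M) ≈⟨ +-congˡ (distribˡ _ _ _) ⟩
    t x y * t z x + (t x y * t z y + t x y * ⋆ z M)
      ≈⟨ +-cong (t-swap x≢y (z# x∈) (z# y∈)) (+-cong (t-swap′ x≢y (z# x∈) (z# y∈))
           (⋆-disjoint M (z# x∈) (z# y∈) (#-tail (head# U′)) (head# (tail-unique U′)))) ⟩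
    t z y * t x y + (t z x * t x y + ⋆ z M * t x y)
      ≈⟨ solve (t x y ∷ t z x ∷ t z y ∷ ⋆ z M ∷ []) []
           (λ s a b m → b :* s :+ (a :* s :+ m :* s) := (a :+ (b :+ m)) :* s) ≡.refl ⟩
    (t z x + (t z y + ⋆ z M)) * t x y ≈⟨ *-congʳ (∑-↭ (t z) p) ⟨
    ⋆ z L * t x y                   ∎
    where U′ = Unique-resp-↭ p U

  -- An element is recorded together with its construction, so that commutation or annihilation can
  -- be proved by induction from the generators. Generators carry `x ≢ y` because the braid relation
  -- requires distinct letters.
  data Subalgebra (G : V → V → Set) : Carrier → Set (c ⊔ ℓ ⊔ f) where
    scal  : ∀ r → Subalgebra G (ι r)
    gen   : ∀ {x y} → x ≢ y → G x y → Subalgebra G (t x y)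
    _⊞_   : ∀ {g h} → Subalgebra G g → Subalgebra G h → Subalgebra G (g + h)
    _⊠_   : ∀ {g h} → Subalgebra G g → Subalgebra G h → Subalgebra G (g * h)
    resp  : ∀ {g h} → g ≈ h → Subalgebra G g → Subalgebra G h

  sub-1 : ∀ {G} → Subalgebra G 1#
  sub-1 = resp ι-1 (scal _)

  sub-∑ : ∀ {G g} L → (∀ {e} → e ∈ L → Subalgebra G (g e)) → Subalgebra G (∑ g L)
  sub-∑ []      sub = resp ι-0 (scal _)
  sub-∑ (x ∷ L) sub = sub (here ≡.refl) ⊞ sub-∑ L λ e∈ → sub (there e∈)

  sub-⊆ : ∀ {G H g} → (∀ {x y} → x ≢ y → G x y → H x y) → Subalgebra G g → Subalgebra H g
  sub-⊆ i (scal r)    = scal r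
  sub-⊆ i (gen x≢y g) = gen x≢y (i x≢y g)
  sub-⊆ i (p ⊞ q)     = sub-⊆ i p ⊞ sub-⊆ i q
  sub-⊆ i (p ⊠ q)     = sub-⊆ i p ⊠ sub-⊆ i q
  sub-⊆ i (resp eq p) = resp eq (sub-⊆ i p)

  sub-commute : ∀ {G h g} → (∀ {x y} → x ≢ y → G x y → t x y * h ≈ h * t x y) → Subalgebra G g → g * h ≈ h * g
  sub-commute com (scal r)    = ι-central r _
  sub-commute com (gen x≢y g) = com x≢y g
  sub-commute com (p ⊞ q)     = trans (distribʳ _ _ _)
    (trans (+-cong (sub-commute com p) (sub-commute com q)) (sym (distribˡ _ _ _)))
  sub-commute {h = h} com (_⊠_ {g} {g′} p q) = begin
    g * g′ * h   ≈⟨ *-assoc _ _ _ ⟩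
    g * (g′ * h) ≈⟨ *-congˡ (sub-commute com q) ⟩
    g * (h * g′) ≈⟨ *-assoc _ _ _ ⟨
    g * h * g′   ≈⟨ *-congʳ (sub-commute com p) ⟩
    h * g * g′   ≈⟨ *-assoc _ _ _ ⟩
    h * (g * g′) ∎
  sub-commute com (resp eq p) = trans (*-congʳ (sym eq)) (trans (sub-commute com p) (*-congˡ eq))

-- Symmetrizers of labelled sets

module Symmetrizers {f ℓf c ℓ} {F : Field f ℓf} {V : Set} (𝔸 : TranspositionAlgebra F V c ℓ) where

  open TranspositionAlgebra 𝔸
  open Stars 𝔸
  open ListLemmas
  open import Data.List using (List; []; _∷_)
  open import Data.List.Membership.Propositional using (_∈_)
  open import Data.List.Relation.Binary.Permutation.Propositional as ↭ using (_↭_; ↭-sym)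
  open import Data.List.Relation.Binary.Permutation.Propositional.Properties using (∈-resp-↭; filter-↭)
  open import Data.List.Relation.Unary.Any using (here; there)
  open import Data.List.Relation.Unary.Unique.Propositional using (Unique)
  open import Data.List.Relation.Unary.Unique.Propositional.Properties using (filter⁺)
  open import Data.List.Relation.Unary.AllPairs using ([]; _∷_)
  open import Data.List.Relation.Unary.All using ([]; _∷_)
  open import Data.Nat using (ℕ; _≟_)
  open import Data.Product using (_,_; proj₂)
  open import Data.Empty using (⊥-elim)
  open import Data.Vec using ([]; _∷_)
  open import Relation.Nullary using (yes; no)
  open import Relation.Binary.Reasoning.Setoid setoid

  module _ (ρ : V → ℕ) where

    SameClass : List V → V → V → Set
    SameClass L x y = x ∈ L Data.Product.× y ∈ L Data.Product.× ρ x ≡ ρ y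

    class-unique : ∀ k {L} → Unique L → Unique (class ρ k L)
    class-unique k = filter⁺ (λ e → ρ e ≟ k)

    class-↭ : ∀ k {L M} → L ↭ M → class ρ k L ↭ class ρ k M
    class-↭ k = filter-↭ (λ e → ρ e ≟ k)

    -- Having the same label, x and y lie both inside or both outside the class, so conjugation by
    -- (x , y) permutes or fixes the summands.
    t-⋆-class : ∀ {x y z k L} → Unique L → x ≢ y → x ∈ L → y ∈ L → ρ x ≡ ρ y → z # L →
      t x y * ⋆ z (class ρ k L) ≈ ⋆ z (class ρ k L) * t x y
    t-⋆-class {x} {y} {z} {k} {L} U x≢y x∈ y∈ ρxy z# with ρ x ≟ k
    ... | yes ρx≡k = ⋆-inside (class-unique k U) x≢y (∈-class⁺ ρ x∈ ρx≡k)
                       (∈-class⁺ ρ y∈ (≡.trans (≡.sym ρxy) ρx≡k)) (#-class ρ z#)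
    ... | no ρx≢k  = ⋆-disjoint (class ρ k L) (z# x∈) (z# y∈)
      (λ e∈ x≡e → ρx≢k (≡.trans (≡.cong ρ x≡e) (proj₂ (∈-class⁻ ρ L e∈))))
      (λ e∈ y≡e → ρx≢k (≡.trans ρxy (≡.trans (≡.cong ρ y≡e) (proj₂ (∈-class⁻ ρ L e∈)))))

  module Symmetrizer (ρ : V → ℕ) (ε : K.Carrier) (ε² : ε K.* ε K.≈ K.1#) where

    e : Carrier
    e = ι ε

    e² : e * e ≈ 1#
    e² = trans (sym (ι-* ε ε)) (trans (ι-cong ε²) ι-1)

    -- The product over the classes X of ρ of Σ σ (if ε = 1) or Σ sgn(σ) σ (if ε = -1) over 𝔖_X, with the
    -- coset representatives 1 and (x , y) of 𝔖_X in 𝔖_{x ∷ X} collected into 1 + ε ⋆ x X.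
    Sym : List V → Carrier
    Sym []      = 1#
    Sym (x ∷ L) = (1# + e * ⋆ x (class ρ (ρ x) L)) * Sym L

    Sym-subalgebra : ∀ {L} → Unique L → Subalgebra (SameClass ρ L) (Sym L)
    Sym-subalgebra {[]}    U = sub-1
    Sym-subalgebra {x ∷ L} U = (sub-1 ⊞ (scal ε ⊠ sub-∑ (class ρ (ρ x) L) star)) ⊠
      sub-⊆ (λ { _ (x∈ , y∈ , eq) → there x∈ , there y∈ , eq }) (Sym-subalgebra (tail-unique U))
      where
      star : ∀ {y} → y ∈ class ρ (ρ x) L → Subalgebra (SameClass ρ (x ∷ L)) (t x y)
      star y∈ with ∈-class⁻ ρ L y∈
      ... | y∈L , eq = gen (head# U y∈L) (here ≡.refl , there y∈L , ≡.sym eq)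

    Sym-⋆ : ∀ {L z k} → Unique L → z # L → Sym L * ⋆ z (class ρ k L) ≈ ⋆ z (class ρ k L) * Sym L
    Sym-⋆ U z# = sub-commute (λ { x≢y (x∈ , y∈ , eq) → t-⋆-class ρ U x≢y x∈ y∈ eq z# }) (Sym-subalgebra U)

    -- Left multiplication by (z , y) permutes the coset representatives: it exchanges 1 and (z ,
    -- y), and it sends (z , x) to (z , x) (x , y), where the last factor is absorbed by `s`. The
    -- exchange costs a sign ε because ε² = 1.
    t-antisymmetrises : ∀ {z y C s} → Unique C → z # C → y ∈ C →
      (∀ {x} → x ≢ y → x ∈ C → t x y * s ≈ e * s) →
      t z y * ((1# + e * ⋆ z C) * s) ≈ e * ((1# + e * ⋆ z C) * s)
    t-antisymmetrises {z} {y} {C} {s} U z# y∈ abs with pluck y∈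
    ... | M , p = begin
      t z y * ((1# + e * ⋆ z C) * s)
        ≈⟨ *-congˡ (*-congʳ (+-congˡ (*-congˡ (∑-↭ (t z) p)))) ⟩
      t z y * ((1# + e * (t z y + ⋆ z M)) * s)
        ≈⟨ solve (t z y ∷ ⋆ z M ∷ s ∷ []) (scalar ε ∷ [])
             (λ a m s e → a :* ((:1 :+ e :* (a :+ m)) :* s) := a :* s :+ e :* (a :* a) :* s :+ e :* (a :* m :* s)) ≡.refl ⟩
      t z y * s + e * (t z y * t z y) * s + e * (t z y * ⋆ z M * s)
        ≈⟨ +-cong (+-congˡ (*-congʳ (*-congˡ (t-involutive z y)))) (*-congˡ star) ⟩
      t z y * s + e * 1# * s + e * (e * (⋆ z M * s))
        ≈⟨ +-cong (+-congʳ (trans (sym (*-identityˡ _)) (*-congʳ (sym e²)))) refl ⟩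
      e * e * (t z y * s) + e * 1# * s + e * (e * (⋆ z M * s))
        ≈⟨ solve (t z y ∷ ⋆ z M ∷ s ∷ []) (scalar ε ∷ [])
             (λ a m s e → e :* e :* (a :* s) :+ e :* :1 :* s :+ e :* (e :* (m :* s)) := e :* ((:1 :+ e :* (a :+ m)) :* s)) ≡.refl ⟩
      e * ((1# + e * (t z y + ⋆ z M)) * s)
        ≈⟨ *-congˡ (*-congʳ (+-congˡ (*-congˡ (∑-↭ (t z) p)))) ⟨
      e * ((1# + e * ⋆ z C) * s) ∎
      where
      y∉M : y # M
      y∉M = head# (Unique-resp-↭ p U)
      up : ∀ {x} → x ∈ M → x ∈ C
      up x∈ = ∈-resp-↭ (↭-sym p) (there x∈)
      z≢y : z ≢ y
      z≢y = z# y∈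
      star : t z y * ⋆ z M * s ≈ e * (⋆ z M * s)
      star = begin
        t z y * ⋆ z M * s                   ≈⟨ *-congʳ (∑-*ˡ _ _ M) ⟩
        ∑ (λ x → t z y * t z x) M * s       ≈⟨ ∑-*ʳ _ _ M ⟩
        ∑ (λ x → t z y * t z x * s) M       ≈⟨ ∑-cong M (λ {x} x∈ → begin
            t z y * t z x * s   ≈⟨ *-congʳ (trans (*-congʳ (t-sym z y)) (*-congˡ (t-sym z x))) ⟩
            t y z * t x z * s   ≈⟨ *-congʳ (*-congˡ (t-sym x z)) ⟩
            t y z * t z x * s   ≈⟨ *-congʳ (t-braid (≢-sym z≢y) (y∉M x∈) (z# (up x∈))) ⟩
            t y x * t y z * s   ≈⟨ *-congʳ (*-congʳ (t-sym y x)) ⟩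
            t x y * t y z * s   ≈⟨ *-congʳ (t-braid (≢-sym (y∉M x∈)) (≢-sym (z# (up x∈))) (≢-sym z≢y)) ⟩
            t x z * t x y * s   ≈⟨ *-assoc _ _ _ ⟩
            t x z * (t x y * s) ≈⟨ *-congˡ (abs (≢-sym (y∉M x∈)) (up x∈)) ⟩
            t x z * (e * s)     ≈⟨ *-congʳ (t-sym x z) ⟩
            t z x * (e * s)     ≈⟨ solve (t z x ∷ s ∷ []) (scalar ε ∷ []) (λ a s e → a :* (e :* s) := e :* a :* s) ≡.refl ⟩
            e * t z x * s       ∎) ⟩
        ∑ (λ x → e * t z x * s) M           ≈⟨ ∑-*ʳ _ _ M ⟨
        ∑ (λ x → e * t z x) M * s           ≈⟨ *-congʳ (∑-*ˡ _ _ M) ⟨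
        e * ⋆ z M * s                       ≈⟨ *-assoc _ _ _ ⟩
        e * (⋆ z M * s)                     ∎

    -- Only a transposition that involves the newest entry needs an argument; one between older
    -- entries passes through the star by `t-⋆-class`.
    Sym-absorbˡ : ∀ {L x y} → Unique L → x ≢ y → x ∈ L → y ∈ L → ρ x ≡ ρ y → t x y * Sym L ≈ e * Sym L
    Sym-absorbˡ {z ∷ L} U x≢y (here ≡.refl) (here ≡.refl) eq = ⊥-elim (x≢y ≡.refl)
    Sym-absorbˡ {z ∷ L} U x≢y (here ≡.refl) (there y∈) eq =
      t-antisymmetrises (class-unique ρ _ (tail-unique U)) (#-class ρ (head# U)) (∈-class⁺ ρ y∈ (≡.sym eq))
        λ x≢y x∈ → let x∈L , ρx = ∈-class⁻ ρ L x∈ in Sym-absorbˡ (tail-unique U) x≢y x∈L y∈ (≡.trans ρx eq)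
    Sym-absorbˡ {z ∷ L} U x≢y (there x∈) (here ≡.refl) eq =
      trans (*-congʳ (t-sym _ _))
        (t-antisymmetrises (class-unique ρ _ (tail-unique U)) (#-class ρ (head# U)) (∈-class⁺ ρ x∈ eq)
          λ w≢x w∈ → let w∈L , ρw = ∈-class⁻ ρ L w∈ in
            Sym-absorbˡ (tail-unique U) w≢x w∈L x∈ (≡.trans ρw (≡.sym eq)))
    Sym-absorbˡ {z ∷ L} {x} {y} U x≢y (there x∈) (there y∈) eq = begin
      t x y * ((1# + e * S) * Sym L)
        ≈⟨ solve (t x y ∷ S ∷ Sym L ∷ []) (scalar ε ∷ [])
             (λ a s q e → a :* ((:1 :+ e :* s) :* q) := a :* q :+ e :* (a :* s) :* q) ≡.refl ⟩
      t x y * Sym L + e * (t x y * S) * Sym L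
        ≈⟨ +-congˡ (*-congʳ (*-congˡ (t-⋆-class ρ (tail-unique U) x≢y x∈ y∈ eq (head# U)))) ⟩
      t x y * Sym L + e * (S * t x y) * Sym L
        ≈⟨ solve (t x y ∷ S ∷ Sym L ∷ []) (scalar ε ∷ [])
             (λ a s q e → a :* q :+ e :* (s :* a) :* q := (:1 :+ e :* s) :* (a :* q)) ≡.refl ⟩
      (1# + e * S) * (t x y * Sym L)
        ≈⟨ *-congˡ (Sym-absorbˡ (tail-unique U) x≢y x∈ y∈ eq) ⟩
      (1# + e * S) * (e * Sym L)
        ≈⟨ solve (S ∷ Sym L ∷ []) (scalar ε ∷ []) (λ s q e → (:1 :+ e :* s) :* (e :* q) := e :* ((:1 :+ e :* s) :* q)) ≡.refl ⟩
      e * ((1# + e * S) * Sym L) ∎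
      where S = ⋆ z (class ρ (ρ z) L)

    -- This is the commutation of the Jucys-Murphy elements ⋆ y C and (x , y) + ⋆ x C, rewritten by
    -- `⋆-turn` so that the two sides differ by exchanging x and y.
    ⋆-commutator : ∀ {x y} C → x ≢ y → x # C → y # C → Unique C →
      t x y * ⋆ y C + ⋆ x C * ⋆ y C ≈ t x y * ⋆ x C + ⋆ y C * ⋆ x C
    ⋆-commutator []      x≢y x# y# U = refl
    ⋆-commutator {x} {y} (z ∷ C) x≢y x# y# U = cancel-by
      (solve (t x y ∷ t x z ∷ t y z ∷ ⋆ x C ∷ ⋆ y C ∷ []) []
        (λ s a b X Y → (s :* (b :+ Y) :+ (a :+ X) :* (b :+ Y))
                         :+ ((s :* X :+ Y :* X) :+ s :* a :+ b :* X :+ Y :* a :+ b :* a)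
                    := (s :* (a :+ X) :+ (b :+ Y) :* (a :+ X))
                         :+ ((s :* Y :+ X :* Y) :+ a :* b :+ X :* b :+ a :* Y :+ s :* b)) ≡.refl)
      (sym (+-cong (+-cong (+-cong (+-cong
        (sym (⋆-commutator C x≢y (#-tail x#) (#-tail y#) (tail-unique U)))
        (sym ab)) (⋆-disjoint C x≢y x≢z (#-tail y#) (head# U)))
        (sym (⋆-disjoint C (≢-sym x≢y) y≢z (#-tail x#) (head# U)))) ba))
      where
      x≢z : x ≢ z
      x≢z = x# (here ≡.refl)
      y≢z : y ≢ z
      y≢z = y# (here ≡.refl)
      ab : t x z * t y z ≈ t x y * t x z
      ab = trans (*-congˡ (t-sym y z)) (t-braid x≢z x≢y (≢-sym y≢z))
      ba : t y z * t x z ≈ t x y * t y z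
      ba = trans (*-congˡ (t-sym x z)) (trans (t-braid y≢z (≢-sym x≢y) (≢-sym x≢z)) (*-congʳ (t-sym y x)))

    -- It makes `Sym` independent of the listing, so one symmetrizer can be read by rows, by columns
    -- or cell by cell. For equal labels the reason is `⋆-commutator`; for different labels the two
    -- stars move disjoint sets of letters.
    Sym-swap : ∀ x y L → Unique (x ∷ y ∷ L) → Sym (x ∷ y ∷ L) ≈ Sym (y ∷ x ∷ L)
    Sym-swap x y L ((x≢y ∷ _) ∷ _) with ρ x ≟ ρ y
    Sym-swap x y L U@((x≢y ∷ _) ∷ _) | yes eq
      rewrite class-accept ρ {ρ x} {y} L (≡.sym eq) | class-accept ρ {ρ y} {x} L eq | eq = begin
      (1# + e * (t x y + X)) * ((1# + e * Y) * Sym L)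
        ≈⟨ solve (t x y ∷ X ∷ Y ∷ Sym L ∷ []) (scalar ε ∷ [])
             (λ a X Y s e → (:1 :+ e :* (a :+ X)) :* ((:1 :+ e :* Y) :* s)
                := (:1 :+ e :* (a :+ X :+ Y) :+ e :* e :* (a :* Y :+ X :* Y)) :* s) ≡.refl ⟩
      (1# + e * (t x y + X + Y) + e * e * (t x y * Y + X * Y)) * Sym L
        ≈⟨ *-congʳ (+-cong (+-congˡ (*-congˡ (+-congʳ (+-congʳ (t-sym x y)))))
             (*-congˡ (trans (⋆-commutator C x≢y (#-class ρ (#-tail (head# U))) (#-class ρ (head# (tail-unique U)))
               (class-unique ρ _ (tail-unique (tail-unique U)))) (+-congʳ (*-congʳ (t-sym x y)))))) ⟩
      (1# + e * (t y x + X + Y) + e * e * (t y x * X + Y * X)) * Sym L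
        ≈⟨ solve (t y x ∷ X ∷ Y ∷ Sym L ∷ []) (scalar ε ∷ [])
             (λ a X Y s e → (:1 :+ e :* (a :+ X :+ Y) :+ e :* e :* (a :* X :+ Y :* X)) :* s
                := (:1 :+ e :* (a :+ Y)) :* ((:1 :+ e :* X) :* s)) ≡.refl ⟩
      (1# + e * (t y x + Y)) * ((1# + e * X) * Sym L) ∎
      where
      C = class ρ (ρ y) L
      X = ⋆ x C
      Y = ⋆ y C
    Sym-swap x y L U@((x≢y ∷ _) ∷ _) | no neq
      rewrite class-reject ρ {ρ x} {y} L (λ eq → neq (≡.sym eq)) | class-reject ρ {ρ y} {x} L neq = begin
      (1# + e * X) * ((1# + e * Y) * Sym L)
        ≈⟨ solve (X ∷ Y ∷ Sym L ∷ []) (scalar ε ∷ [])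
             (λ X Y s e → (:1 :+ e :* X) :* ((:1 :+ e :* Y) :* s)
                := (:1 :+ e :* (X :+ Y) :+ e :* e :* (X :* Y)) :* s) ≡.refl ⟩
      (1# + e * (X + Y) + e * e * (X * Y)) * Sym L
        ≈⟨ *-congʳ (+-congˡ (*-congˡ XY)) ⟩
      (1# + e * (X + Y) + e * e * (Y * X)) * Sym L
        ≈⟨ solve (X ∷ Y ∷ Sym L ∷ []) (scalar ε ∷ [])
             (λ X Y s e → (:1 :+ e :* (X :+ Y) :+ e :* e :* (Y :* X)) :* s
                := (:1 :+ e :* Y) :* ((:1 :+ e :* X) :* s)) ≡.refl ⟩
      (1# + e * Y) * ((1# + e * X) * Sym L) ∎
      where
      X = ⋆ x (class ρ (ρ x) L)
      Y = ⋆ y (class ρ (ρ y) L)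
      XY : X * Y ≈ Y * X
      XY = sym (∑-intertwine Y Y (class ρ (ρ x) L) λ {z} z∈ →
        let z∈L , ρz = ∈-class⁻ ρ L z∈ in
        sym (⋆-disjoint (class ρ (ρ y) L) (≢-sym x≢y) (head# (tail-unique U) z∈L)
          (#-class ρ (#-tail (head# U)))
          (λ w∈ z≡w → neq (≡.trans (≡.sym ρz) (≡.trans (≡.cong ρ z≡w) (proj₂ (∈-class⁻ ρ L w∈)))))))

    Sym-prep : ∀ x {L M} → L ↭ M → Sym L ≈ Sym M → Sym (x ∷ L) ≈ Sym (x ∷ M)
    Sym-prep x p = *-cong (+-congˡ (*-congˡ (∑-↭ (t x) (class-↭ ρ (ρ x) p))))

    Sym-↭ : ∀ {L M} → Unique L → L ↭ M → Sym L ≈ Sym M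
    Sym-↭ U ↭.refl         = refl
    Sym-↭ U (↭.prep x p)   = Sym-prep x p (Sym-↭ (tail-unique U) p)
    Sym-↭ {L = _ ∷ _ ∷ L} U (↭.swap x y p) = trans (Sym-swap x y L U)
      (Sym-prep y (↭.prep x p) (Sym-prep x p (Sym-↭ (tail-unique (tail-unique U)) p)))
    Sym-↭ U (↭.trans p q)  = trans (Sym-↭ U p) (Sym-↭ (Unique-resp-↭ p U) q)

-- Reversal of products turns the relations for right multiplication by stars into those for left
-- multiplication.
opposite : ∀ {f ℓf c ℓ} {F : Field f ℓf} {V : Set} → TranspositionAlgebra F V c ℓ → TranspositionAlgebra F V c ℓ
opposite 𝔸 = record
  { ring = flip-ring ring
  ; ι = ι ; ι-cong = ι-cong ; ι-+ = ι-+ ; ι-0 = ι-0 ; ι-1 = ι-1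
  ; ι-* = λ r s → trans (ι-* r s) (ι-central r (ι s))
  ; ι-central = λ r x → sym (ι-central r x)
  ; t = t ; t-sym = t-sym ; t-involutive = t-involutive
  ; t-braid = λ {x} {y} {z} x≢y x≢z y≢z → sym (trans (*-congʳ (t-sym x y))
      (trans (t-braid (λ eq → x≢y (≡.sym eq)) y≢z x≢z) (*-congˡ (t-sym y x))))
  ; t-comm = λ x≢z x≢w y≢z y≢w → sym (t-comm x≢z x≢w y≢z y≢w)
  }
  where open TranspositionAlgebra 𝔸

-- Reciprocals of positive integers

module CharacteristicZero {f ℓf} {F : Field f ℓf} (charZero : CharZero F) where

  open import Data.List using (List; []; _∷_)
  open import Data.Nat using (ℕ; suc; _∸_)
  open import Data.Product using (proj₁; proj₂)
  open Field F

  -- The inverse of m + 1: the offset keeps the denominator nonzero, and each denominator below is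
  -- given through its predecessor.
  recip : ℕ → Carrier
  recip m = proj₁ (inverse (embed F (suc m)) (charZero m))

  embed-recip : ∀ m → embed F (suc m) * recip m ≈ 1#
  embed-recip m = proj₂ (inverse (embed F (suc m)) (charZero m))

  -- If rows of lengths qs lie below a row of length l, then rowFactor (suc l) qs is the product of
  -- (hook + 1) / hook over that row.
  rowFactor : ℕ → List ℕ → Carrier
  rowFactor m []       = embed F m
  rowFactor m (q ∷ qs) = rowFactor (suc m) qs * (embed F (m ∸ q) * recip (m ∸ q))

-- Garnir relations

module Garnir {f ℓf c ℓ} {F : Field f ℓf} (charZero : CharZero F) {V : Set}
  (_≟ⱽ_ : DecidableEquality V) (𝔸 : TranspositionAlgebra F V c ℓ) where

  open TranspositionAlgebra 𝔸
  open Stars 𝔸 public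
  open Symmetrizers 𝔸 public
  open ListLemmas
  open import Data.List using (List; []; _∷_; length)
  open import Data.List.Properties using (filter-all)
  open import Data.List.Membership.Propositional using (_∈_)
  open import Data.List.Relation.Unary.All as All using (All)
  open import Data.List.Relation.Unary.Any using (here; there)
  open import Data.List.Relation.Unary.Unique.Propositional using (Unique)
  open import Data.Nat using (ℕ; suc; _≟_)
  open import Data.Product using (_,_; proj₂; _×_; Σ)
  open import Data.Vec using ([]; _∷_)
  open import Relation.Nullary using (yes; no)
  open import Relation.Binary.Reasoning.Setoid setoid

  open CharacteristicZero {F = F} charZero public using (recip)

  nat-recip : ∀ m → nat (suc m) * ι (recip m) ≈ 1#
  nat-recip m = trans (sym (ι-* _ _)) (trans (ι-cong (proj₂ (K.inverse _ (charZero m)))) ι-1)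

  nat-cancel : ∀ m {x y} → nat (suc m) * x ≈ nat (suc m) * y → x ≈ y
  nat-cancel m {x} {y} eq = trans (sym (lemma x)) (trans (*-congˡ eq) (lemma y))
    where
    lemma : ∀ x → ι (recip m) * (nat (suc m) * x) ≈ x
    lemma x = trans (sym (*-assoc _ _ _)) (trans (*-congʳ (trans (ι-central _ _) (nat-recip m))) (*-identityˡ x))

  x+x≈0⇒x≈0 : ∀ {x} → x + x ≈ 0# → x ≈ 0#
  x+x≈0⇒x≈0 {x} eq = nat-cancel 1 (trans (*-congʳ (trans (nat-suc 1) (+-congˡ (trans (nat-suc 0) (trans (+-congˡ ι-0) (+-identityʳ 1#))))))
    (trans (solve (x ∷ []) [] (λ x → (:1 :+ :1) :* x := x :+ x) ≡.refl) (trans eq (sym (zeroʳ _)))))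

  module _ (ρ : V → ℕ) (ε : K.Carrier) (ε² : ε K.* ε K.≈ K.1#) where

    open Symmetrizer ρ ε ε²

    private
      module Op = Symmetrizers.Symmetrizer (opposite 𝔸) ρ ε ε²

      -- Reversal multiplies the factors in the opposite order, but each star commutes with the
      -- symmetrizer of the entries listed after it.
      Symᵒ≈Sym : ∀ {L} → Unique L → Op.Sym L ≈ Sym L
      Symᵒ≈Sym {[]}    U = refl
      Symᵒ≈Sym {x ∷ L} U = begin
        Op.Sym L * (1# + S * e)  ≈⟨ *-congʳ (Symᵒ≈Sym (tail-unique U)) ⟩
        Sym L * (1# + S * e)     ≈⟨ solve (Sym L ∷ S ∷ []) (scalar ε ∷ []) (λ q s e → q :* (:1 :+ s :* e) := q :+ e :* (q :* s)) ≡.refl ⟩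
        Sym L + e * (Sym L * S)  ≈⟨ +-congˡ (*-congˡ (Sym-⋆ (tail-unique U) (head# U))) ⟩
        Sym L + e * (S * Sym L)  ≈⟨ solve (Sym L ∷ S ∷ []) (scalar ε ∷ []) (λ q s e → q :+ e :* (s :* q) := (:1 :+ e :* s) :* q) ≡.refl ⟩
        (1# + e * S) * Sym L     ∎
        where S = ⋆ x (class ρ (ρ x) L)

    Sym-opposite : ∀ {L} → Unique L → Symmetrizers.Symmetrizer.Sym (opposite 𝔸) ρ ε ε² L ≈ Sym L
    Sym-opposite = Symᵒ≈Sym

    Sym-absorbʳ : ∀ {L x y} → Unique L → x ≢ y → x ∈ L → y ∈ L → ρ x ≡ ρ y → Sym L * t x y ≈ e * Sym L
    Sym-absorbʳ {L} {x} {y} U x≢y x∈ y∈ eq = begin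
      Sym L * t x y    ≈⟨ *-congʳ (Symᵒ≈Sym U) ⟨
      Op.Sym L * t x y ≈⟨ Op.Sym-absorbˡ U x≢y x∈ y∈ eq ⟩
      Op.Sym L * e     ≈⟨ ι-central ε _ ⟨
      e * Op.Sym L     ≈⟨ *-congˡ (Symᵒ≈Sym U) ⟩
      e * Sym L        ∎

    Absorbs : Carrier → List V → Set _
    Absorbs w L = ∀ {x y} → x ≢ y → x ∈ L → y ∈ L → w * t x y ≈ e * w

    absorb-star : ∀ {w x C} → (∀ {y} → y ∈ C → w * t x y ≈ e * w) → w * ⋆ x C ≈ nat (length C) * (e * w)
    absorb-star {w} {x} {C} abs = trans (∑-*ˡ _ _ C) (trans (∑-cong C abs) (∑-const _ C))

    -- The sign of the factor meets the sign of the absorption, so each transposition contributes ε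
    -- ε = 1.
    absorb-factor : ∀ {w x C} → (∀ {y} → y ∈ C → w * t x y ≈ e * w) → w * (1# + e * ⋆ x C) ≈ nat (suc (length C)) * w
    absorb-factor {w} {x} {C} abs = begin
      w * (1# + e * ⋆ x C)
        ≈⟨ solve (w ∷ ⋆ x C ∷ []) (scalar ε ∷ []) (λ w s e → w :* (:1 :+ e :* s) := w :+ e :* (w :* s)) ≡.refl ⟩
      w + e * (w * ⋆ x C)
        ≈⟨ +-congˡ (*-congˡ (absorb-star abs)) ⟩
      w + e * (nat (length C) * (e * w))
        ≈⟨ solve (w ∷ []) (scalar ε ∷ natural (length C) ∷ []) (λ w e n → w :+ e :* (n :* (e :* w)) := w :+ e :* e :* (n :* w)) ≡.refl ⟩
      w + e * e * (nat (length C) * w)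
        ≈⟨ +-congˡ (trans (*-congʳ e²) (*-identityˡ _)) ⟩
      w + nat (length C) * w
        ≈⟨ solve (w ∷ []) (natural (length C) ∷ []) (λ w n → w :+ n :* w := (:1 :+ n) :* w) ≡.refl ⟩
      (1# + nat (length C)) * w
        ≈⟨ *-congʳ (nat-suc (length C)) ⟨
      nat (suc (length C)) * w ∎

    -- Symmetrizing over C multiplies such a `w` by the factorial of the size of C, and s is its
    -- reciprocal. The lemma serves to split a symmetrizer of C off the right end of `w`.
    absorb-Sym : ∀ {w k C} → Absorbs w C → Unique C → (∀ {x} → x ∈ C → ρ x ≡ k) → Σ K.Carrier λ s → w ≈ w * Sym C * ι s
    absorb-Sym {w} {C = []}    abs U ρ≡k = K.1# , sym (trans (*-cong (*-identityʳ w) ι-1) (*-identityʳ w))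
    absorb-Sym {w} {k} {x ∷ C} abs U ρ≡k with absorb-Sym {w} (λ x≢y x∈ y∈ → abs x≢y (there x∈) (there y∈)) (tail-unique U) (λ x∈ → ρ≡k (there x∈))
    ... | s , eq = recip (length C) K.* s , (begin
      w                                       ≈⟨ eq ⟩
      w * Sym C * ι s                         ≈⟨ *-congʳ (*-congʳ (trans (sym (*-identityʳ w)) (*-congˡ (sym (nat-recip (length C)))))) ⟩
      w * (nat (suc (length C)) * ι r) * Sym C * ι s
        ≈⟨ solve (w ∷ Sym C ∷ []) (natural (suc (length C)) ∷ scalar r ∷ scalar s ∷ [])
             (λ w q n r s → w :* (n :* r) :* q :* s := n :* w :* q :* (r :* s)) ≡.refl ⟩
      nat (suc (length C)) * w * Sym C * (ι r * ι s)
        ≈⟨ *-cong (*-congʳ (sym (absorb-factor λ y∈ → abs (head# U y∈) (here ≡.refl) (there y∈)))) (sym (ι-* r s)) ⟩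
      w * (1# + e * ⋆ x C) * Sym C * ι (r K.* s)
        ≈⟨ *-congʳ (*-assoc _ _ _) ⟩
      w * ((1# + e * ⋆ x C) * Sym C) * ι (r K.* s)
        ≡⟨ ≡.cong (λ D → w * ((1# + e * ⋆ x D) * Sym C) * ι (r K.* s)) (≡.sym whole) ⟩
      w * ((1# + e * ⋆ x (class ρ (ρ x) C)) * Sym C) * ι (r K.* s) ∎)
      where
      r = recip (length C)
      whole : class ρ (ρ x) C ≡ C
      whole = filter-all _ (All.tabulate λ y∈ → ≡.trans (ρ≡k (there y∈)) (≡.sym (ρ≡k (here ≡.refl))))

  module Relations (ρ σ : V → ℕ) (ε δ : K.Carrier) (ε² : ε K.* ε K.≈ K.1#) (δ² : δ K.* δ K.≈ K.1#)
    (ε+δ≈0 : ε K.+ δ K.≈ K.0#) where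

    private
      module A = Symmetrizer ρ ε ε²
      module B = Symmetrizer σ δ δ²

      e+d≈0 : A.e + B.e ≈ 0#
      e+d≈0 = trans (sym (ι-+ ε δ)) (trans (ι-cong ε+δ≈0) ι-0)

    -- Evaluating a g s from both sides gives ε a s = δ a s = - ε a s, and both 2 and ε are
    -- invertible.
    opposite-signs-vanish : ∀ {a s g} → a * g ≈ A.e * a → g * s ≈ B.e * s → a * s ≈ 0#
    opposite-signs-vanish {a} {s} {g} ag gs = begin
      a * s             ≈⟨ *-identityˡ _ ⟨
      1# * (a * s)      ≈⟨ *-congʳ A.e² ⟨
      A.e * A.e * (a * s) ≈⟨ *-assoc _ _ _ ⟩
      A.e * (A.e * (a * s)) ≈⟨ *-congˡ (x+x≈0⇒x≈0 double) ⟩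
      A.e * 0#          ≈⟨ zeroʳ _ ⟩
      0#                ∎
      where
      double : A.e * (a * s) + A.e * (a * s) ≈ 0#
      double = begin
        A.e * (a * s) + A.e * (a * s) ≈⟨ +-congˡ (*-assoc _ _ _) ⟨
        A.e * (a * s) + A.e * a * s ≈⟨ +-congˡ (*-congʳ ag) ⟨
        A.e * (a * s) + a * g * s   ≈⟨ +-congˡ (trans (*-assoc _ _ _) (*-congˡ gs)) ⟩
        A.e * (a * s) + a * (B.e * s)
          ≈⟨ solve (a ∷ s ∷ []) (scalar ε ∷ scalar δ ∷ []) (λ a s e d → e :* (a :* s) :+ a :* (d :* s) := (e :+ d) :* (a :* s)) ≡.refl ⟩
        (A.e + B.e) * (a * s)       ≈⟨ *-congʳ e+d≈0 ⟩
        0# * (a * s)                ≈⟨ zeroˡ _ ⟩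
        0#                          ∎

    -- Up to a scalar the column factor b ends in the symmetrizer of C, and together with 1 + δ ⋆ x
    -- C this is the symmetrizer of C and x. Carried leftwards through b, it becomes that of C and
    -- some z of the class of x. The transposition of z and its mate in C then has opposite signs on
    -- the two sides, so everything vanishes. The existence of mates says that the class i is at
    -- least as long as that of x.
    garnir : ∀ {L x i} → Unique L → x ∈ L → i ≢ σ x →
      (∀ {z} → z ∈ L → σ z ≡ σ x → Σ V λ y → y ∈ L × σ y ≡ i × ρ y ≡ ρ z) →
      A.Sym L * B.Sym L * ⋆ x (class σ i L) ≈ A.e * (A.Sym L * B.Sym L)
    -- Since δ ε = -1, the vanishing of a b (1 + δ ⋆ x C), multiplied by ε, is the claim.
    garnir {L} {x} {i} U x∈ i≢ mate = trans (cancel-by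
        (solve (a ∷ b ∷ ⋆ x C ∷ []) (scalar ε ∷ scalar δ ∷ [])
          (λ a b s e d → a :* b :* s :+ e :* (a :* b :* (:1 :+ d :* s)) := e :* (a :* b) :+ (:1 :+ d :* e) :* (a :* b :* s)) ≡.refl)
        (trans (*-congʳ 1+de≈0) (trans (zeroˡ _) (sym (trans (*-congˡ vanishes) (zeroʳ _)))))) refl
      where
      a = A.Sym L
      b = B.Sym L
      C = class σ i L
      B₂ = B.Sym C
      E : V → Carrier
      E z = 1# + B.e * ⋆ z C
      UC : Unique C
      UC = class-unique σ i U
      z#C : ∀ {z} → σ z ≢ i → z # C
      z#C σz e∈ z≡e = σz (≡.trans (≡.cong σ z≡e) (proj₂ (∈-class⁻ σ L e∈)))
      1+de≈0 : 1# + B.e * A.e ≈ 0#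
      1+de≈0 = trans (+-congʳ (sym A.e²)) (trans (sym (distribʳ _ _ _)) (trans (*-congʳ e+d≈0) (zeroˡ _)))

      -- All z of the class of x are treated at once, because moving a transposition past E z B₂ may
      -- replace z by another member of the class.
      Kills : Carrier → Set _
      Kills g = ∀ {z} → z ∈ L → σ z ≡ σ x → a * g * (E z * B₂) ≈ 0#

      kills-1 : Kills 1#
      kills-1 {z} z∈ σz with mate z∈ σz
      ... | y , y∈ , σy , ρy = trans (*-congʳ (*-identityʳ a)) (opposite-signs-vanish {g = t z y}
        (Sym-absorbʳ ρ ε ε² U (λ z≡y → i≢ (≡.trans (≡.sym σy) (≡.trans (≡.cong σ (≡.sym z≡y)) σz))) z∈ y∈ (≡.sym ρy))
        (B.t-antisymmetrises UC (z#C (λ eq → i≢ (≡.trans (≡.sym eq) σz))) (∈-class⁺ σ y∈ σy)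
          λ w≢y w∈ → B.Sym-absorbˡ UC w≢y w∈ (∈-class⁺ σ y∈ σy) (≡.trans (proj₂ (∈-class⁻ σ L w∈)) (≡.sym σy))))

      B₂-commutes : ∀ {p q} → p # C → q # C → t p q * B₂ ≈ B₂ * t p q
      B₂-commutes {p} {q} p# q# = sym (sub-commute
        (λ { _ (u∈ , v∈ , _) → t-comm (λ eq → p# u∈ (≡.sym eq)) (λ eq → q# u∈ (≡.sym eq))
                                       (λ eq → p# v∈ (≡.sym eq)) (λ eq → q# v∈ (≡.sym eq)) })
        (B.Sym-subalgebra UC))

      move : ∀ {p q z z′} → t p q * ⋆ z C ≈ ⋆ z′ C * t p q → t p q * B₂ ≈ B₂ * t p q →
        t p q * (E z * B₂) ≈ E z′ * B₂ * t p q
      move {p} {q} {z} {z′} st sb = begin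
        t p q * (E z * B₂)
          ≈⟨ solve (t p q ∷ ⋆ z C ∷ B₂ ∷ []) (scalar δ ∷ []) (λ t s b d → t :* ((:1 :+ d :* s) :* b) := t :* b :+ d :* (t :* s) :* b) ≡.refl ⟩
        t p q * B₂ + B.e * (t p q * ⋆ z C) * B₂
          ≈⟨ +-congˡ (*-congʳ (*-congˡ st)) ⟩
        t p q * B₂ + B.e * (⋆ z′ C * t p q) * B₂
          ≈⟨ solve (t p q ∷ ⋆ z′ C ∷ B₂ ∷ []) (scalar δ ∷ []) (λ t s b d → t :* b :+ d :* (s :* t) :* b := (:1 :+ d :* s) :* (t :* b)) ≡.refl ⟩
        E z′ * (t p q * B₂) ≈⟨ *-congˡ sb ⟩
        E z′ * (B₂ * t p q) ≈⟨ *-assoc _ _ _ ⟨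
        E z′ * B₂ * t p q   ∎

      zero-through : ∀ {g h s s′ r} → h * s ≈ s′ * r → a * g * s′ ≈ 0# → a * (g * h) * s ≈ 0#
      zero-through {g} {h} {s} {s′} {r} hs z = begin
        a * (g * h) * s  ≈⟨ solve (a ∷ g ∷ h ∷ s ∷ []) [] (λ a g h s → a :* (g :* h) :* s := a :* g :* (h :* s)) ≡.refl ⟩
        a * g * (h * s)  ≈⟨ *-congˡ hs ⟩
        a * g * (s′ * r) ≈⟨ *-assoc _ _ _ ⟨
        a * g * s′ * r   ≈⟨ *-congʳ z ⟩
        0# * r           ≈⟨ zeroˡ r ⟩
        0#               ∎

      kills-* : ∀ {h} → Subalgebra (SameClass σ L) h → ∀ {g} → Kills g → Kills (g * h)
      kills-* (scal r) kg z∈ σz = zero-through (ι-central r _) (kg z∈ σz)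
      kills-* (p ⊞ q) {g} kg z∈ σz = trans (*-congʳ (trans (*-congˡ (distribˡ _ _ _)) (distribˡ _ _ _)))
        (trans (distribʳ _ _ _) (trans (+-cong (kills-* p kg z∈ σz) (kills-* q kg z∈ σz)) (+-identityˡ 0#)))
      kills-* (p ⊠ q) kg z∈ σz = trans (*-congʳ (*-congˡ (sym (*-assoc _ _ _)))) (kills-* q (kills-* p kg) z∈ σz)
      kills-* (resp eq p) kg z∈ σz = trans (*-congʳ (*-congˡ (*-congˡ (sym eq)))) (kills-* p kg z∈ σz)
      kills-* (gen {p} {q} p≢q (p∈ , q∈ , σpq)) kg {z} z∈ σz with σ p ≟ i
      -- Both p and q lie in C, so the transposition commutes with E z and becomes the scalar δ on
      -- `B₂`.
      ... | yes σp = zero-through {s′ = E z * B₂} {r = B.e} (begin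
          t p q * (E z * B₂)
            ≈⟨ solve (t p q ∷ ⋆ z C ∷ B₂ ∷ []) (scalar δ ∷ []) (λ t s b d → t :* ((:1 :+ d :* s) :* b) := t :* b :+ d :* (t :* s) :* b) ≡.refl ⟩
          t p q * B₂ + B.e * (t p q * ⋆ z C) * B₂
            ≈⟨ +-congˡ (*-congʳ (*-congˡ (⋆-inside UC p≢q p∈C q∈C (z#C λ eq → i≢ (≡.trans (≡.sym eq) σz))))) ⟩
          t p q * B₂ + B.e * (⋆ z C * t p q) * B₂
            ≈⟨ solve (t p q ∷ ⋆ z C ∷ B₂ ∷ []) (scalar δ ∷ []) (λ t s b d → t :* b :+ d :* (s :* t) :* b := (:1 :+ d :* s) :* (t :* b)) ≡.refl ⟩
          E z * (t p q * B₂) ≈⟨ *-congˡ (B.Sym-absorbˡ UC p≢q p∈C q∈C σpq) ⟩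
          E z * (B.e * B₂)   ≈⟨ solve (E z ∷ B₂ ∷ []) (scalar δ ∷ []) (λ s b d → s :* (d :* b) := s :* b :* d) ≡.refl ⟩
          E z * B₂ * B.e ∎) (kg z∈ σz)
        where
        p∈C = ∈-class⁺ σ p∈ σp
        q∈C = ∈-class⁺ σ q∈ (≡.trans (≡.sym σpq) σp)
      ... | no σp with z ≟ⱽ p | z ≟ⱽ q
      -- Here z = p, and the star of p turns into the star of q, which is again in the class of x.
      ...   | yes ≡.refl | _ = zero-through
              (move (⋆-turn C p≢q (z#C σp) (z#C (λ eq → σp (≡.trans σpq eq)))) (B₂-commutes (z#C σp) (z#C (λ eq → σp (≡.trans σpq eq)))))
              (kg q∈ (≡.trans (≡.sym σpq) σz))
      ...   | no _ | yes ≡.refl = zero-through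
              (move (trans (*-congʳ (t-sym p q)) (trans (⋆-turn C (λ eq → p≢q (≡.sym eq)) (z#C (λ eq → σp (≡.trans σpq eq))) (z#C σp)) (*-congˡ (t-sym q p))))
                (B₂-commutes (z#C σp) (z#C (λ eq → σp (≡.trans σpq eq)))))
              (kg p∈ (≡.trans σpq σz))
      ...   | no z≢p | no z≢q = zero-through
              (move (⋆-disjoint C z≢p z≢q (z#C σp) (z#C (λ eq → σp (≡.trans σpq eq)))) (B₂-commutes (z#C σp) (z#C (λ eq → σp (≡.trans σpq eq)))))
              (kg z∈ σz)

      kills-b : a * b * (E x * B₂) ≈ 0#
      kills-b = trans (*-congʳ (*-congˡ (sym (*-identityˡ b)))) (kills-* (B.Sym-subalgebra U) kills-1 x∈ ≡.refl)

      B₂-star : B₂ * ⋆ x C ≈ ⋆ x C * B₂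
      B₂-star = ≡.subst (λ D → B₂ * ⋆ x D ≈ ⋆ x D * B₂)
        (filter-all _ (All.tabulate λ y∈ → proj₂ (∈-class⁻ σ L y∈)))
        (B.Sym-⋆ {k = i} UC (z#C λ eq → i≢ (≡.sym eq)))

      vanishes : a * b * E x ≈ 0#
      -- A copy of `B₂` is taken out of b and commuted past the star, which assembles the factor
      -- that `kills-b` annihilates.
      vanishes with absorb-Sym σ δ δ² {b} {i} {C}
        (λ p≢q p∈ q∈ → let p∈L , σp = ∈-class⁻ σ L p∈ ; q∈L , σq = ∈-class⁻ σ L q∈ in
          Sym-absorbʳ σ δ δ² U p≢q p∈L q∈L (≡.trans σp (≡.sym σq)))
        UC (λ p∈ → proj₂ (∈-class⁻ σ L p∈))
      ... | s , eq = begin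
        a * b * E x               ≈⟨ *-congʳ (*-congˡ eq) ⟩
        a * (b * B₂ * ι s) * E x
          ≈⟨ solve (a ∷ b ∷ B₂ ∷ ⋆ x C ∷ []) (scalar s ∷ scalar δ ∷ [])
               (λ a b q x s d → a :* (b :* q :* s) :* (:1 :+ d :* x) := s :* (a :* b :* (q :+ d :* (q :* x)))) ≡.refl ⟩
        ι s * (a * b * (B₂ + B.e * (B₂ * ⋆ x C))) ≈⟨ *-congˡ (*-congˡ (+-congˡ (*-congˡ B₂-star))) ⟩
        ι s * (a * b * (B₂ + B.e * (⋆ x C * B₂)))
          ≈⟨ solve (a ∷ b ∷ B₂ ∷ ⋆ x C ∷ []) (scalar s ∷ scalar δ ∷ [])
               (λ a b q x s d → s :* (a :* b :* (q :+ d :* (x :* q))) := s :* (a :* b :* ((:1 :+ d :* x) :* q))) ≡.refl ⟩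
        ι s * (a * b * (E x * B₂)) ≈⟨ *-congˡ kills-b ⟩
        ι s * 0#                   ≈⟨ zeroʳ _ ⟩
        0#                         ∎

-- Young symmetrizers

module YoungSymmetrizer {f ℓf c ℓ} {F : Field f ℓf} (charZero : CharZero F) {V : Set}
  (_≟ⱽ_ : DecidableEquality V) (𝔸 : TranspositionAlgebra F V c ℓ) (row col : V → ℕ) where

  open TranspositionAlgebra 𝔸
  open Garnir charZero _≟ⱽ_ 𝔸 public
  open CharacteristicZero {F = F} charZero public using (rowFactor)
  open ListLemmas
  open import Data.List using (List; []; _∷_; length)
  open import Data.List.Membership.Propositional using (_∈_)
  open import Data.List.Relation.Binary.Permutation.Propositional as ↭ using (_↭_; ↭-sym; ↭-trans; ↭-reflexive)
  open import Data.List.Relation.Binary.Permutation.Propositional.Properties using (∈-resp-↭; ↭-length)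
  open import Data.List.Relation.Unary.Any using (here; there)
  open import Data.List.Relation.Unary.AllPairs using ([]; _∷_)
  open import Data.List.Relation.Unary.Unique.Propositional using (Unique)
  open import Data.Nat using (zero; suc; _≟_; _<_; _≤_; z≤n; s≤s; _∸_) renaming (_+_ to _+ⁿ_)
  import Data.Nat.Properties as ℕ
  open import Data.Product using (_,_; proj₂; _×_; Σ)
  open import Data.Empty using (⊥-elim)
  open import Data.Vec using ([]; _∷_)
  open import Relation.Nullary using (yes; no)
  open import Relation.Binary.Reasoning.Setoid setoid
  import Algebra.Properties.Ring K.ring as KP

  -1K : K.Carrier
  -1K = K.- K.1#

  1² : K.1# K.* K.1# K.≈ K.1#
  1² = K.*-identityˡ K.1#

  -1² : -1K K.* -1K K.≈ K.1#
  -1² = K.trans (KP.-1*x≈-x -1K) (KP.-‿involutive K.1#)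

  module A = Symmetrizer row K.1# 1²
  module B = Symmetrizer col -1K -1²

  cc : List V → Carrier
  cc L = A.Sym L * B.Sym L

  -1ᴬ : Carrier
  -1ᴬ = B.e

  1-1≈0 : 1# + -1ᴬ ≈ 0#
  1-1≈0 = trans (+-congʳ (sym ι-1)) (trans (sym (ι-+ _ _)) (trans (ι-cong (K.-‿inverseʳ K.1#)) ι-0))

  nat-+ : ∀ m n → nat (m +ⁿ n) ≈ nat m + nat n
  nat-+ zero    n = sym (trans (+-congʳ ι-0) (+-identityˡ _))
  nat-+ (suc m) n = begin
    nat (suc (m +ⁿ n))      ≈⟨ nat-suc (m +ⁿ n) ⟩
    1# + nat (m +ⁿ n)       ≈⟨ +-congˡ (nat-+ m n) ⟩
    1# + (nat m + nat n)    ≈⟨ +-assoc _ _ _ ⟨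
    1# + nat m + nat n      ≈⟨ +-congʳ (nat-suc m) ⟨
    nat (suc m) + nat n     ∎

  cc-garnirʳ : ∀ {L x i} → Unique L → x ∈ L → i ≢ col x →
    (∀ {z} → z ∈ L → col z ≡ col x → Σ V λ y → y ∈ L × col y ≡ i × row y ≡ row z) →
    cc L * ⋆ x (class col i L) ≈ cc L
  cc-garnirʳ U x∈ i≢ mate = trans
    (Relations.garnir row col K.1# -1K 1² -1² (K.-‿inverseʳ K.1#) U x∈ i≢ mate)
    (trans (*-congʳ ι-1) (*-identityˡ _))

  -- Reversal puts the column symmetrizer first, so rows and columns change roles and with them the
  -- two signs; hence the eigenvalue -1.
  cc-garnirˡ : ∀ {L x i} → Unique L → x ∈ L → i ≢ row x →
    (∀ {z} → z ∈ L → row z ≡ row x → Σ V λ y → y ∈ L × row y ≡ i × col y ≡ col z) →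
    ⋆ x (class row i L) * cc L ≈ -1ᴬ * cc L
  cc-garnirˡ {L} {x} {i} U x∈ i≢ mate = begin
    ⋆ x (class row i L) * cc L
      ≈⟨ *-congˡ (*-cong (Sym-opposite row K.1# 1² U) (Sym-opposite col -1K -1² U)) ⟨
    ⋆ x (class row i L) * (Opp.Symmetrizer.Sym row K.1# 1² L * Opp.Symmetrizer.Sym col -1K -1² L)
      ≈⟨ Garnir.Relations.garnir charZero _≟ⱽ_ (opposite 𝔸) col row -1K K.1# -1² 1² (K.-‿inverseˡ K.1#) U x∈ i≢ mate ⟩
    Opp.Symmetrizer.Sym row K.1# 1² L * Opp.Symmetrizer.Sym col -1K -1² L * -1ᴬ
      ≈⟨ *-congʳ (*-cong (Sym-opposite row K.1# 1² U) (Sym-opposite col -1K -1² U)) ⟩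
    cc L * -1ᴬ ≈⟨ ι-central _ _ ⟨
    -1ᴬ * cc L ∎
    where module Opp = Symmetrizers (opposite 𝔸)

  cc-row : ∀ {L x y} → Unique L → x ≢ y → x ∈ L → y ∈ L → row x ≡ row y → t x y * cc L ≈ cc L
  cc-row U x≢y x∈ y∈ eq = trans (sym (*-assoc _ _ _)) (*-congʳ
    (trans (A.Sym-absorbˡ U x≢y x∈ y∈ eq) (trans (*-congʳ ι-1) (*-identityˡ _))))

  cc-col : ∀ {L x y} → Unique L → x ≢ y → x ∈ L → y ∈ L → col x ≡ col y → cc L * t x y ≈ -1ᴬ * cc L
  cc-col {L} U x≢y x∈ y∈ eq = trans (*-assoc _ _ _) (trans (*-congˡ (Sym-absorbʳ col -1K -1² U x≢y x∈ y∈ eq))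
    (solve (A.Sym L ∷ B.Sym L ∷ []) (scalar -1K ∷ []) (λ a b e → a :* (e :* b) := e :* (a :* b)) ≡.refl))

  -- The column star commutes with the column symmetrizer of L and can be moved to the far right.
  -- The two new factors then enclose c(L) and can be dealt with separately.
  cc-∷ : ∀ {x L} → Unique (x ∷ L) →
    cc (x ∷ L) ≈ (1# + ⋆ x (class row (row x) L)) * cc L * (1# + -1ᴬ * ⋆ x (class col (col x) L))
  cc-∷ {x} {L} U = begin
    (1# + A.e * Y) * A.Sym L * ((1# + -1ᴬ * Z) * B.Sym L)
      ≈⟨ *-cong (*-congʳ (+-congˡ (trans (*-congʳ ι-1) (*-identityˡ Y))))
           (solve (Z ∷ B.Sym L ∷ []) (scalar -1K ∷ []) (λ z b e → (:1 :+ e :* z) :* b := b :+ e :* (z :* b)) ≡.refl) ⟩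
    (1# + Y) * A.Sym L * (B.Sym L + -1ᴬ * (Z * B.Sym L))
      ≈⟨ *-congˡ (+-congˡ (*-congˡ (sym (B.Sym-⋆ (tail-unique U) (head# U))))) ⟩
    (1# + Y) * A.Sym L * (B.Sym L + -1ᴬ * (B.Sym L * Z))
      ≈⟨ solve (Y ∷ Z ∷ A.Sym L ∷ B.Sym L ∷ []) (scalar -1K ∷ [])
           (λ y z a b e → (:1 :+ y) :* a :* (b :+ e :* (b :* z)) := (:1 :+ y) :* (a :* b) :* (:1 :+ e :* z)) ≡.refl ⟩
    (1# + Y) * cc L * (1# + -1ᴬ * Z) ∎
    where
    Y = ⋆ x (class row (row x) L)
    Z = ⋆ x (class col (col x) L)

  sumFrom : (ℕ → Carrier) → ℕ → ℕ → Carrier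
  sumFrom g k zero    = 0#
  sumFrom g k (suc n) = g k + sumFrom g (suc k) n

  sumFrom-cong : ∀ {g h} k n → (∀ j → k ≤ j → g j ≈ h j) → sumFrom g k n ≈ sumFrom h k n
  sumFrom-cong k zero    eq = refl
  sumFrom-cong k (suc n) eq = +-cong (eq k ℕ.≤-refl) (sumFrom-cong (suc k) n λ j k<j → eq j (ℕ.<⇒≤ k<j))

  sumFrom-+ : ∀ g h k n → sumFrom (λ j → g j + h j) k n ≈ sumFrom g k n + sumFrom h k n
  sumFrom-+ g h k zero    = sym (+-identityˡ _)
  sumFrom-+ g h k (suc n) = trans (+-congˡ (sumFrom-+ g h (suc k) n))
    (solve (g k ∷ h k ∷ _ ∷ _ ∷ []) [] (λ x y z w → (x :+ y) :+ (z :+ w) := (x :+ z) :+ (y :+ w)) ≡.refl)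

  sumFrom-split : ∀ g k m n → sumFrom g k (m +ⁿ n) ≈ sumFrom g k m + sumFrom g (k +ⁿ m) n
  sumFrom-split g k zero    n = trans (sym (+-identityˡ _)) (+-congˡ (reflexive (≡.cong (λ j → sumFrom g j n) (≡.sym (ℕ.+-identityʳ k)))))
  sumFrom-split g k (suc m) n = trans (+-congˡ (sumFrom-split g (suc k) m n))
    (trans (sym (+-assoc _ _ _)) (+-congˡ (reflexive (≡.cong (λ j → sumFrom g j n) (≡.sym (ℕ.+-suc k m))))))

  sumFrom-intertwine : ∀ {g h} a b k n → (∀ j → k ≤ j → a * g j ≈ h j * b) → a * sumFrom g k n ≈ sumFrom h k n * b
  sumFrom-intertwine a b k zero    eq = trans (zeroʳ a) (sym (zeroˡ b))
  sumFrom-intertwine a b k (suc n) eq = trans (distribˡ _ _ _) (trans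
    (+-cong (eq k ℕ.≤-refl) (sumFrom-intertwine a b (suc k) n λ j k<j → eq j (ℕ.<⇒≤ k<j))) (sym (distribʳ _ _ _)))

  sumFrom-single : ∀ g k n j a → k ≤ j → j < k +ⁿ n → g j ≈ a → (∀ i → i ≢ j → g i ≈ 0#) → sumFrom g k n ≈ a
  sumFrom-single g k zero    j a k≤j j< gj g0 = ⊥-elim (ℕ.<⇒≱ j< (≡.subst (_≤ j) (≡.sym (ℕ.+-identityʳ k)) k≤j))
  sumFrom-single g k (suc n) j a k≤j j< gj g0 with k ≟ j
  ... | yes ≡.refl = trans (+-cong gj (rest (suc k) n ℕ.≤-refl)) (+-identityʳ a)
    where
    rest : ∀ i m → k < i → sumFrom g i m ≈ 0#
    rest i zero    k<i = refl
    rest i (suc m) k<i = trans (+-cong (g0 i λ i≡k → ℕ.<-irrefl (≡.sym i≡k) k<i) (rest (suc i) m (ℕ.m<n⇒m<1+n k<i))) (+-identityʳ 0#)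
  ... | no k≢j = trans (+-cong (g0 k k≢j) (sumFrom-single g (suc k) n j a (ℕ.≤∧≢⇒< k≤j k≢j) (≡.subst (j <_) (ℕ.+-suc k n) j<) gj g0)) (+-identityˡ a)

  ∑-rows : ∀ g L N → (∀ {e} → e ∈ L → row e < N) → ∑ g L ≈ sumFrom (λ k → ∑ g (class row k L)) 0 N
  ∑-rows g []      N bound = sym (sumFrom-zero 0 N)
    where
    sumFrom-zero : ∀ k n → sumFrom (λ _ → 0#) k n ≈ 0#
    sumFrom-zero k zero    = refl
    sumFrom-zero k (suc n) = trans (+-identityˡ _) (sumFrom-zero (suc k) n)
  ∑-rows g (x ∷ L) N bound = begin
    g x + ∑ g L
      ≈⟨ +-cong (sym (sumFrom-single here-only 0 N (row x) (g x) z≤n (bound (here ≡.refl)) at-row elsewhere))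
                (∑-rows g L N λ e∈ → bound (there e∈)) ⟩
    sumFrom here-only 0 N + sumFrom (λ k → ∑ g (class row k L)) 0 N
      ≈⟨ sumFrom-+ here-only _ 0 N ⟨
    sumFrom (λ k → here-only k + ∑ g (class row k L)) 0 N
      ≈⟨ sumFrom-cong 0 N (λ k _ → combine k) ⟩
    sumFrom (λ k → ∑ g (class row k (x ∷ L))) 0 N ∎
    where
    here-only : ℕ → Carrier
    here-only k with row x ≟ k
    ... | yes _ = g x
    ... | no _  = 0#
    at-row : here-only (row x) ≈ g x
    at-row with row x ≟ row x
    ... | yes _ = refl
    ... | no neq = ⊥-elim (neq ≡.refl)
    elsewhere : ∀ i → i ≢ row x → here-only i ≈ 0#
    elsewhere i neq with row x ≟ i
    ... | yes eq = ⊥-elim (neq (≡.sym eq))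
    ... | no _   = refl
    combine : ∀ k → here-only k + ∑ g (class row k L) ≈ ∑ g (class row k (x ∷ L))
    combine k with row x ≟ k
    ... | yes eq = reflexive (≡.cong (∑ g) (≡.sym (class-accept row L eq)))
    ... | no neq = trans (+-identityˡ _) (reflexive (≡.cong (∑ g) (≡.sym (class-reject row L neq))))

  rowLengths : List V → ℕ → ℕ → List ℕ
  rowLengths L k zero    = []
  rowLengths L k (suc n) = length (class row k L) ∷ rowLengths L (suc k) n

  -- The hypothesis `content` says that x acts on w by its content, column minus row.
  -- `columns-closed` supplies the mates for the row Garnir relations of c(L), and `short-rows`
  -- keeps the denominators of the sweep positive.
  module AddCell (N : ℕ) {x : V} {L : List V} (U : Unique (x ∷ L)) (bound : ∀ {y} → y ∈ L → row y < N)
    (columns-closed : ∀ {b k} → b ∈ L → k < row b → Σ V λ y → y ∈ L × row y ≡ k × col y ≡ col b)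
    (short-rows : ∀ k → row x ≤ k → length (class row k L) ≤ col x)
    {w : Carrier} (content : w * ⋆ x L + nat (row x) * w ≈ nat (col x) * w) where

    private
      UL : Unique L
      UL = tail-unique U
      x# : x # L
      x# = head# U
      c′ : Carrier
      c′ = cc L
      R : ℕ → List V
      R k = class row k L
      Y : ℕ → Carrier
      Y k = ⋆ x (R k)
      q : ℕ → ℕ
      q k = length (R k)

    private
      row≢ : ∀ {y z} → row y ≢ row z → y ≢ z
      row≢ neq eq = neq (≡.cong row eq)

    -- Elements z through which the stars of the rows from k on can be moved, and which c′ evaluates
    -- to the scalar s once x is exchanged for an entry b of such a row.
    record Transparent (k : ℕ) (s : K.Carrier) (z : Carrier) : Set (c ⊔ ℓ ⊔ f) where
      field
        generated : Subalgebra (λ p y → p ≡ x × y ∈ L × row y < k) z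
        evaluates : ∀ {b} → b ∈ L → k ≤ row b → t x b * z * t x b * c′ ≈ ι s * c′
    open Transparent

    transparent-1 : ∀ k → Transparent k K.1# 1#
    transparent-1 k .generated = sub-1
    transparent-1 k .evaluates {b} b∈ k≤ = *-congʳ (trans (*-congʳ (*-identityʳ _)) (trans (t-involutive x b) (sym ι-1)))

    transparent-suc : ∀ {k s z} → Transparent k s z → Transparent (suc k) s z
    transparent-suc Z .generated = sub-⊆ (λ { _ (p≡x , y∈ , lt) → p≡x , y∈ , ℕ.m<n⇒m<1+n lt }) (Z .generated)
    transparent-suc Z .evaluates b∈ k<b = Z .evaluates b∈ (ℕ.<⇒≤ k<b)

    ⋆-higher-row : ∀ {b i} → b ∈ L → i < row b → ⋆ b (R i) * c′ ≈ -1ᴬ * c′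
    ⋆-higher-row b∈ i<b = cc-garnirˡ UL b∈ (λ i≡b → ℕ.<-irrefl i≡b i<b)
      λ z∈ z≡b → columns-closed z∈ (≡.subst (_ <_) (≡.sym z≡b) i<b)

    -- Once x is exchanged for b, the new factor is the star of b over a row above b, which acts on
    -- c′ by -1; hence the change of sign.
    transparent-step : ∀ {k s z} → Transparent k s z → Transparent (suc k) (-1K K.* s) (Y k * z)
    transparent-step {k} {s} {z} Z .generated = sub-∑ (R k)
      (λ e∈ → let e∈L , e≡k = ∈-class⁻ row L e∈ in gen (x# e∈L) (≡.refl , e∈L , ≡.subst (_< suc k) (≡.sym e≡k) (ℕ.n<1+n k)))
      ⊠ transparent-suc Z .generated
    transparent-step {k} {s} {z} Z .evaluates {b} b∈ k<b = begin
      t x b * (Y k * z) * t x b * c′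
        ≈⟨ solve (t x b ∷ Y k ∷ z ∷ c′ ∷ []) [] (λ t y z c → t :* (y :* z) :* t :* c := t :* y :* (z :* t :* c)) ≡.refl ⟩
      t x b * Y k * (z * t x b * c′)
        ≈⟨ *-congʳ (⋆-turn (R k) (x# b∈) (#-class row x#) (λ e∈ → row≢ λ b≡e → ℕ.<-irrefl (≡.trans (≡.sym (proj₂ (∈-class⁻ row L e∈))) (≡.sym b≡e)) k<b)) ⟩
      ⋆ b (R k) * t x b * (z * t x b * c′)
        ≈⟨ solve (t x b ∷ ⋆ b (R k) ∷ z ∷ c′ ∷ []) [] (λ t y z c → y :* t :* (z :* t :* c) := y :* (t :* z :* t :* c)) ≡.refl ⟩
      ⋆ b (R k) * (t x b * z * t x b * c′) ≈⟨ *-congˡ (Z .evaluates b∈ (ℕ.<⇒≤ k<b)) ⟩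
      ⋆ b (R k) * (ι s * c′)
        ≈⟨ solve (⋆ b (R k) ∷ c′ ∷ []) (scalar s ∷ []) (λ y c s → y :* (s :* c) := s :* (y :* c)) ≡.refl ⟩
      ι s * (⋆ b (R k) * c′)               ≈⟨ *-congˡ (⋆-higher-row b∈ k<b) ⟩
      ι s * (-1ᴬ * c′)
        ≈⟨ solve (c′ ∷ []) (scalar s ∷ scalar -1K ∷ []) (λ c s m → s :* (m :* c) := m :* s :* c) ≡.refl ⟩
      -1ᴬ * ι s * c′                       ≈⟨ *-congʳ (ι-* -1K s) ⟨
      ι (-1K K.* s) * c′                   ∎

    sumFrom-vanish : ∀ {g a} k n → (∀ j → k ≤ j → j < k +ⁿ n → g j * c′ ≈ a * c′) → sumFrom g k n * c′ ≈ nat n * (a * c′)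
    sumFrom-vanish k zero    eq = trans (zeroˡ _) (sym (trans (*-congʳ ι-0) (zeroˡ _)))
    sumFrom-vanish {g} {a} k (suc n) eq = trans (distribʳ _ _ _)
      (trans (+-cong (eq k ℕ.≤-refl (ℕ.m<m+n k (s≤s z≤n)))
               (sumFrom-vanish (suc k) n λ j k<j j< → eq j (ℕ.<⇒≤ k<j) (≡.subst (j <_) (≡.sym (ℕ.+-suc k n)) j<)))
        (trans (+-congʳ (sym (*-identityˡ _))) (trans (sym (distribʳ _ _ _)) (*-congʳ (sym (nat-suc n))))))

    -- The k rows above b contribute -1 each by the Garnir relations, the other entries of its own
    -- row contribute q k - 1, and the rows below stay unevaluated.
    ⋆-rest : ∀ {b k n M} → L ↭ b ∷ M → row b ≡ k → suc k +ⁿ n ≡ N →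
      ⋆ b M * c′ + nat (suc k) * c′ ≈ nat (q k) * c′ + sumFrom (λ j → ⋆ b (R j)) (suc k) n * c′
    ⋆-rest {b} {k} {n} {M} p ≡.refl ≡.refl = begin
      ⋆ b M * c′ + nat (suc k) * c′
        ≈⟨ +-cong (*-congʳ (trans (∑-rows (t b) M (suc k +ⁿ n) (λ e∈ → bound (∈-resp-↭ (↭-sym p) (there e∈))))
             (trans (reflexive (≡.cong (sumFrom S 0) (≡.sym (ℕ.+-suc k n)))) (sumFrom-split S 0 k (suc n))))) (*-congʳ (nat-suc k)) ⟩
      (sumFrom S 0 k + (S k + sumFrom S (suc k) n)) * c′ + (1# + nat k) * c′
        ≈⟨ solve (sumFrom S 0 k ∷ S k ∷ sumFrom S (suc k) n ∷ c′ ∷ []) (natural k ∷ [])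
             (λ a b d c k → (a :+ (b :+ d)) :* c :+ (:1 :+ k) :* c := (a :* c :+ k :* c) :+ (b :* c :+ c) :+ d :* c) ≡.refl ⟩
      (sumFrom S 0 k * c′ + nat k * c′) + (S k * c′ + c′) + sumFrom S (suc k) n * c′
        ≈⟨ +-cong (+-cong above own) (*-congʳ (sumFrom-cong (suc k) n λ j k<j → ∑-↭ (t b) (other-row λ j≡k → ℕ.<-irrefl (≡.sym j≡k) k<j))) ⟩
      0# + nat (q k) * c′ + sumFrom (λ j → ⋆ b (R j)) (suc k) n * c′
        ≈⟨ +-congʳ (+-identityˡ _) ⟩
      nat (q k) * c′ + sumFrom (λ j → ⋆ b (R j)) (suc k) n * c′ ∎
      where
      S : ℕ → Carrier
      S j = ⋆ b (class row j M)
      b∈ : b ∈ L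
      b∈ = ∈-resp-↭ (↭-sym p) (here ≡.refl)
      other-row : ∀ {j} → j ≢ k → class row j M ↭ R j
      other-row {j} j≢k = ↭-trans (↭-reflexive (≡.sym (class-reject row M (≢-sym j≢k)))) (↭-sym (class-↭ row j p))
      above : sumFrom S 0 k * c′ + nat k * c′ ≈ 0#
      above = begin
        sumFrom S 0 k * c′ + nat k * c′
          ≈⟨ +-congʳ (sumFrom-vanish 0 k λ j _ j<k → trans (*-congʳ (∑-↭ (t b) (other-row λ j≡k → ℕ.<-irrefl j≡k j<k))) (⋆-higher-row b∈ j<k)) ⟩
        nat k * (-1ᴬ * c′) + nat k * c′
          ≈⟨ solve (c′ ∷ []) (natural k ∷ scalar -1K ∷ []) (λ c k m → k :* (m :* c) :+ k :* c := (:1 :+ m) :* (k :* c)) ≡.refl ⟩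
        (1# + -1ᴬ) * (nat k * c′) ≈⟨ *-congʳ 1-1≈0 ⟩
        0# * (nat k * c′)         ≈⟨ zeroˡ _ ⟩
        0#                        ∎
      own↭ : R k ↭ b ∷ class row k M
      own↭ = ↭-trans (class-↭ row k p) (↭-reflexive (class-accept row M ≡.refl))
      own : S k * c′ + c′ ≈ nat (q k) * c′
      own = begin
        S k * c′ + c′
          ≈⟨ +-congʳ (trans (∑-*ʳ c′ (t b) (class row k M)) (trans (∑-cong (class row k M) λ {y} y∈ →
               let y∈M , y≡k = ∈-class⁻ row M y∈ in
               cc-row UL (head# (Unique-resp-↭ p UL) y∈M) b∈ (∈-resp-↭ (↭-sym p) (there y∈M)) (≡.sym y≡k))
               (∑-const c′ (class row k M)))) ⟩
        nat (length (class row k M)) * c′ + c′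
          ≈⟨ solve (c′ ∷ []) (natural (length (class row k M)) ∷ []) (λ c n → n :* c :+ c := (:1 :+ n) :* c) ≡.refl ⟩
        (1# + nat (length (class row k M))) * c′ ≈⟨ *-congʳ (nat-suc (length (class row k M))) ⟨
        nat (suc (length (class row k M))) * c′  ≡⟨ ≡.cong (λ m → nat m * c′) (↭-length own↭) ⟨
        nat (q k) * c′ ∎

    Below : ℕ → ℕ → Carrier
    Below k n = sumFrom Y k n

    -- Moved past (x , b), the star of x over L becomes the star of b over x and all other cells of
    -- L. That star commutes with z. Its summand (x , b) encloses z together with the first (x , b),
    -- which `evaluates` handles; the remaining summands are covered by `⋆-rest`.
    exchange-cell : ∀ {k n s z b} → suc k +ⁿ n ≡ N → Transparent k s z → b ∈ R k →
      w * ⋆ x L * t x b * (z * c′) + nat (suc k) * (w * t x b * (z * c′))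
        ≈ ι s * (w * c′) + (nat (q k) * (w * t x b * (z * c′)) + w * Below (suc k) n * t x b * (z * c′))
    exchange-cell {k} {n} {s} {z} {b} kn Z b∈R with ∈-class⁻ row L b∈R
    ... | b∈ , b≡k with pluck b∈
    ... | M , p = begin
      w * ⋆ x L * t x b * (z * c′) + nat (suc k) * (w * t x b * (z * c′))
        ≈⟨ +-congʳ (trans (*-congʳ (*-assoc _ _ _)) (*-congʳ (*-congˡ turn))) ⟩
      w * (t x b * ⋆ b (x ∷ M)) * (z * c′) + nat (suc k) * (w * t x b * (z * c′))
        ≈⟨ solve (w ∷ t x b ∷ ⋆ b (x ∷ M) ∷ z ∷ c′ ∷ []) (natural (suc k) ∷ [])
             (λ w t s z c k → w :* (t :* s) :* (z :* c) :+ k :* (w :* t :* (z :* c)) := w :* t :* (s :* z) :* c :+ k :* (w :* t :* (z :* c))) ≡.refl ⟩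
      w * t x b * (⋆ b (x ∷ M) * z) * c′ + nat (suc k) * (w * t x b * (z * c′))
        ≈⟨ +-congʳ (*-congʳ (*-congˡ (sym z-star))) ⟩
      w * t x b * (z * (t b x + ⋆ b M)) * c′ + nat (suc k) * (w * t x b * (z * c′))
        ≈⟨ +-congʳ (*-congʳ (*-congˡ (*-congˡ (+-congʳ (t-sym b x))))) ⟩
      w * t x b * (z * (t x b + ⋆ b M)) * c′ + nat (suc k) * (w * t x b * (z * c′))
        ≈⟨ solve (w ∷ t x b ∷ ⋆ b M ∷ z ∷ c′ ∷ []) (natural (suc k) ∷ [])
             (λ w t s z c k → w :* t :* (z :* (t :+ s)) :* c :+ k :* (w :* t :* (z :* c)) := w :* (t :* z :* t :* c) :+ w :* t :* z :* (s :* c :+ k :* c)) ≡.refl ⟩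
      w * (t x b * z * t x b * c′) + w * t x b * z * (⋆ b M * c′ + nat (suc k) * c′)
        ≈⟨ +-cong (*-congˡ (Z .evaluates b∈ (ℕ.≤-reflexive (≡.sym b≡k)))) (*-congˡ (⋆-rest p b≡k kn)) ⟩
      w * (ι s * c′) + w * t x b * z * (nat (q k) * c′ + SB * c′)
        ≈⟨ solve (w ∷ t x b ∷ SB ∷ z ∷ c′ ∷ []) (scalar s ∷ natural (q k) ∷ [])
             (λ w t b z c s q → w :* (s :* c) :+ w :* t :* z :* (q :* c :+ b :* c) := s :* (w :* c) :+ (q :* (w :* t :* (z :* c)) :+ w :* t :* (z :* b) :* c)) ≡.refl ⟩
      ι s * (w * c′) + (nat (q k) * (w * t x b * (z * c′)) + w * t x b * (z * SB) * c′)
        ≈⟨ +-congˡ (+-congˡ (*-congʳ (*-congˡ z-below))) ⟩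
      ι s * (w * c′) + (nat (q k) * (w * t x b * (z * c′)) + w * t x b * (SB * z) * c′)
        ≈⟨ +-congˡ (+-congˡ (solve (w ∷ t x b ∷ SB ∷ z ∷ c′ ∷ []) [] (λ w t b z c → w :* t :* (b :* z) :* c := w :* (t :* b) :* (z :* c)) ≡.refl)) ⟩
      ι s * (w * c′) + (nat (q k) * (w * t x b * (z * c′)) + w * (t x b * SB) * (z * c′))
        ≈⟨ +-congˡ (+-congˡ (*-congʳ (trans (*-congˡ turn-below) (sym (*-assoc _ _ _))))) ⟩
      ι s * (w * c′) + (nat (q k) * (w * t x b * (z * c′)) + w * Below (suc k) n * t x b * (z * c′)) ∎
      where
      SB = sumFrom (λ j → ⋆ b (R j)) (suc k) n
      UM : Unique (b ∷ M)
      UM = Unique-resp-↭ p UL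
      M⊆L : ∀ {y} → y ∈ M → y ∈ L
      M⊆L y∈ = ∈-resp-↭ (↭-sym p) (there y∈)
      below# : ∀ {y j} → row y ≤ k → k < j → y # R j
      below# y≤k k<j e∈ y≡e = ℕ.<⇒≱ k<j (≡.subst (_≤ k) (≡.trans (≡.cong row y≡e) (proj₂ (∈-class⁻ row L e∈))) y≤k)
      turn : ⋆ x L * t x b ≈ t x b * (t b x + ⋆ b M)
      turn = begin
        ⋆ x L * t x b                   ≈⟨ *-congʳ (∑-↭ (t x) p) ⟩
        (t x b + ⋆ x M) * t x b         ≈⟨ distribʳ _ _ _ ⟩
        t x b * t x b + ⋆ x M * t x b
          ≈⟨ +-cong (*-congˡ (t-sym x b)) (trans (*-congˡ (t-sym x b)) (trans (sym (⋆-turn M (≢-sym (x# b∈)) (head# UM) (λ y∈ → x# (M⊆L y∈)))) (*-congʳ (t-sym b x)))) ⟩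
        t x b * t b x + t x b * ⋆ b M   ≈⟨ distribˡ _ _ _ ⟨
        t x b * (t b x + ⋆ b M)         ∎
      z-star : z * ⋆ b (x ∷ M) ≈ ⋆ b (x ∷ M) * z
      z-star = sub-commute (λ { {u} {y} u≢y (≡.refl , y∈ , y<k) →
        ⋆-inside (#⇒All (λ y∈ → x# (M⊆L y∈)) ∷ tail-unique UM) u≢y (here ≡.refl)
          (there (in-M y∈ (λ y≡b → ℕ.<-irrefl (≡.trans (≡.cong row y≡b) b≡k) y<k)))
          (λ { (here e≡x) b≡e → x# b∈ (≡.sym (≡.trans b≡e e≡x)) ; (there e∈) → head# UM e∈ }) }) (Z .generated)
        where
        in-M : ∀ {y} → y ∈ L → y ≢ b → y ∈ M
        in-M y∈ y≢b with ∈-resp-↭ p y∈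
        ... | here y≡b = ⊥-elim (y≢b y≡b)
        ... | there y∈M = y∈M
      z-below : z * SB ≈ SB * z
      z-below = sumFrom-intertwine z z (suc k) n λ j k<j → sub-commute (λ { u≢y (≡.refl , y∈ , y<k) →
        ⋆-disjoint (R j) (≢-sym (x# b∈)) (row≢ (λ b≡y → ℕ.<-irrefl (≡.trans (≡.sym b≡y) b≡k) y<k))
          (#-class row x#) (below# (ℕ.<⇒≤ y<k) k<j) }) (Z .generated)
      turn-below : t x b * SB ≈ Below (suc k) n * t x b
      turn-below = sumFrom-intertwine (t x b) (t x b) (suc k) n λ j k<j →
        trans (*-congʳ (t-sym x b)) (trans (⋆-turn (R j) (≢-sym (x# b∈)) (below# (ℕ.≤-reflexive b≡k) k<j) (#-class row x#)) (*-congˡ (t-sym b x)))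

    sum-relation : ∀ {g p₁ p₂ p₃ h κ} m n C →
      (∀ {b} → b ∈ C → p₁ * g b * h + nat m * (p₂ * g b * h) ≈ κ + (nat n * (p₂ * g b * h) + p₃ * g b * h)) →
      p₁ * ∑ g C * h + nat m * (p₂ * ∑ g C * h) ≈ nat (length C) * κ + (nat n * (p₂ * ∑ g C * h) + p₃ * ∑ g C * h)
    sum-relation {g} {p₁} {p₂} {p₃} {h} {κ} m n [] eq = trans
      (solve (p₁ ∷ p₂ ∷ h ∷ []) (natural m ∷ []) (λ p r h m → p :* :0 :* h :+ m :* (r :* :0 :* h) := :0) ≡.refl)
      (sym (trans (+-congʳ (trans (*-congʳ ι-0) (zeroˡ κ)))
        (solve (p₂ ∷ p₃ ∷ h ∷ []) (natural n ∷ []) (λ p r h m → :0 :+ (m :* (p :* :0 :* h) :+ r :* :0 :* h) := :0) ≡.refl)))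
    sum-relation {g} {p₁} {p₂} {p₃} {h} {κ} m n (b ∷ C) eq = begin
      p₁ * (g b + G) * h + nat m * (p₂ * (g b + G) * h)
        ≈⟨ solve (p₁ ∷ p₂ ∷ h ∷ g b ∷ G ∷ []) (natural m ∷ [])
             (λ p r h b G m → p :* (b :+ G) :* h :+ m :* (r :* (b :+ G) :* h)
               := (p :* b :* h :+ m :* (r :* b :* h)) :+ (p :* G :* h :+ m :* (r :* G :* h))) ≡.refl ⟩
      (p₁ * g b * h + nat m * (p₂ * g b * h)) + (p₁ * G * h + nat m * (p₂ * G * h))
        ≈⟨ +-cong (eq (here ≡.refl)) (sum-relation m n C λ b∈ → eq (there b∈)) ⟩
      (κ + (nat n * (p₂ * g b * h) + p₃ * g b * h)) + (nat (length C) * κ + (nat n * (p₂ * G * h) + p₃ * G * h))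
        ≈⟨ solve (p₂ ∷ p₃ ∷ h ∷ g b ∷ G ∷ κ ∷ []) (natural n ∷ natural (length C) ∷ [])
             (λ p r h b G κ n l → (κ :+ (n :* (p :* b :* h) :+ r :* b :* h)) :+ (l :* κ :+ (n :* (p :* G :* h) :+ r :* G :* h))
               := (:1 :+ l) :* κ :+ (n :* (p :* (b :+ G) :* h) :+ r :* (b :+ G) :* h)) ≡.refl ⟩
      (1# + nat (length C)) * κ + (nat n * (p₂ * (g b + G) * h) + p₃ * (g b + G) * h)
        ≈⟨ +-congʳ (*-congʳ (sym (nat-suc (length C)))) ⟩
      nat (length (b ∷ C)) * κ + (nat n * (p₂ * (g b + G) * h) + p₃ * (g b + G) * h) ∎
      where G = ∑ g C

    private
      u v : ℕ
      u = row x
      v = col x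

    -- Comparing the exchange relation, summed over row k, with `content` yields the coefficient v -
    -- u + k + 1 - q k = d + 1 in front of w Y k z c′. The lower rows are evaluated by the last
    -- hypothesis, an instance of `sweep` for Y k z, whose scalar is -s.
    sweep-cell : ∀ {k n m d s z r} → suc k +ⁿ n ≡ N → q k +ⁿ d ≡ m → v +ⁿ k ≡ u +ⁿ m → Transparent k s z →
      w * Below (suc k) n * (Y k * z * c′) + ι r * (ι (-1K K.* s) * (w * c′)) ≈ nat (suc m) * (ι (-1K K.* s) * (w * c′)) →
      nat (suc d) * (w * Y k * (z * c′) + ι s * (w * c′)) ≈ ι r * (ι s * (w * c′))
    sweep-cell {k} {n} {m} {d} {s} {z} {r} kn qd vk Z ih = trans (*-congʳ (nat-suc d)) (cancel-by
      (solve (P ∷ Q ∷ W ∷ BB ∷ []) (natural u ∷ natural v ∷ natural k ∷ natural m ∷ natural d ∷ natural (q k) ∷ scalar r ∷ [])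
        (λ P Q W B u v k m d q r →
          (:1 :+ d) :* (P :+ W) :+ ((q :* W :+ (q :* P :+ B)) :+ (Q :+ u :* P) :+ r :* W :+ (v :+ k) :* P :+ m :* (P :+ W))
          := r :* W :+ ((Q :+ (:1 :+ k) :* P) :+ v :* P :+ (B :+ (:1 :+ m) :* W) :+ (u :+ m) :* P :+ (q :+ d) :* (P :+ W))) ≡.refl)
      (+-cong (+-cong (+-cong (+-cong moved (sym contents)) below) (*-congʳ vk′)) (*-congʳ qd′)))
      where
      h = z * c′
      P = w * Y k * h
      Q = w * ⋆ x L * Y k * h
      W = ι s * (w * c′)
      BB = w * Below (suc k) n * Y k * h
      moved : Q + (1# + nat k) * P ≈ nat (q k) * W + (nat (q k) * P + BB)
      moved = trans (+-congˡ (*-congʳ (sym (nat-suc k)))) (sum-relation (suc k) (q k) (R k) (exchange-cell {s = s} kn Z))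
      contents : Q + nat u * P ≈ nat v * P
      contents = begin
        Q + nat u * P
          ≈⟨ solve (w ∷ ⋆ x L ∷ Y k ∷ h ∷ []) (natural u ∷ []) (λ w s y h u → w :* s :* y :* h :+ u :* (w :* y :* h) := (w :* s :+ u :* w) :* (y :* h)) ≡.refl ⟩
        (w * ⋆ x L + nat u * w) * (Y k * h) ≈⟨ *-congʳ content ⟩
        nat v * w * (Y k * h)
          ≈⟨ solve (w ∷ Y k ∷ h ∷ []) (natural v ∷ []) (λ w y h v → v :* w :* (y :* h) := v :* (w :* y :* h)) ≡.refl ⟩
        nat v * P ∎
      below : BB + (1# + nat m) * W ≈ ι r * W
      below = cancel-by
        (solve (BB ∷ w * Below (suc k) n * (Y k * z * c′) ∷ W ∷ []) (natural m ∷ scalar r ∷ scalar -1K ∷ [])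
          (λ B B′ W m r e →
            B :+ (:1 :+ m) :* W :+ (B′ :+ (:1 :+ m) :* (e :* W) :+ (:1 :+ e) :* (r :* W))
            := r :* W :+ (B :+ (B′ :+ r :* (e :* W)) :+ (:1 :+ e) :* ((:1 :+ m) :* W))) ≡.refl)
        (begin
          BB + (w * Below (suc k) n * (Y k * z * c′) + ι r * (-1ᴬ * W)) + (1# + -1ᴬ) * ((1# + nat m) * W)
            ≈⟨ +-cong (+-cong (solve (w * Below (suc k) n ∷ Y k ∷ z ∷ c′ ∷ []) [] (λ a b c d → a :* b :* (c :* d) := a :* (b :* c :* d)) ≡.refl)
                 (trans (+-congˡ (*-congˡ neg)) (trans ih (*-cong (nat-suc m) (sym neg))))) (trans (*-congʳ 1-1≈0) (zeroˡ _)) ⟩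
          w * Below (suc k) n * (Y k * z * c′) + (1# + nat m) * (-1ᴬ * W) + 0#
            ≈⟨ +-congˡ (trans (sym (zeroˡ _)) (*-congʳ (sym 1-1≈0))) ⟩
          w * Below (suc k) n * (Y k * z * c′) + (1# + nat m) * (-1ᴬ * W) + (1# + -1ᴬ) * (ι r * W) ∎)
        where
        neg : -1ᴬ * W ≈ ι (-1K K.* s) * (w * c′)
        neg = trans (sym (*-assoc _ _ _)) (*-congʳ (sym (ι-* -1K s)))
      vk′ : nat u + nat m ≈ nat v + nat k
      vk′ = trans (sym (nat-+ u m)) (trans (reflexive (≡.cong nat (≡.sym vk))) (nat-+ v k))
      qd′ : nat (q k) + nat d ≈ nat m
      qd′ = trans (sym (nat-+ (q k) d)) (reflexive (≡.cong nat qd))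

    -- Here m is the content of x minus the content of the first cell of row k. The induction on the
    -- number of rows calls itself twice at row k + 1, for z and for Y k z, which is why z has to be
    -- arbitrary.
    sweep : ∀ {k s z} n m → k +ⁿ n ≡ N → v +ⁿ k ≡ u +ⁿ m → u ≤ k → Transparent k s z →
      w * Below k n * (z * c′) + ι (rowFactor m (rowLengths L k n)) * (ι s * (w * c′)) ≈ nat m * (ι s * (w * c′))
    sweep {z = z} zero m kn vk u≤k Z = trans (+-congʳ (trans (*-congʳ (zeroʳ w)) (zeroˡ _))) (+-identityˡ _)
    sweep {k} {s} {z} (suc n) m kn vk u≤k Z = begin
      w * (Y k + S) * h + ι (r K.* (embed F d K.* recip d)) * W
        ≈⟨ +-congˡ (*-congʳ (trans (ι-* r _) (*-congˡ (ι-* (embed F d) (recip d))))) ⟩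
      w * (Y k + S) * h + ι r * (nat d * ι (recip d)) * W
        ≈⟨ cancel-by
             (solve (w ∷ Y k ∷ S ∷ h ∷ W ∷ []) (natural m ∷ natural d ∷ scalar r ∷ scalar (recip d) ∷ [])
               (λ w y s h W m d r i →
                 w :* (y :+ s) :* h :+ r :* (d :* i) :* W
                   :+ ((:1 :+ m) :* W :+ i :* (r :* W) :+ r :* W)
                 := m :* W :+ ((w :* s :* h :+ r :* W) :+ (w :* y :* h :+ W) :+ ((:1 :+ d) :* i) :* (r :* W))) ≡.refl)
             (+-cong (+-cong (trans (sweep n (suc m) kn′ vk′ (ℕ.m≤n⇒m≤1+n u≤k) (transparent-suc Z)) (*-congʳ (nat-suc m))) cell)
               (trans (*-congʳ (trans (*-congʳ (sym (nat-suc d))) (nat-recip d))) (*-identityˡ _))) ⟩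
      nat m * W ∎
      where
      h = z * c′
      S = Below (suc k) n
      W = ι s * (w * c′)
      d = m ∸ q k
      r = rowFactor (suc m) (rowLengths L (suc k) n)
      kn′ : suc k +ⁿ n ≡ N
      kn′ = ≡.trans (≡.sym (ℕ.+-suc k n)) kn
      vk′ : v +ⁿ suc k ≡ u +ⁿ suc m
      vk′ = ≡.trans (ℕ.+-suc v k) (≡.trans (≡.cong suc vk) (≡.sym (ℕ.+-suc u m)))
      q≤m : q k ≤ m
      q≤m = ℕ.≤-trans (short-rows k u≤k) (ℕ.+-cancelˡ-≤ u v m (≡.subst (u +ⁿ v ≤_) vk (≡.subst (_≤ v +ⁿ k) (ℕ.+-comm v u) (ℕ.+-monoʳ-≤ v u≤k))))
      cell : w * Y k * h + W ≈ ι (recip d) * (ι r * W)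
      cell = trans (sym (trans (sym (*-assoc _ _ _)) (trans (*-congʳ (trans (ι-central _ _) (nat-recip d))) (*-identityˡ _))))
        (*-congˡ (sweep-cell {m = m} {d = d} kn′ (ℕ.m+[n∸m]≡n q≤m) vk Z (sweep n (suc m) kn′ vk′ (ℕ.m≤n⇒m≤1+n u≤k) (transparent-step Z))))

    -- The row of x is full to the left of x, so m = q u = v and the denominator d + 1 is 1; the
    -- sweep starts with z = 1.
    cell-row : ∀ {n} → suc u +ⁿ n ≡ N → q u ≡ v →
      w * ((1# + Y u) * c′) ≈ ι (rowFactor (suc v) (rowLengths L (suc u) n)) * (w * c′)
    cell-row {n} un qu = begin
      w * ((1# + Y u) * c′)
        ≈⟨ solve (w ∷ Y u ∷ c′ ∷ []) [] (λ w y c → w :* ((:1 :+ y) :* c) := (:1 :+ :0) :* (w :* y :* (:1 :* c) :+ :1 :* (w :* c))) ≡.refl ⟩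
      (1# + 0#) * (w * Y u * (1# * c′) + 1# * (w * c′))
        ≈⟨ *-cong (trans (+-congˡ (sym ι-0)) (sym (nat-suc 0))) (+-congˡ (*-congʳ (sym ι-1))) ⟩
      nat 1 * (w * Y u * (1# * c′) + ι K.1# * (w * c′))
        ≈⟨ sweep-cell {m = v} {d = 0} un (≡.trans (ℕ.+-identityʳ _) qu) (ℕ.+-comm v u) (transparent-1 u)
             (sweep n (suc v) un (≡.trans (ℕ.+-suc v u) (≡.trans (≡.cong suc (ℕ.+-comm v u)) (≡.sym (ℕ.+-suc u v)))) (ℕ.n≤1+n u) (transparent-step (transparent-1 u))) ⟩
      ι r * (ι K.1# * (w * c′)) ≈⟨ *-congˡ (trans (*-congʳ ι-1) (*-identityˡ _)) ⟩
      ι r * (w * c′) ∎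
      where r = rowFactor (suc v) (rowLengths L (suc u) n)

-- Row lengths from column heights

module CellCounts where

  open import Data.List using (List; []; _∷_; length; filter)
  open import Data.Nat using (zero; suc; _≤_; _<?_; z≤n) renaming (_+_ to _+ⁿ_)
  import Data.Nat.Properties as ℕ
  open import Data.Empty using (⊥-elim)
  open import Relation.Nullary using (Dec; yes; no)
  open import Relation.Unary using (Decidable)

  indicator : ∀ {p} {P : Set p} → Dec P → ℕ
  indicator (yes _) = 1
  indicator (no _)  = 0

  indicator≤1 : ∀ {p} {P : Set p} (d : Dec P) → indicator d ≤ 1
  indicator≤1 (yes _) = ℕ.≤-refl
  indicator≤1 (no _)  = z≤n

  count : ∀ {A : Set} {P : A → Set} → Decidable P → List A → ℕ
  count P? L = length (filter P? L)

  count-∷ : ∀ {A : Set} {P : A → Set} (P? : Decidable P) x L → count P? (x ∷ L) ≡ indicator (P? x) +ⁿ count P? L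
  count-∷ P? x L with P? x
  ... | yes p = ≡.refl
  ... | no ¬p = ≡.refl

  module _ (h : ℕ → ℕ) where

    -- The length of row k within the first j columns. Heights are the primary data because cells
    -- are added column by column.
    rowCount : ℕ → ℕ → ℕ
    rowCount k zero    = 0
    rowCount k (suc j) = indicator (k <? h j) +ⁿ rowCount k j

    rowCount≤ : ∀ k j → rowCount k j ≤ j
    rowCount≤ k zero    = z≤n
    rowCount≤ k (suc j) = ℕ.+-mono-≤ (indicator≤1 (k <? h j)) (rowCount≤ k j)

    rowCount-full : ∀ {k} j → (∀ i → i < j → k < h i) → rowCount k j ≡ j
    rowCount-full     zero    full = ≡.refl
    rowCount-full {k} (suc j) full with k <? h j
    ... | yes _ = ≡.cong suc (rowCount-full j λ i i<j → full i (ℕ.m<n⇒m<1+n i<j))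
    ... | no ¬p = ⊥-elim (¬p (full j ℕ.≤-refl))

    rowCounts : ℕ → ℕ → ℕ → List ℕ
    rowCounts v k zero    = []
    rowCounts v k (suc n) = rowCount k v ∷ rowCounts v (suc k) n

-- Weights of cells and columns

module HookWeights {f ℓf} {F : Field f ℓf} (charZero : CharZero F) (h : ℕ → ℕ) (N : ℕ) where

  open import Data.Nat using (zero; suc; _∸_)
  open Field F
  open CharacteristicZero {F = F} charZero
  open CellCounts

  -- The scalars picked up when the cell (i , j) is added: the row part comes from `cell-row`, and i
  -- + 1 comes from the column, which already holds i cells.
  cellFactor : ℕ → ℕ → Carrier
  cellFactor i j = rowFactor (suc j) (rowCounts h j (suc i) (N ∸ suc i)) * embed F (suc i)

  columnWeight : ℕ → ℕ → Carrier
  columnWeight j zero    = 1#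
  columnWeight j (suc i) = cellFactor i j * columnWeight j i

  weight : ℕ → Carrier
  weight zero    = 1#
  weight (suc J) = columnWeight J (h J) * weight J

-- Shapes built column by column

module Shape {f ℓf c ℓ} {F : Field f ℓf} (charZero : CharZero F) {V : Set}
  (_≟ⱽ_ : DecidableEquality V) (𝔸 : TranspositionAlgebra F V c ℓ) (row col : V → ℕ)
  (E : ℕ → ℕ → V) (h : ℕ → ℕ)
  (row-E : ∀ {i j} → i < h j → row (E i j) ≡ i) (col-E : ∀ {i j} → i < h j → col (E i j) ≡ j) where

  open TranspositionAlgebra 𝔸
  open YoungSymmetrizer charZero _≟ⱽ_ 𝔸 row col
  open ListLemmas
  open CellCounts
  open import Data.List using (List; []; _∷_; _++_; length; applyDownFrom)
  open import Data.List.Properties using (filter-all; filter-none; filter-++; length-++; length-applyDownFrom; ++-identityʳ)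
  open import Data.List.Membership.Propositional using (_∈_)
  open import Data.List.Membership.Propositional.Properties using (∈-++⁺ˡ; ∈-++⁺ʳ; ∈-++⁻; ∈-applyDownFrom⁺; ∈-applyDownFrom⁻)
  open import Data.List.Relation.Unary.All as All using (All)
  open import Data.List.Relation.Unary.AllPairs using ([]; _∷_)
  open import Data.List.Relation.Unary.Unique.Propositional using (Unique)
  open import Data.Nat using (zero; suc; _≟_; _≤_; _<?_; _∸_) renaming (_+_ to _+ⁿ_)
  import Data.Nat.Properties as ℕ
  open import Data.Product using (_,_; proj₁; proj₂; _×_; Σ; ∃)
  open import Data.Sum using (_⊎_; inj₁; inj₂)
  open import Data.Vec using ([]; _∷_)
  open import Relation.Nullary using (yes; no; ¬_)
  open import Relation.Binary.Reasoning.Setoid setoid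

  -- The lowest cell comes first, so that `Col j (suc i)` is definitionally the new cell in front of
  -- the old ones, as the recursion of `Sym` requires.
  Col : ℕ → ℕ → List V
  Col j i = applyDownFrom (λ k → E k j) i

  column : ℕ → List V
  column j = Col j (h j)

  -- With the last column in front, `chain (suc j)` is definitionally `partial j (h j)`, so adding
  -- cells one at a time leads from each chain to the next.
  chain : ℕ → List V
  chain zero    = []
  chain (suc j) = column j ++ chain j

  data Cell (J : ℕ) : V → Set where
    cell : ∀ {i j} → j < J → i < h j → Cell J (E i j)

  ∈-Col : ∀ j i {e} → e ∈ Col j i → ∃ λ k → k < i × e ≡ E k j
  ∈-Col j i e∈ with ∈-applyDownFrom⁻ (λ k → E k j) e∈
  ... | k , k<i , eq = k , k<i , eq

  ∈-column : ∀ {i j} → i < h j → E i j ∈ column j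
  ∈-column {j = j} i<h = ∈-applyDownFrom⁺ (λ k → E k j) i<h

  ∈-chain⁻ : ∀ J {e} → e ∈ chain J → Cell J e
  ∈-chain⁻ (suc J) e∈ with ∈-++⁻ (column J) e∈
  ... | inj₁ e∈c with ∈-Col J (h J) e∈c
  ...   | k , k<h , ≡.refl = cell (ℕ.n<1+n J) k<h
  ∈-chain⁻ (suc J) e∈ | inj₂ e∈ch with ∈-chain⁻ J e∈ch
  ...   | cell j<J i<h = cell (ℕ.m<n⇒m<1+n j<J) i<h

  ∈-chain⁺ : ∀ {J i j} → j < J → i < h j → E i j ∈ chain J
  ∈-chain⁺ {suc J} {i} {j} j<J i<h with j ≟ J
  ... | yes ≡.refl = ∈-++⁺ˡ (∈-column i<h)
  ... | no j≢J     = ∈-++⁺ʳ (column J) (∈-chain⁺ (ℕ.≤∧≢⇒< (ℕ.≤-pred j<J) j≢J) i<h)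

  partial : ℕ → ℕ → List V
  partial j i = Col j i ++ chain j

  ∈-partial⁻ : ∀ j i {e} → e ∈ partial j i → (∃ λ k → k < i × e ≡ E k j) ⊎ Cell j e
  ∈-partial⁻ j i e∈ with ∈-++⁻ (Col j i) e∈
  ... | inj₁ e∈c = inj₁ (∈-Col j i e∈c)
  ... | inj₂ e∈c = inj₂ (∈-chain⁻ j e∈c)

  E-injective : ∀ {i j i′ j′} → i < h j → i′ < h j′ → E i j ≡ E i′ j′ → i ≡ i′ × j ≡ j′
  E-injective p q eq = ≡.trans (≡.sym (row-E p)) (≡.trans (≡.cong row eq) (row-E q))
                     , ≡.trans (≡.sym (col-E p)) (≡.trans (≡.cong col eq) (col-E q))

  E#partial : ∀ {j i} → i < h j → E i j # partial j i
  E#partial {j} {i} i<h e∈ eq with ∈-partial⁻ j i e∈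
  ... | inj₁ (k , k<i , ≡.refl) = ℕ.<-irrefl (≡.sym (proj₁ (E-injective i<h (ℕ.<-trans k<i i<h) eq))) k<i
  ... | inj₂ (cell j′<j i′<h)   = ℕ.<-irrefl (≡.sym (proj₂ (E-injective i<h i′<h eq))) j′<j

  chain-unique : ∀ J → Unique (chain J)
  partial-unique : ∀ j i → i ≤ h j → Unique (partial j i)
  chain-unique zero    = []
  chain-unique (suc J) = partial-unique J (h J) ℕ.≤-refl
  partial-unique j zero    _   = chain-unique j
  partial-unique j (suc i) i<h = #⇒All (E#partial i<h) ∷ partial-unique j i (ℕ.<⇒≤ i<h)

  Col-row-absent : ∀ {j k} i → i ≤ k → i ≤ h j → class row k (Col j i) ≡ []
  Col-row-absent {j} {k} i i≤k i≤h = filter-none _ (All.tabulate absent)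
    where
    absent : ∀ {e} → e ∈ Col j i → ¬ row e ≡ k
    absent e∈ eq with ∈-Col j i e∈
    ... | k′ , k′<i , ≡.refl = ℕ.<-irrefl (≡.trans (≡.sym (row-E (ℕ.<-≤-trans k′<i i≤h))) eq) (ℕ.<-≤-trans k′<i i≤k)

  Col-row-present : ∀ {j k} i → k < i → i ≤ h j → length (class row k (Col j i)) ≡ 1
  Col-row-present {j} {k} (suc i) k<i i<h with i ≟ k
  ... | yes ≡.refl = ≡.trans (≡.cong length (class-accept row (Col j i) (row-E i<h)))
                       (≡.cong (λ C → suc (length C)) (Col-row-absent i ℕ.≤-refl (ℕ.<⇒≤ i<h)))
  ... | no i≢k = ≡.trans (≡.cong length (class-reject row (Col j i) (λ eq → i≢k (≡.trans (≡.sym (row-E i<h)) eq))))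
                   (Col-row-present i (ℕ.≤∧≢⇒< (ℕ.≤-pred k<i) (≢-sym i≢k)) (ℕ.<⇒≤ i<h))

  class-++ : ∀ (ρ : V → ℕ) k L M → class ρ k (L ++ M) ≡ class ρ k L ++ class ρ k M
  class-++ ρ k L M = filter-++ (λ e → ρ e ≟ k) L M

  chain-row : ∀ k J → length (class row k (chain J)) ≡ rowCount h k J
  chain-row k zero    = ≡.refl
  chain-row k (suc J) = ≡.trans (≡.cong length (class-++ row k (column J) (chain J)))
    (≡.trans (length-++ (class row k (column J))) (≡.cong₂ _+ⁿ_ top (chain-row k J)))
    where
    top : length (class row k (column J)) ≡ indicator (k <? h J)
    top with k <? h J
    ... | yes k<h = Col-row-present (h J) k<h ℕ.≤-refl
    ... | no k≮h  = ≡.cong length (Col-row-absent (h J) (ℕ.≮⇒≥ k≮h) ℕ.≤-refl)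

  partial-row : ∀ {j i k} → i ≤ k → i ≤ h j → length (class row k (partial j i)) ≡ rowCount h k j
  partial-row {j} {i} {k} i≤k i≤h = ≡.trans
    (≡.cong length (≡.trans (class-++ row k (Col j i) (chain j)) (≡.cong (_++ class row k (chain j)) (Col-row-absent i i≤k i≤h))))
    (chain-row k j)

  Col-own : ∀ {j} i → i ≤ h j → class col j (Col j i) ≡ Col j i
  Col-own {j} i i≤h = filter-all _ (All.tabulate λ e∈ → own (∈-Col j i e∈))
    where
    own : ∀ {e} → (∃ λ k → k < i × e ≡ E k j) → col e ≡ j
    own (k , k<i , ≡.refl) = col-E (ℕ.<-≤-trans k<i i≤h)

  chain-later : ∀ {i} J → J ≤ i → class col i (chain J) ≡ []
  chain-later {i} J J≤i = filter-none _ (All.tabulate λ e∈ → later (∈-chain⁻ J e∈))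
    where
    later : ∀ {e} → Cell J e → ¬ col e ≡ i
    later (cell j<J i<h) eq = ℕ.<-irrefl (≡.trans (≡.sym (col-E i<h)) eq) (ℕ.<-≤-trans j<J J≤i)

  partial-col : ∀ {j i} → i ≤ h j → class col j (partial j i) ≡ Col j i
  partial-col {j} {i} i≤h = ≡.trans (class-++ col j (Col j i) (chain j))
    (≡.trans (≡.cong₂ _++_ (Col-own i i≤h) (chain-later j ℕ.≤-refl)) (++-identityʳ _))

  chain-col : ∀ {i J} → i < J → class col i (chain J) ≡ column i
  chain-col {i} {suc J} i<J with i ≟ J
  ... | yes ≡.refl = partial-col ℕ.≤-refl
  ... | no i≢J = ≡.trans (class-++ col i (column J) (chain J))
        (≡.trans (≡.cong (_++ class col i (chain J)) (filter-none _ (All.tabulate λ e∈ → other (∈-Col J (h J) e∈)))) (chain-col (ℕ.≤∧≢⇒< (ℕ.≤-pred i<J) i≢J)))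
    where
    other : ∀ {e} → (∃ λ k → k < h J × e ≡ E k J) → ¬ col e ≡ i
    other (k , k<h , ≡.refl) eq = i≢J (≡.trans (≡.sym eq) (col-E k<h))

  -- The mate of a cell of column j is the cell of column i in the same row, which exists because
  -- `h j ≤ h i`.
  chain-garnir : ∀ {J i j k} → i < J → j < J → i ≢ j → k < h j → h j ≤ h i →
    cc (chain J) * ⋆ (E k j) (column i) ≈ cc (chain J)
  chain-garnir {J} {i} {j} {k} i<J j<J i≢j k<h hj≤hi =
    ≡.subst (λ C → cc (chain J) * ⋆ (E k j) C ≈ cc (chain J)) (chain-col i<J)
      (cc-garnirʳ (chain-unique J) (∈-chain⁺ j<J k<h) (λ eq → i≢j (≡.trans eq (col-E k<h))) (λ z∈ eq → mate (∈-chain⁻ J z∈) (≡.trans eq (col-E k<h))))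
    where
    mate : ∀ {z} → Cell J z → col z ≡ j → Σ V λ y → y ∈ chain J × col y ≡ i × row y ≡ row z
    mate (cell {k′} {j′} j′<J k′<h) eq with ≡.trans (≡.sym (col-E k′<h)) eq
    ... | ≡.refl = E k′ i , ∈-chain⁺ i<J k′<hi , col-E k′<hi , ≡.trans (row-E k′<hi) (≡.sym (row-E k′<h))
      where k′<hi = ℕ.<-≤-trans k′<h hj≤hi

  chain-antisymmetric : ∀ {J i i′ j} → j < J → i < h j → i′ < h j → i ≢ i′ →
    cc (chain J) * t (E i j) (E i′ j) ≈ -1ᴬ * cc (chain J)
  chain-antisymmetric {J} j<J i<h i′<h i≢i′ = cc-col (chain-unique J) (λ eq → i≢i′ (proj₁ (E-injective i<h i′<h eq)))
    (∈-chain⁺ j<J i<h) (∈-chain⁺ j<J i′<h) (≡.trans (col-E i<h) (≡.sym (col-E i′<h)))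

  -- What w c(S) = α w needs to know about w.
  record Compatible (J : ℕ) (w : Carrier) : Set ℓ where
    field
      antisymmetric : ∀ {i i′ j} → j < J → i < h j → i′ < h j → i ≢ i′ → w * t (E i j) (E i′ j) ≈ -1ᴬ * w
      previous      : ∀ {i j} → j < J → i < h j → w * ⋆ (E i j) (chain j) ≈ nat j * w

  module Hooks (N : ℕ) (h≤N : ∀ j → h j ≤ N) (h-antitone : ∀ {i j} → i ≤ j → h j ≤ h i) where

    open HookWeights {F = F} charZero h N public

    module _ {J : ℕ} {w : Carrier} (good : Compatible J w) where
      open Compatible good

      own-column : ∀ {j i} → j < J → i < h j → ∀ {y} → y ∈ Col j i → w * t (E i j) y ≈ -1ᴬ * w
      own-column {j} {i} j<J i<h y∈ with ∈-Col j i y∈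
      ... | k , k<i , ≡.refl = antisymmetric j<J i<h (ℕ.<-trans k<i i<h) λ i≡k → ℕ.<-irrefl (≡.sym i≡k) k<i

      -- The i cells above in the same column contribute -1 each by antisymmetry, and the j previous
      -- columns contribute j.
      cell-content : ∀ {j i} → j < J → i < h j → w * ⋆ (E i j) (partial j i) + nat i * w ≈ nat j * w
      cell-content {j} {i} j<J i<h = begin
        w * ⋆ (E i j) (partial j i) + nat i * w
          ≈⟨ +-congʳ (trans (*-congˡ (∑-++ _ (Col j i) (chain j))) (distribˡ _ _ _)) ⟩
        w * ⋆ (E i j) (Col j i) + w * ⋆ (E i j) (chain j) + nat i * w
          ≈⟨ +-congʳ (+-cong (trans (absorb-star col -1K -1² (own-column j<J i<h)) (*-congʳ (reflexive (≡.cong nat (length-applyDownFrom _ i))))) (previous j<J i<h)) ⟩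
        nat i * (-1ᴬ * w) + nat j * w + nat i * w
          ≈⟨ solve (w ∷ []) (natural i ∷ natural j ∷ scalar -1K ∷ []) (λ w i j e → i :* (e :* w) :+ j :* w :+ i :* w := j :* w :+ (:1 :+ e) :* (i :* w)) ≡.refl ⟩
        nat j * w + (1# + -1ᴬ) * (nat i * w) ≈⟨ +-congˡ (trans (*-congʳ 1-1≈0) (zeroˡ _)) ⟩
        nat j * w + 0# ≈⟨ +-identityʳ _ ⟩
        nat j * w ∎

      module Step {j i : ℕ} (j<J : j < J) (i<h : i < h j) where
        x = E i j
        L = partial j i

        bound : ∀ {y} → y ∈ L → row y < N
        bound y∈ with ∈-partial⁻ j i y∈
        ... | inj₁ (k , k<i , ≡.refl) = ≡.subst (_< N) (≡.sym (row-E (ℕ.<-trans k<i i<h))) (ℕ.<-≤-trans (ℕ.<-trans k<i i<h) (h≤N j))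
        ... | inj₂ (cell {i′} {j′} _ i′<h) = ≡.subst (_< N) (≡.sym (row-E i′<h)) (ℕ.<-≤-trans i′<h (h≤N j′))

        closed : ∀ {b k} → b ∈ L → k < row b → Σ V λ y → y ∈ L × row y ≡ k × col y ≡ col b
        closed {b} {k} b∈ k<b with ∈-partial⁻ j i b∈
        ... | inj₁ (k′ , k′<i , ≡.refl) = E k j , ∈-++⁺ˡ (∈-applyDownFrom⁺ (λ k → E k j) k<i) , row-E k<h , ≡.trans (col-E k<h) (≡.sym (col-E k′<h))
          where
          k′<h = ℕ.<-trans k′<i i<h
          k<i = ℕ.<-trans (≡.subst (k <_) (row-E k′<h) k<b) k′<i
          k<h = ℕ.<-trans k<i i<h
        ... | inj₂ (cell {i′} {j′} j′<j i′<h) = E k j′ , ∈-++⁺ʳ (Col j i) (∈-chain⁺ j′<j k<h) , row-E k<h , ≡.trans (col-E k<h) (≡.sym (col-E i′<h))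
          where k<h = ℕ.<-trans (≡.subst (k <_) (row-E i′<h) k<b) i′<h

        short : ∀ k → row x ≤ k → length (class row k L) ≤ col x
        short k x≤k = ≡.subst₂ _≤_ (≡.sym (partial-row (≡.subst (_≤ k) (row-E i<h) x≤k) (ℕ.<⇒≤ i<h))) (≡.sym (col-E i<h)) (rowCount≤ h k j)

        Ux : Unique (x ∷ L)
        Ux = partial-unique j (suc i) i<h

        open AddCell N Ux bound closed short
          (≡.subst₂ (λ r c → w * ⋆ x L + nat r * w ≈ nat c * w) (≡.sym (row-E i<h)) (≡.sym (col-E i<h)) (cell-content j<J i<h))

        rowLengths≡ : ∀ k n → i ≤ k → rowLengths L k n ≡ rowCounts h j k n
        rowLengths≡ k zero    i≤k = ≡.refl
        rowLengths≡ k (suc n) i≤k = ≡.cong₂ _∷_ (partial-row i≤k (ℕ.<⇒≤ i<h)) (rowLengths≡ (suc k) n (ℕ.m≤n⇒m≤1+n i≤k))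

        full-row : length (class row (row x) L) ≡ col x
        full-row = ≡.trans (≡.cong (λ k → length (class row k L)) (row-E i<h))
          (≡.trans (partial-row ℕ.≤-refl (ℕ.<⇒≤ i<h)) (≡.trans (rowCount-full h j (λ i′ i′<j → ℕ.<-≤-trans i<h (h-antitone (ℕ.<⇒≤ i′<j)))) (≡.sym (col-E i<h))))

        row-step : w * ((1# + ⋆ x (class row (row x) L)) * cc L) ≈ ι (rowFactor (suc j) (rowCounts h j (suc i) (N ∸ suc i))) * (w * cc L)
        row-step = trans (cell-row {n = N ∸ suc i} (≡.trans (≡.cong (λ r → suc r +ⁿ (N ∸ suc i)) (row-E i<h)) (ℕ.m+[n∸m]≡n (ℕ.<-≤-trans i<h (h≤N j)))) full-row)
          (*-congʳ (reflexive (≡.cong ι (≡.cong₂ (λ c → rowFactor (suc c)) (col-E i<h)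
            (≡.trans (≡.cong (λ r → rowLengths L (suc r) (N ∸ suc i)) (row-E i<h)) (rowLengths≡ (suc i) (N ∸ suc i) (ℕ.n≤1+n i)))))))

        column-step : w * (1# + -1ᴬ * ⋆ x (class col (col x) L)) ≈ nat (suc i) * w
        column-step = trans (*-congˡ (+-congˡ (*-congˡ (reflexive (≡.cong (⋆ x) (≡.trans (≡.cong (λ c → class col c L) (col-E i<h)) (partial-col (ℕ.<⇒≤ i<h))))))))
          (trans (absorb-factor col -1K -1² (own-column j<J i<h)) (*-congʳ (reflexive (≡.cong (λ n → nat (suc n)) (length-applyDownFrom _ i)))))

        -- The row part goes first, since its evaluation needs c(L) to its right; the induction
        -- hypothesis then brings w next to the column part.
        cell-step : ∀ {s} → w * cc L ≈ ι s * w → w * cc (x ∷ L) ≈ ι (cellFactor i j K.* s) * w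
        cell-step {s} ih = begin
          w * cc (x ∷ L)                ≈⟨ *-congˡ (cc-∷ Ux) ⟩
          w * ((1# + Y) * cc L * D)     ≈⟨ *-assoc _ _ _ ⟨
          w * ((1# + Y) * cc L) * D     ≈⟨ *-congʳ row-step ⟩
          ι r * (w * cc L) * D          ≈⟨ *-congʳ (*-congˡ ih) ⟩
          ι r * (ι s * w) * D
            ≈⟨ solve (w ∷ D ∷ []) (scalar r ∷ scalar s ∷ []) (λ w d r s → r :* (s :* w) :* d := r :* s :* (w :* d)) ≡.refl ⟩
          ι r * ι s * (w * D)           ≈⟨ *-congˡ column-step ⟩
          ι r * ι s * (nat (suc i) * w)
            ≈⟨ solve (w ∷ []) (scalar r ∷ scalar s ∷ natural (suc i) ∷ []) (λ w r s n → r :* s :* (n :* w) := r :* n :* s :* w) ≡.refl ⟩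
          ι r * nat (suc i) * ι s * w
            ≈⟨ *-congʳ (trans (ι-* _ _) (*-congʳ (ι-* _ _))) ⟨
          ι (cellFactor i j K.* s) * w  ∎
          where
          r = rowFactor (suc j) (rowCounts h j (suc i) (N ∸ suc i))
          Y = ⋆ x (class row (row x) L)
          D = 1# + -1ᴬ * ⋆ x (class col (col x) L)

      chain-absorbs : ∀ j → j ≤ J → w * cc (chain j) ≈ ι (weight j) * w
      partial-absorbs : ∀ j i → j < J → i ≤ h j → w * cc (partial j i) ≈ ι (columnWeight j i K.* weight j) * w
      chain-absorbs zero    _   = trans (*-congˡ (*-identityˡ 1#)) (trans (*-identityʳ w) (trans (sym (*-identityˡ w)) (*-congʳ (sym ι-1))))
      chain-absorbs (suc j) j<J = partial-absorbs j (h j) j<J ℕ.≤-refl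
      partial-absorbs j zero    j<J _   = trans (chain-absorbs j (ℕ.<⇒≤ j<J)) (*-congʳ (ι-cong (K.sym (K.*-identityˡ _))))
      partial-absorbs j (suc i) j<J i<h = trans (Step.cell-step j<J i<h (partial-absorbs j i j<J (ℕ.<⇒≤ i<h)))
        (*-congʳ (ι-cong (K.sym (K.*-assoc _ _ _))))

-- Two orders of listing columns

module Stacks {V : Set} where

  open import Data.List using (List; []; _∷_; _++_; concat)
  open import Data.List.Properties using (++-assoc)
  open import Data.List.Relation.Binary.Permutation.Propositional using (_↭_; ↭-refl; ↭-sym; ↭-trans; ↭-reflexive; module PermutationReasoning)
  open import Data.List.Relation.Binary.Permutation.Propositional.Properties using (++⁺; ++⁺ˡ; ++⁺ʳ; ++-comm)
  open import Data.Nat using (zero; suc; _+_)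
  import Data.Nat.Properties as ℕ

  -- Last column first, to match `chain`, whereas `columnsFrom` has the left-to-right order of
  -- `columns`. Sums over the entries do not see the difference.
  stack : (ℕ → List V) → ℕ → ℕ → List V
  stack C j zero    = []
  stack C j (suc l) = C (j + l) ++ stack C j l

  columnsFrom : (ℕ → List V) → ℕ → ℕ → List (List V)
  columnsFrom C j zero    = []
  columnsFrom C j (suc l) = C j ∷ columnsFrom C (suc j) l

  stack-head : ∀ C j l → stack C j (suc l) ↭ C j ++ stack C (suc j) l
  stack-head C j zero    = ↭-reflexive (≡.cong (λ k → C k ++ []) (ℕ.+-identityʳ j))
  stack-head C j (suc l) = begin
    C (j + suc l) ++ stack C j (suc l)             ↭⟨ ++⁺ˡ (C (j + suc l)) (stack-head C j l) ⟩
    C (j + suc l) ++ (C j ++ stack C (suc j) l)    ≡⟨ ++-assoc (C (j + suc l)) (C j) _ ⟨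
    (C (j + suc l) ++ C j) ++ stack C (suc j) l    ↭⟨ ++⁺ʳ (stack C (suc j) l) (++-comm (C (j + suc l)) (C j)) ⟩
    (C j ++ C (j + suc l)) ++ stack C (suc j) l    ≡⟨ ++-assoc (C j) (C (j + suc l)) _ ⟩
    C j ++ (C (j + suc l) ++ stack C (suc j) l)    ≡⟨ ≡.cong (λ k → C j ++ (C k ++ stack C (suc j) l)) (ℕ.+-suc j l) ⟩
    C j ++ (C (suc j + l) ++ stack C (suc j) l)    ∎
    where open PermutationReasoning

  concat-columnsFrom : ∀ {C D} → (∀ j → C j ↭ D j) → ∀ j l → concat (columnsFrom C j l) ↭ stack D j l
  concat-columnsFrom         C↭D j zero    = ↭-refl
  concat-columnsFrom {D = D} C↭D j (suc l) = ↭-trans (++⁺ (C↭D j) (concat-columnsFrom C↭D (suc j) l)) (↭-sym (stack-head D j l))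

-- Multiplying in a block

module Blocks {f ℓf c ℓ} {F : Field f ℓf} (charZero : CharZero F) {V : Set}
  (_≟ⱽ_ : DecidableEquality V) (𝔸 : TranspositionAlgebra F V c ℓ) (row col : V → ℕ)
  (E : ℕ → ℕ → V) (h : ℕ → ℕ)
  (row-E : ∀ {i j} → i < h j → row (E i j) ≡ i) (col-E : ∀ {i j} → i < h j → col (E i j) ≡ j)
  (h-antitone : ∀ {i j} → i ≤ j → h j ≤ h i)
  (a : V) (a≢E : ∀ {i j} → i < h j → a ≢ E i j) (u v J : ℕ) where

  open TranspositionAlgebra 𝔸
  open YoungSymmetrizer charZero _≟ⱽ_ 𝔸 row col
  open Shape charZero _≟ⱽ_ 𝔸 row col E h row-E col-E
  open ListLemmas
  open Stacks
  open import Data.List using (List; []; _∷_; _++_; length)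
  open import Data.List.Properties using (++-assoc; length-applyDownFrom)
  open import Data.List.Membership.Propositional using (_∈_)
  open import Data.List.Membership.Propositional.Properties using (∈-++⁺ˡ; ∈-++⁺ʳ; ∈-++⁻)
  open import Data.List.Relation.Binary.Permutation.Propositional as ↭ using (_↭_; ↭-sym; ↭-trans; ↭-reflexive)
  open import Data.List.Relation.Binary.Permutation.Propositional.Properties using (∈-resp-↭; ↭-length; ++⁺ʳ; shift; ++⁺ˡ; ++-comm)
  open import Data.List.Relation.Unary.Any using (here; there)
  open import Data.List.Relation.Unary.AllPairs using ([]; _∷_)
  open import Data.List.Relation.Unary.Unique.Propositional using (Unique)
  open import Data.Nat using (zero; suc; _≟_; _≤?_; _<?_; _∸_) renaming (_+_ to _+ⁿ_)
  import Data.Nat.Properties as ℕ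
  open import Data.Product using (_,_; proj₁; proj₂; _×_; ∃)
  open import Data.Sum using (_⊎_; inj₁; inj₂)
  open import Data.Empty using (⊥-elim)
  open import Data.Vec using ([]; _∷_)
  open import Relation.Nullary using (yes; no; ¬_)
  open import Relation.Binary.Reasoning.Setoid setoid

  block : ℕ → ℕ → List V
  block = stack column

  data BlockCell (j l : ℕ) : V → Set where
    cell : ∀ {i j′} → j ≤ j′ → j′ < j +ⁿ l → i < h j′ → BlockCell j l (E i j′)

  ∈-block⁻ : ∀ j l {e} → e ∈ block j l → BlockCell j l e
  ∈-block⁻ j (suc l) e∈ with ∈-++⁻ (column (j +ⁿ l)) e∈
  ... | inj₁ e∈c with ∈-Col (j +ⁿ l) _ e∈c
  ...   | k , k<h , ≡.refl = cell (ℕ.m≤m+n j l) (ℕ.+-monoʳ-< j (ℕ.n<1+n l)) k<h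
  ∈-block⁻ j (suc l) e∈ | inj₂ e∈b with ∈-block⁻ j l e∈b
  ...   | cell p q r = cell p (ℕ.<-trans q (ℕ.+-monoʳ-< j (ℕ.n<1+n l))) r

  ∈-block⁺ : ∀ {j l i j′} → j ≤ j′ → j′ < j +ⁿ l → i < h j′ → E i j′ ∈ block j l
  ∈-block⁺ {j} {zero}  p q r = ⊥-elim (ℕ.<⇒≱ q (≡.subst (_≤ _) (≡.sym (ℕ.+-identityʳ j)) p))
  ∈-block⁺ {j} {suc l} {j′ = j′} p q r with j′ ≟ j +ⁿ l
  ... | yes ≡.refl = ∈-++⁺ˡ (∈-column r)
  ... | no neq     = ∈-++⁺ʳ (column (j +ⁿ l)) (∈-block⁺ p (ℕ.≤∧≢⇒< (ℕ.≤-pred (≡.subst (j′ <_) (ℕ.+-suc j l) q)) neq) r)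

  chain-+ : ∀ j l → chain (j +ⁿ l) ≡ block j l ++ chain j
  chain-+ j zero    = ≡.cong chain (ℕ.+-identityʳ j)
  chain-+ j (suc l) = ≡.trans (≡.cong chain (ℕ.+-suc j l)) (≡.trans (≡.cong (column (j +ⁿ l) ++_) (chain-+ j l)) (≡.sym (++-assoc (column (j +ⁿ l)) _ _)))

  block-+ : ∀ j m n → block j (m +ⁿ n) ≡ block (j +ⁿ n) m ++ block j n
  block-+ j zero    n = ≡.refl
  block-+ j (suc m) n = ≡.trans (≡.cong₂ _++_ (≡.cong column index) (block-+ j m n)) (≡.sym (++-assoc (column (j +ⁿ n +ⁿ m)) _ _))
    where
    index : j +ⁿ (m +ⁿ n) ≡ j +ⁿ n +ⁿ m
    index = ≡.trans (≡.cong (j +ⁿ_) (ℕ.+-comm m n)) (≡.sym (ℕ.+-assoc j n m))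

  a#chain : ∀ j → a # chain j
  a#chain j e∈ with ∈-chain⁻ j e∈
  ... | cell _ i<h = a≢E i<h

  a#block : ∀ j l → a # block j l
  a#block j l e∈ with ∈-block⁻ j l e∈
  ... | cell _ _ i<h = a≢E i<h

  E#chain : ∀ {i j j′} → i < h j → j′ ≤ j → E i j # chain j′
  E#chain {j′ = j′} i<h j′≤j e∈ eq with ∈-chain⁻ j′ e∈
  ... | cell j″<j′ i″<h = ℕ.<-irrefl (≡.sym (proj₂ (E-injective i<h i″<h eq))) (ℕ.<-≤-trans j″<j′ j′≤j)

  E≢E : ∀ {i j i′ j′} → i < h j → i′ < h j′ → j ≢ j′ → E i j ≢ E i′ j′
  E≢E p q j≢j′ eq = j≢j′ (proj₂ (E-injective p q eq))

  E#column : ∀ {i j j′} → i < h j → j ≢ j′ → E i j # column j′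
  E#column {j′ = j′} i<h j≢j′ e∈ with ∈-Col j′ _ e∈
  ... | k , k<h , ≡.refl = E≢E i<h k<h j≢j′

  E#block : ∀ {i j′ j l} → i < h j′ → ¬ (j ≤ j′ × j′ < j +ⁿ l) → E i j′ # block j l
  E#block {j = j} {l} i<h out e∈ eq with ∈-block⁻ j l e∈
  ... | cell p q k<h with proj₂ (E-injective i<h k<h eq)
  ...   | ≡.refl = out (p , q)

  -- The state of w = c(T) Π (1 - x̃ᵢ / r̃ᵢ) once the blocks meeting the first j columns of S are multiplied in.
  record Stage (j : ℕ) (w : Carrier) : Set ℓ where
    field
      content-a     : w * ⋆ a (chain j) + nat u * w ≈ nat v * w
      antisymmetric : ∀ {i i′ j′} → j′ < J → i < h j′ → i′ < h j′ → i ≢ i′ → w * t (E i j′) (E i′ j′) ≈ -1ᴬ * w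
      previous      : ∀ {i j′} → j′ < j → i < h j′ → w * ⋆ (E i j′) (chain j′) ≈ nat j′ * w
      next          : ∀ {i j′} → j ≤ j′ → j′ < J → i < h j′ → w * (⋆ (E i j′) (chain j) + t (E i j′) a) ≈ nat j * w
      next-columns  : ∀ {i j′ k} → j ≤ j′ → j′ < J → j ≤ k → k < J → k ≢ j′ → i < h j′ → h j′ ≤ h k →
                      w * ⋆ (E i j′) (column k) ≈ w

  stage-compatible : ∀ {w} → Stage J w → Compatible J w
  stage-compatible st = record { antisymmetric = antisymmetric ; previous = previous }
    where open Stage st

  -- By `r-eq`, r + 1 = (j + l - v) + (u - H): the arm from column v to the end of the block plus
  -- the leg of column v below row H. By `s-eq`, s = -1 / (r + 1).
  module AddBlock {j l H r : ℕ} {w : Carrier} (st : Stage j w) (j+l≤J : j +ⁿ l ≤ J)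
    (level : ∀ {k} → j ≤ k → k < j +ⁿ l → h k ≡ H)
    (r-eq : suc r +ⁿ (H +ⁿ v) ≡ j +ⁿ l +ⁿ u)
    (s : K.Carrier) (s-eq : nat (suc r) * ι s + 1# ≈ 0#) where

    open Stage st

    private
      B : List V
      B = block j l
      P : List V
      P = chain j
      X̃ : Carrier
      X̃ = ⋆ a B
      w′ : Carrier
      w′ = w * (1# + ι s * X̃)

    through : ∀ {g} → X̃ * g ≈ g * X̃ → w′ * g ≈ w * g * (1# + ι s * X̃)
    through {g} com = begin
      w * (1# + ι s * X̃) * g
        ≈⟨ solve (w ∷ X̃ ∷ g ∷ []) (scalar s ∷ []) (λ w x g s → w :* (:1 :+ s :* x) :* g := w :* g :+ w :* s :* (x :* g)) ≡.refl ⟩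
      w * g + w * ι s * (X̃ * g)   ≈⟨ +-congˡ (*-congˡ com) ⟩
      w * g + w * ι s * (g * X̃)
        ≈⟨ solve (w ∷ X̃ ∷ g ∷ []) (scalar s ∷ []) (λ w x g s → w :* g :+ w :* s :* (g :* x) := w :* g :* (:1 :+ s :* x)) ≡.refl ⟩
      w * g * (1# + ι s * X̃)      ∎

    through-eigen : ∀ {g n} → X̃ * g ≈ g * X̃ → w * g ≈ ι n * w → w′ * g ≈ ι n * w′
    through-eigen com eq = trans (through com) (trans (*-congʳ eq) (*-assoc _ _ _))

    X̃-commutes : ∀ {g} → (∀ {b} → b ∈ B → t a b * g ≈ g * t a b) → X̃ * g ≈ g * X̃
    X̃-commutes {g} com = sym (∑-intertwine g g B λ b∈ → sym (com b∈))

    columns-eigen : ∀ {i k} k₀ m → j ≤ k → k < J → i < h k → ¬ (k₀ ≤ k × k < k₀ +ⁿ m) → k₀ +ⁿ m ≤ J → j ≤ k₀ →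
      (∀ {k′} → k₀ ≤ k′ → k′ < k₀ +ⁿ m → h k ≤ h k′) → w * ⋆ (E i k) (block k₀ m) ≈ nat m * w
    columns-eigen k₀ zero j≤k k<J i<h out ≤J j≤k₀ tall = trans (zeroʳ w) (sym (trans (*-congʳ ι-0) (zeroˡ w)))
    columns-eigen {i} {k} k₀ (suc m) j≤k k<J i<h out ≤J j≤k₀ tall = begin
      w * ⋆ x (column (k₀ +ⁿ m) ++ block k₀ m)
        ≈⟨ trans (*-congˡ (∑-++ (t x) (column (k₀ +ⁿ m)) (block k₀ m))) (distribˡ _ _ _) ⟩
      w * ⋆ x (column (k₀ +ⁿ m)) + w * ⋆ x (block k₀ m)
        ≈⟨ +-cong (next-columns j≤k k<J (ℕ.≤-trans j≤k₀ (ℕ.m≤m+n k₀ m)) (ℕ.<-≤-trans last< ≤J)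
                     (λ { ≡.refl → out (ℕ.m≤m+n k₀ m , last<) }) i<h (tall (ℕ.m≤m+n k₀ m) last<))
             (columns-eigen k₀ m j≤k k<J i<h (λ { (p , q) → out (p , ℕ.<-trans q last<) }) (ℕ.≤-trans (ℕ.<⇒≤ last<) ≤J) j≤k₀ λ p q → tall p (ℕ.<-trans q last<)) ⟩
      w + nat m * w ≈⟨ solve (w ∷ []) (natural m ∷ []) (λ w l → w :+ l :* w := (:1 :+ l) :* w) ≡.refl ⟩
      (1# + nat m) * w ≈⟨ *-congʳ (nat-suc m) ⟨
      nat (suc m) * w ∎
      where
      x = E i k
      last< : k₀ +ⁿ m < k₀ +ⁿ suc m
      last< = ℕ.+-monoʳ-< k₀ (ℕ.n<1+n m)

    -- A cell x of the block splits the block into the columns before it, the rest O of its own column,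
    -- and the columns after it.
    module At {i j′ : ℕ} (j≤j′ : j ≤ j′) (j′< : j′ < j +ⁿ l) (i<h : i < h j′) where

      x : V
      x = E i j′
      p m : ℕ
      p = j′ ∸ j
      m = j +ⁿ l ∸ suc j′
      B₁ B₂ : List V
      B₁ = block j p
      B₂ = block (suc j′) m

      j+p : j +ⁿ p ≡ j′
      j+p = ℕ.m+[n∸m]≡n j≤j′

      j′+m : suc j′ +ⁿ m ≡ j +ⁿ l
      j′+m = ℕ.m+[n∸m]≡n j′<

      j′<J : j′ < J
      j′<J = ℕ.<-≤-trans j′< j+l≤J

      l-split : l ≡ m +ⁿ suc p
      l-split = ℕ.+-cancelˡ-≡ j l (m +ⁿ suc p) (≡.trans (≡.sym j′+m) (≡.trans (≡.cong (λ k → suc k +ⁿ m) (≡.sym j+p))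
        (≡.trans (≡.cong (_+ⁿ m) (≡.sym (ℕ.+-suc j p))) (≡.trans (ℕ.+-assoc j (suc p) m) (≡.cong (j +ⁿ_) (ℕ.+-comm (suc p) m))))))

      plucked : ∃ λ O → column j′ ↭ x ∷ O
      plucked = pluck (∈-column i<h)
      O : List V
      O = proj₁ plucked

      column-split : column j′ ↭ x ∷ O
      column-split = proj₂ plucked

      length-O : suc (length O) ≡ H
      length-O = ≡.trans (≡.sym (↭-length column-split)) (≡.trans (length-applyDownFrom _ _) (level j≤j′ j′<))

      ∈-O : ∀ {e} → e ∈ O → ∃ λ k → k < h j′ × e ≡ E k j′ × k ≢ i
      ∈-O e∈ with ∈-Col j′ _ (∈-resp-↭ (↭-sym column-split) (there e∈))
      ... | k , k<h , ≡.refl = k , k<h , ≡.refl , λ { ≡.refl → head# (Unique-resp-↭ column-split column-unique) e∈ ≡.refl }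
        where
        column-unique : Unique (column j′)
        column-unique = ≡.subst Unique (partial-col ℕ.≤-refl) (class-unique col j′ (partial-unique j′ (h j′) ℕ.≤-refl))

      R : List V
      R = O ++ B₂

      block-split : B ↭ x ∷ R ++ B₁
      block-split = ↭-trans (↭-reflexive (≡.trans (≡.cong (block j) l-split) (≡.trans (block-+ j m (suc p))
          (≡.cong₂ (λ k k′ → block k m ++ column k′ ++ B₁) (≡.trans (ℕ.+-suc j p) (≡.cong suc j+p)) j+p))))
        (↭-trans (++⁺ˡ B₂ (++⁺ʳ B₁ column-split))
          (↭-trans (shift x B₂ (O ++ B₁)) (↭.prep x (↭-trans (↭-reflexive (≡.sym (++-assoc B₂ O B₁))) (++⁺ʳ B₁ (++-comm B₂ O))))))

      flat : ∀ {k′} → j ≤ k′ → k′ < j +ⁿ l → h j′ ≤ h k′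
      flat p q = ℕ.≤-reflexive (≡.trans (level j≤j′ j′<) (≡.sym (level p q)))

      before-eigen : w * ⋆ x B₁ ≈ nat p * w
      before-eigen = columns-eigen j p j≤j′ j′<J i<h (λ { (_ , q) → ℕ.<-irrefl (≡.sym j+p) q })
        (ℕ.≤-trans (ℕ.≤-reflexive j+p) (ℕ.<⇒≤ j′<J)) ℕ.≤-refl λ q q′ → flat q (ℕ.<-trans (≡.subst (_ <_) j+p q′) j′<)

      rest-eigen : w * ⋆ x R ≈ (nat (length O) * -1ᴬ + nat m) * w
      rest-eigen = begin
        w * ⋆ x (O ++ B₂)           ≈⟨ trans (*-congˡ (∑-++ (t x) O B₂)) (distribˡ _ _ _) ⟩
        w * ⋆ x O + w * ⋆ x B₂
          ≈⟨ +-cong (absorb-star col -1K -1² λ y∈ → own (∈-O y∈))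
               (columns-eigen (suc j′) m j≤j′ j′<J i<h (λ { (q , _) → ℕ.<-irrefl ≡.refl q }) (ℕ.≤-trans (ℕ.≤-reflexive j′+m) j+l≤J) (ℕ.m≤n⇒m≤1+n j≤j′)
                 λ {k″} q q′ → flat (ℕ.≤-trans j≤j′ (ℕ.<⇒≤ q)) (≡.subst (k″ <_) j′+m q′)) ⟩
        nat (length O) * (-1ᴬ * w) + nat m * w
          ≈⟨ solve (w ∷ []) (natural (length O) ∷ natural m ∷ scalar -1K ∷ []) (λ w o m e → o :* (e :* w) :+ m :* w := (o :* e :+ m) :* w) ≡.refl ⟩
        (nat (length O) * -1ᴬ + nat m) * w ∎
        where
        own : ∀ {y} → (∃ λ k → k < h j′ × y ≡ E k j′ × k ≢ i) → w * t x y ≈ -1ᴬ * w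
        own (k , k<h , ≡.refl , k≢i) = antisymmetric j′<J i<h k<h (≢-sym k≢i)

      -- r = j′ + m + u - |O| - v.
      sizes : nat (suc r) + (nat (length O) + nat v) ≈ nat j′ + (nat m + nat u)
      sizes = begin
        nat (suc r) + (nat (length O) + nat v) ≈⟨ +-congˡ (nat-+ (length O) v) ⟨
        nat (suc r) + nat (length O +ⁿ v)      ≈⟨ nat-+ (suc r) (length O +ⁿ v) ⟨
        nat (suc r +ⁿ (length O +ⁿ v))         ≡⟨ ≡.cong nat (ℕ.suc-injective arith) ⟩
        nat (j′ +ⁿ (m +ⁿ u))                   ≈⟨ nat-+ j′ (m +ⁿ u) ⟩
        nat j′ + nat (m +ⁿ u)                  ≈⟨ +-congˡ (nat-+ m u) ⟩
        nat j′ + (nat m + nat u)               ∎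
        where
        arith : suc (suc r +ⁿ (length O +ⁿ v)) ≡ suc (j′ +ⁿ (m +ⁿ u))
        arith = ≡.trans (≡.sym (ℕ.+-suc (suc r) (length O +ⁿ v))) (≡.trans (≡.cong (λ o → suc r +ⁿ (o +ⁿ v)) length-O)
          (≡.trans r-eq (≡.trans (≡.cong (_+ⁿ u) (≡.sym j′+m)) (≡.cong suc (ℕ.+-assoc j′ m u)))))

      T : Carrier
      T = t a x

      x≢a : x ≢ a
      x≢a = ≢-sym (a≢E i<h)

      X : Carrier
      X = ⋆ x (chain j′)

      chain-split : chain j′ ≡ B₁ ++ P
      chain-split = ≡.trans (≡.cong chain (≡.sym j+p)) (chain-+ j p)

      star-split : ∀ y → ⋆ y (chain j′) ≈ ⋆ y B₁ + ⋆ y P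
      star-split y = trans (reflexive (≡.cong (⋆ y) chain-split)) (∑-++ (t y) B₁ P)

      -- The columns of the block before x contribute 1 each, and the columns before the block
      -- contribute j once a is added to them.
      x-eigen : w * (X + T) ≈ nat j′ * w
      x-eigen = begin
        w * (X + T)                          ≈⟨ *-congˡ (+-cong (star-split x) (t-sym a x)) ⟩
        w * (⋆ x B₁ + ⋆ x P + t x a)
          ≈⟨ solve (w ∷ ⋆ x B₁ ∷ ⋆ x P ∷ t x a ∷ []) [] (λ w b p t → w :* (b :+ p :+ t) := w :* b :+ w :* (p :+ t)) ≡.refl ⟩
        w * ⋆ x B₁ + w * (⋆ x P + t x a)     ≈⟨ +-cong before-eigen (next j≤j′ j′<J i<h) ⟩
        nat p * w + nat j * w
          ≈⟨ solve (w ∷ []) (natural p ∷ natural j ∷ []) (λ w p j → p :* w :+ j :* w := (j :+ p) :* w) ≡.refl ⟩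
        (nat j + nat p) * w                  ≈⟨ *-congʳ (trans (sym (nat-+ j p)) (reflexive (≡.cong nat j+p))) ⟩
        nat j′ * w                           ∎

      R-commutes : ⋆ a R * X ≈ X * ⋆ a R
      R-commutes = sym (∑-intertwine X X R λ b∈ → sym (com b∈))
        where
        com : ∀ {b} → b ∈ R → t a b * X ≈ X * t a b
        com b∈ with ∈-++⁻ O b∈
        ... | inj₁ b∈O with ∈-O b∈O
        ...   | k , k<h , ≡.refl , k≢i = ⋆-disjoint (chain j′) x≢a (λ eq → k≢i (≡.sym (proj₁ (E-injective i<h k<h eq)))) (a#chain j′) (E#chain k<h ℕ.≤-refl)
        com b∈ | inj₂ b∈B with ∈-block⁻ (suc j′) m b∈B
        ...   | cell j′<k _ k<h = ⋆-disjoint (chain j′) x≢a (E≢E i<h k<h λ eq → ℕ.<-irrefl eq j′<k) (a#chain j′) (E#chain k<h (ℕ.<⇒≤ j′<k))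

      x#R : x # R
      x#R e∈ with ∈-++⁻ O e∈
      ... | inj₁ e∈O with ∈-O e∈O
      ...   | k , k<h , ≡.refl , k≢i = λ eq → k≢i (≡.sym (proj₁ (E-injective i<h k<h eq)))
      x#R e∈ | inj₂ e∈B with ∈-block⁻ (suc j′) m e∈B
      ...   | cell j′<k _ k<h = E≢E i<h k<h λ eq → ℕ.<-irrefl eq j′<k

      a#R : a # R
      a#R e∈ with ∈-++⁻ O e∈
      ... | inj₁ e∈O with ∈-O e∈O
      ...   | k , k<h , ≡.refl , k≢i = a≢E k<h
      a#R e∈ | inj₂ e∈B = a#block (suc j′) m e∈B

      -- X + T is the star of x over a and all previous columns. This set contains both a and b for
      -- each b in B₁, hence is invariant under (a , b).
      B₁-commutes : ⋆ a B₁ * (X + T) ≈ (X + T) * ⋆ a B₁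
      B₁-commutes = sym (∑-intertwine (X + T) (X + T) B₁ λ b∈ → sym (com b∈))
        where
        com : ∀ {b} → b ∈ B₁ → t a b * (X + T) ≈ (X + T) * t a b
        com {b} b∈ = begin
          t a b * (X + T)               ≈⟨ *-congˡ (trans (+-comm X T) (+-congʳ (t-sym a x))) ⟩
          t a b * ⋆ x (a ∷ chain j′)
            ≈⟨ ⋆-inside (#⇒All (a#chain j′) ∷ chain-unique j′) (a#block j p b∈) (here ≡.refl)
                 (there (≡.subst (b ∈_) (≡.sym chain-split) (∈-++⁺ˡ b∈)))
                 (λ { (here ≡.refl) → x≢a ; (there e∈) → E#chain i<h ℕ.≤-refl e∈ }) ⟩
          ⋆ x (a ∷ chain j′) * t a b    ≈⟨ *-congʳ (trans (+-congʳ (t-sym x a)) (+-comm T X)) ⟩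
          (X + T) * t a b               ∎

      X̃-split : X̃ ≈ T + (⋆ a R + ⋆ a B₁)
      X̃-split = trans (∑-↭ (t a) block-split) (+-congˡ (∑-++ (t a) R B₁))

      -- On w X̃ the star X misses the eigenvalue j′ by a multiple of w T. Of the three parts of X̃,
      -- the star over R passes X, the star over B₁ passes X + T, and T turns X into a star of a;
      -- collecting the eigenvalues with `sizes` gives the multiple r + 1.
      key : w * X̃ * X + nat (suc r) * (w * T) ≈ nat j′ * (w * X̃)
      key = trans (+-congʳ (*-congʳ (*-congˡ X̃-split))) (trans (cancel-by
        (solve (w ∷ T ∷ r̂ ∷ b̂ ∷ X ∷ ⋆ a P ∷ ⋆ x R ∷ [])
          (natural (suc r) ∷ natural j′ ∷ natural m ∷ natural (length O) ∷ natural u ∷ natural v ∷ scalar -1K ∷ [])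
          (λ w T r̂ b̂ X A Q r j m o u v e →
            w :* (T :+ (r̂ :+ b̂)) :* X :+ r :* (w :* T) :+
              (w :* (X :* r̂) :+ j :* w :* r̂ :+ w :* (T :* r̂) :+ w :* Q :* T :+ w :* ((b̂ :+ A) :* T) :+ v :* w :* T
               :+ w :* ((X :+ T) :* b̂) :+ j :* w :* b̂ :+ (j :+ (m :+ u)) :* (w :* T) :+ (:1 :+ e) :* (o :* (w :* T)))
            := j :* (w :* (T :+ (r̂ :+ b̂))) :+
              (w :* (r̂ :* X) :+ w :* (X :+ T) :* r̂ :+ w :* (Q :* T) :+ (o :* e :+ m) :* w :* T :+ w :* (T :* X) :+ (w :* A :+ u :* w) :* T
               :+ w :* (b̂ :* (X :+ T)) :+ w :* (X :+ T) :* b̂ :+ (r :+ (o :+ v)) :* (w :* T) :+ :0)) ≡.refl)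
        (+-cong (+-cong (+-cong (+-cong (+-cong (+-cong (+-cong (+-cong (+-cong
          (*-congˡ R-commutes)
          (*-congʳ x-eigen))
          (*-congˡ (sym (⋆-turn R (≢-sym x≢a) a#R x#R))))
          (*-congʳ (sym rest-eigen)))
          (*-congˡ (trans (*-congʳ (t-sym a x)) (trans (⋆-turn (chain j′) x≢a (E#chain i<h ℕ.≤-refl) (a#chain j′)) (*-cong (star-split a) (t-sym x a))))))
          (*-congʳ content-a))
          (*-congˡ B₁-commutes))
          (*-congʳ x-eigen))
          (*-congʳ sizes))
          (sym (trans (*-congʳ 1-1≈0) (zeroˡ _)))))
        (*-congˡ (*-congˡ (sym X̃-split))))
        where
        r̂ = ⋆ a R
        b̂ = ⋆ a B₁

      -- The defect - w T of w X cancels against the defect of s w X̃ X from `key`, by the choice of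
      -- s.
      previous-block : w′ * X ≈ nat j′ * w′
      previous-block = begin
        w * (1# + ι s * X̃) * X
          ≈⟨ solve (w ∷ X̃ ∷ X ∷ []) (scalar s ∷ []) (λ w x X s → w :* (:1 :+ s :* x) :* X := w :* X :+ s :* (w :* x :* X)) ≡.refl ⟩
        w * X + ι s * (w * X̃ * X)
          ≈⟨ cancel-by
               (solve (w ∷ X̃ ∷ X ∷ T ∷ []) (natural (suc r) ∷ natural j′ ∷ scalar s ∷ [])
                 (λ w x X T r j s →
                   w :* X :+ s :* (w :* x :* X) :+ (j :* w :+ s :* (j :* (w :* x)) :+ (r :* s :+ :1) :* (w :* T))
                   := j :* w :+ s :* (j :* (w :* x)) :+ (w :* (X :+ T) :+ s :* (w :* x :* X :+ r :* (w :* T)))) ≡.refl)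
               (trans (+-cong x-eigen (*-congˡ key)) (sym (trans (+-congˡ (trans (*-congʳ s-eq) (zeroˡ _))) (+-identityʳ _)))) ⟩
        nat j′ * w + ι s * (nat j′ * (w * X̃))
          ≈⟨ solve (w ∷ X̃ ∷ []) (natural j′ ∷ scalar s ∷ []) (λ w x j s → j :* w :+ s :* (j :* (w :* x)) := j :* (w :* (:1 :+ s :* x))) ≡.refl ⟩
        nat j′ * (w * (1# + ι s * X̃)) ∎

      -- Carried past T, the star of a becomes the star of x over a and all other cells of the first
      -- j + l columns. Its eigenvalues on w add up to j + p + m - |O| = j + l - H.
      block-eigen : w * (T * ⋆ a (B ++ P)) + nat H * (w * T) ≈ nat (j +ⁿ l) * (w * T)
      block-eigen = cancel-by
        (solve (w ∷ T ∷ w * (T * ⋆ a (B ++ P)) ∷ ⋆ x P ∷ ⋆ x R ∷ ⋆ x B₁ ∷ t x a ∷ [])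
          (natural H ∷ natural (j +ⁿ l) ∷ natural j ∷ natural p ∷ natural m ∷ natural (length O) ∷ scalar -1K ∷ [])
          (λ w T L Px Rx Bx t H n j p m o e →
            L :+ H :* (w :* T) :+
              (w :* ((t :+ (Rx :+ (Bx :+ Px))) :* T) :+ (o :* e :+ m) :* w :* T :+ p :* w :* T :+ j :* w :* T :+ n :* (w :* T) :+ (:1 :+ o) :* (w :* T) :+ :0)
            := n :* (w :* T) :+
              (L :+ w :* Rx :* T :+ w :* Bx :* T :+ w :* (Px :+ t) :* T :+ (j :+ (p :+ (m :+ :1))) :* (w :* T) :+ H :* (w :* T) :+ (:1 :+ e) :* (o :* (w :* T)))) ≡.refl)
        (+-cong (+-cong (+-cong (+-cong (+-cong (+-cong
          (*-congˡ turn)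
          (*-congʳ rest-eigen))
          (*-congʳ before-eigen))
          (*-congʳ (next j≤j′ j′<J i<h)))
          (*-congʳ total))
          (*-congʳ (trans (reflexive (≡.cong nat (≡.sym length-O))) (nat-suc (length O)))))
          (trans (*-congʳ 1-1≈0) (zeroˡ _)))
        where
        total : nat j + (nat p + (nat m + 1#)) ≈ nat (j +ⁿ l)
        total = begin
          nat j + (nat p + (nat m + 1#)) ≈⟨ +-congˡ (solve [] (natural p ∷ natural m ∷ []) (λ p m → p :+ (m :+ :1) := m :+ (:1 :+ p)) ≡.refl) ⟩
          nat j + (nat m + (1# + nat p)) ≈⟨ +-congˡ (trans (+-congˡ (sym (nat-suc p))) (sym (nat-+ m (suc p)))) ⟩
          nat j + nat (m +ⁿ suc p)       ≈⟨ trans (sym (nat-+ j _)) (reflexive (≡.cong (λ k → nat (j +ⁿ k)) (≡.sym l-split))) ⟩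
          nat (j +ⁿ l)                   ∎
        all↭ : B ++ P ↭ x ∷ R ++ (B₁ ++ P)
        all↭ = ↭-trans (++⁺ʳ P block-split) (↭.prep x (↭-reflexive (++-assoc R B₁ P)))
        stars : ∀ y → ⋆ y (R ++ (B₁ ++ P)) ≈ ⋆ y R + (⋆ y B₁ + ⋆ y P)
        stars y = trans (∑-++ (t y) R (B₁ ++ P)) (+-congˡ (∑-++ (t y) B₁ P))
        a#rest : a # R ++ (B₁ ++ P)
        a#rest e∈ with ∈-++⁻ R e∈
        ... | inj₁ e∈R = a#R e∈R
        ... | inj₂ e∈′ = a#chain j′ (≡.subst (_ ∈_) (≡.sym chain-split) e∈′)
        x#rest : x # R ++ (B₁ ++ P)
        x#rest e∈ with ∈-++⁻ R e∈
        ... | inj₁ e∈R = x#R e∈R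
        ... | inj₂ e∈′ = E#chain i<h ℕ.≤-refl (≡.subst (_ ∈_) (≡.sym chain-split) e∈′)
        turn : T * ⋆ a (B ++ P) ≈ (t x a + (⋆ x R + (⋆ x B₁ + ⋆ x P))) * T
        turn = begin
          T * ⋆ a (B ++ P)                        ≈⟨ *-congˡ (∑-↭ (t a) all↭) ⟩
          T * (T + ⋆ a (R ++ (B₁ ++ P)))          ≈⟨ distribˡ _ _ _ ⟩
          T * T + T * ⋆ a (R ++ (B₁ ++ P))
            ≈⟨ +-cong (*-congʳ (t-sym a x)) (trans (⋆-turn _ (≢-sym x≢a) a#rest x#rest) (*-congʳ (stars x))) ⟩
          t x a * T + (⋆ x R + (⋆ x B₁ + ⋆ x P)) * T ≈⟨ distribʳ _ _ _ ⟨
          (t x a + (⋆ x R + (⋆ x B₁ + ⋆ x P))) * T ∎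

    inside-or-outside : ∀ {k} → (j ≤ k × k < j +ⁿ l) ⊎ ¬ (j ≤ k × k < j +ⁿ l)
    inside-or-outside {k} with j ≤? k | k <? j +ⁿ l
    ... | yes p | yes q = inj₁ (p , q)
    ... | yes p | no ¬q = inj₂ λ { (_ , q) → ¬q q }
    ... | no ¬p | _     = inj₂ λ { (p , _) → ¬p p }

    cut : ∀ {b} → b ∈ B → BlockCell j l b
    cut = ∈-block⁻ j l

    stage-next : Stage (j +ⁿ l) w′
    -- The star over the block produces an extra w X̃, while on s w X̃ the full star acts by j + l -
    -- H. By `r-eq` the surplus is (1 + s (r + 1)) w X̃, which is zero: the value of s that restores
    -- `previous` also restores the content of a.
    stage-next .Stage.content-a = begin
      w′ * ⋆ a (chain (j +ⁿ l)) + nat u * w′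
        ≈⟨ +-congʳ (*-congˡ (reflexive (≡.cong (⋆ a) (chain-+ j l)))) ⟩
      w′ * G + nat u * w′
        ≈⟨ cancel-by
             (solve (w ∷ X̃ ∷ G ∷ ⋆ a P ∷ []) (natural u ∷ natural v ∷ natural H ∷ natural (j +ⁿ l) ∷ natural (suc r) ∷ scalar s ∷ [])
               (λ w x G A u v H n r s →
                 w :* (:1 :+ s :* x) :* G :+ u :* (w :* (:1 :+ s :* x))
                   :+ (w :* (x :+ A) :+ s :* (n :* (w :* x)) :+ v :* w :+ (r :+ (H :+ v)) :* (s :* (w :* x)) :+ :0)
                 := v :* (w :* (:1 :+ s :* x))
                   :+ (w :* G :+ s :* (w :* (x :* G) :+ H :* (w :* x)) :+ (w :* A :+ u :* w) :+ (n :+ u) :* (s :* (w :* x)) :+ (r :* s :+ :1) :* (w :* x))) ≡.refl)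
             (+-cong (+-cong (+-cong (+-cong (*-congˡ (∑-++ (t a) B P)) (*-congˡ block-sum)) content-a)
               (*-congʳ (trans (sym (nat-+ (j +ⁿ l) u)) (trans (reflexive (≡.cong nat (≡.sym r-eq))) (trans (nat-+ (suc r) (H +ⁿ v)) (+-congˡ (nat-+ H v)))))))
               (trans (*-congʳ s-eq) (zeroˡ _))) ⟩
      nat v * w′ ∎
      where
      G = ⋆ a (B ++ P)
      block-sum : w * (X̃ * G) + nat H * (w * X̃) ≈ nat (j +ⁿ l) * (w * X̃)
      block-sum = begin
        w * (X̃ * G) + nat H * (w * X̃)
          ≈⟨ +-cong (trans (*-congˡ (∑-*ʳ G (t a) B)) (∑-*ˡ w _ B)) (trans (*-congˡ (∑-*ˡ w (t a) B)) (∑-*ˡ (nat H) _ B)) ⟩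
        ∑ (λ b → w * (t a b * G)) B + ∑ (λ b → nat H * (w * t a b)) B
          ≈⟨ ∑-+ (λ b → w * (t a b * G)) (λ b → nat H * (w * t a b)) B ⟨
        ∑ (λ b → w * (t a b * G) + nat H * (w * t a b)) B
          ≈⟨ ∑-cong B (λ b∈ → at (cut b∈)) ⟩
        ∑ (λ b → nat (j +ⁿ l) * (w * t a b)) B
          ≈⟨ trans (*-congˡ (∑-*ˡ w (t a) B)) (∑-*ˡ (nat (j +ⁿ l)) _ B) ⟨
        nat (j +ⁿ l) * (w * X̃) ∎
        where
        at : ∀ {b} → BlockCell j l b → w * (t a b * G) + nat H * (w * t a b) ≈ nat (j +ⁿ l) * (w * t a b)
        at (cell p q k<h) = At.block-eigen p q k<h
    -- Two cells of one column lie both inside or both outside the block, so their transposition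
    -- leaves X̃ invariant.
    stage-next .Stage.antisymmetric {i} {i′} {k} k<J i<h i′<h i≢i′ = through-eigen commutes (antisymmetric k<J i<h i′<h i≢i′)
      where
      x≢y : E i k ≢ E i′ k
      x≢y eq = i≢i′ (proj₁ (E-injective i<h i′<h eq))
      commutes : X̃ * t (E i k) (E i′ k) ≈ t (E i k) (E i′ k) * X̃
      commutes with inside-or-outside {k}
      ... | inj₁ (p , q) = sym (⋆-inside B-unique x≢y (∈-block⁺ p q i<h) (∈-block⁺ p q i′<h) (a#block j l))
        where
        B-unique : Unique B
        B-unique = unique-++⁻ˡ B (≡.subst Unique (chain-+ j l) (chain-unique (j +ⁿ l)))
      ... | inj₂ out = sym (⋆-disjoint B (a≢E i<h) (a≢E i′<h) (E#block i<h out) (E#block i′<h out))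
    stage-next .Stage.previous {i} {k} k<j+l i<h with j ≤? k
    ... | yes j≤k = At.previous-block j≤k k<j+l i<h
    ... | no j≰k  = through-eigen (X̃-commutes λ b∈ → com (cut b∈)) (previous (ℕ.≰⇒> j≰k) i<h)
      where
      com : ∀ {b} → BlockCell j l b → t a b * ⋆ (E i k) (chain k) ≈ ⋆ (E i k) (chain k) * t a b
      com (cell p q k<h) = ⋆-disjoint (chain k) (≢-sym (a≢E i<h)) (E≢E i<h k<h λ { ≡.refl → j≰k p }) (a#chain k) (E#chain k<h (ℕ.<⇒≤ (ℕ.<-≤-trans (ℕ.≰⇒> j≰k) p)))
    -- The sum now runs over a and the whole longer chain, block included, so it commutes with each
    -- (a , b) of X̃.
    stage-next .Stage.next {i} {k} j+l≤k k<J i<h = through-eigen (X̃-commutes λ b∈ → com b∈ (cut b∈)) (begin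
      w * (⋆ x (chain (j +ⁿ l)) + t x a)
        ≈⟨ *-congˡ (+-congʳ (trans (reflexive (≡.cong (⋆ x) (chain-+ j l))) (∑-++ (t x) B P))) ⟩
      w * (⋆ x B + ⋆ x P + t x a)
        ≈⟨ solve (w ∷ ⋆ x B ∷ ⋆ x P ∷ t x a ∷ []) [] (λ w b p t → w :* (b :+ p :+ t) := w :* b :+ w :* (p :+ t)) ≡.refl ⟩
      w * ⋆ x B + w * (⋆ x P + t x a)
        ≈⟨ +-cong (columns-eigen j l j≤k k<J i<h (λ { (_ , q) → ℕ.<⇒≱ q j+l≤k }) j+l≤J ℕ.≤-refl λ _ q → h-antitone (ℕ.<⇒≤ (ℕ.<-≤-trans q j+l≤k))) (next j≤k k<J i<h) ⟩
      nat l * w + nat j * w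
        ≈⟨ solve (w ∷ []) (natural l ∷ natural j ∷ []) (λ w p j → p :* w :+ j :* w := (j :+ p) :* w) ≡.refl ⟩
      (nat j + nat l) * w ≈⟨ *-congʳ (nat-+ j l) ⟨
      nat (j +ⁿ l) * w ∎)
      where
      x = E i k
      j≤k : j ≤ k
      j≤k = ℕ.≤-trans (ℕ.m≤m+n j l) j+l≤k
      com : ∀ {b} → b ∈ B → BlockCell j l b → t a b * (⋆ x (chain (j +ⁿ l)) + t x a) ≈ (⋆ x (chain (j +ⁿ l)) + t x a) * t a b
      com b∈ (cell p q k<h) = trans (*-congˡ (+-comm _ _)) (trans
        (⋆-inside (#⇒All (a#chain (j +ⁿ l)) ∷ chain-unique (j +ⁿ l)) (a≢E k<h) (here ≡.refl) (there (∈-chain⁺ q k<h))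
          (λ { (here ≡.refl) → ≢-sym (a≢E i<h) ; (there e∈) → E#chain i<h j+l≤k e∈ }))
        (*-congʳ (+-comm _ _)))
    stage-next .Stage.next-columns {i} {k} {k′} j+l≤k k<J j+l≤k′ k′<J k′≢k i<h tall =
      trans (through (X̃-commutes λ b∈ → com (cut b∈)))
        (*-congʳ (next-columns (ℕ.≤-trans (ℕ.m≤m+n j l) j+l≤k) k<J (ℕ.≤-trans (ℕ.m≤m+n j l) j+l≤k′) k′<J k′≢k i<h tall))
      where
      com : ∀ {b} → BlockCell j l b → t a b * ⋆ (E i k) (column k′) ≈ ⋆ (E i k) (column k′) * t a b
      com (cell p q b<h) = ⋆-disjoint (column k′) (≢-sym (a≢E i<h)) (E≢E i<h b<h λ { ≡.refl → ℕ.<⇒≱ q j+l≤k }) a#column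
        (E#column b<h λ { ≡.refl → ℕ.<⇒≱ q j+l≤k′ })
        where
        a#column : a # column k′
        a#column e∈ with ∈-Col k′ _ e∈
        ... | _ , k<h , ≡.refl = a≢E k<h

-- The product formula

module ProductFormula {f ℓf c ℓ} {F : Field f ℓf} (charZero : CharZero F) {V : Set}
  (_≟ⱽ_ : DecidableEquality V) (𝔸 : TranspositionAlgebra F V c ℓ) (row col : V → ℕ)
  (E : ℕ → ℕ → V) (h hᵀ : ℕ → ℕ) (u v J : ℕ)
  (row-E : ∀ {i j} → i < hᵀ j → row (E i j) ≡ i) (col-E : ∀ {i j} → i < hᵀ j → col (E i j) ≡ j)
  (h-antitone : ∀ {i j} → i ≤ j → h j ≤ h i) (hᵀ-antitone : ∀ {i j} → i ≤ j → hᵀ j ≤ hᵀ i)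
  (h-v : h v ≡ u) (hᵀ-v : hᵀ v ≡ suc u) (hᵀ≡h : ∀ {j} → j ≢ v → hᵀ j ≡ h j) (v<J : v < J) where

  open TranspositionAlgebra 𝔸
  open YoungSymmetrizer charZero _≟ⱽ_ 𝔸 row col
  open ListLemmas
  open import Data.List using (List; []; _∷_; _++_)
  open import Data.Nat using (zero; _≟_; _∸_) renaming (_+_ to _+ⁿ_)
  import Data.Nat.Properties as ℕ
  open import Data.Product using (_,_; proj₂; _×_; ∃)
  open import Data.Vec using ([]; _∷_)
  open import Relation.Nullary using (yes; no)
  open import Relation.Binary.Reasoning.Setoid setoid
  import Algebra.Properties.Ring K.ring as KP

  h≤hᵀ : ∀ j → h j ≤ hᵀ j
  h≤hᵀ j with j ≟ v
  ... | yes ≡.refl = ≡.subst₂ _≤_ (≡.sym h-v) (≡.sym hᵀ-v) (ℕ.n≤1+n u)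
  ... | no j≢v     = ℕ.≤-reflexive (≡.sym (hᵀ≡h j≢v))

  S-row : ∀ {i j} → i < h j → row (E i j) ≡ i
  S-row {j = j} i<h = row-E (ℕ.<-≤-trans i<h (h≤hᵀ j))

  S-col : ∀ {i j} → i < h j → col (E i j) ≡ j
  S-col {j = j} i<h = col-E (ℕ.<-≤-trans i<h (h≤hᵀ j))

  module S = Shape charZero _≟ⱽ_ 𝔸 row col E h S-row S-col
  module T = Shape charZero _≟ⱽ_ 𝔸 row col E hᵀ row-E col-E

  a : V
  a = E u v

  u<hᵀ : u < hᵀ v
  u<hᵀ = ℕ.≤-reflexive (≡.sym hᵀ-v)

  a≢E : ∀ {i j} → i < h j → a ≢ E i j
  a≢E {i} {j} i<h eq with T.E-injective u<hᵀ (ℕ.<-≤-trans i<h (h≤hᵀ j)) eq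
  ... | ≡.refl , ≡.refl = ℕ.<-irrefl ≡.refl (≡.subst (u <_) h-v i<h)

  open Blocks charZero _≟ⱽ_ 𝔸 row col E h S-row S-col h-antitone a a≢E u v J public

  cᵀ cˢ : Carrier
  cᵀ = cc (T.chain J)
  cˢ = cc (S.chain J)

  column≡ : ∀ {j} → j ≢ v → T.column j ≡ S.column j
  column≡ {j} j≢v = ≡.cong (T.Col j) (hᵀ≡h j≢v)

  chain≡ : ∀ {j} → j ≤ v → T.chain j ≡ S.chain j
  chain≡ {zero}  _   = ≡.refl
  chain≡ {suc j} j<v = ≡.cong₂ _++_ (column≡ λ { ≡.refl → ℕ.<-irrefl ≡.refl j<v }) (chain≡ (ℕ.<⇒≤ j<v))

  cᵀ-previous : ∀ {i k} j → j ≤ k → k < J → i < hᵀ k → cᵀ * ⋆ (E i k) (T.chain j) ≈ nat j * cᵀ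
  cᵀ-previous zero    j≤k k<J i<h = trans (zeroʳ _) (sym (trans (*-congʳ ι-0) (zeroˡ _)))
  cᵀ-previous {i} {k} (suc j) j<k k<J i<h = begin
    cᵀ * ⋆ x (T.column j ++ T.chain j)
      ≈⟨ trans (*-congˡ (∑-++ (t x) (T.column j) (T.chain j))) (distribˡ _ _ _) ⟩
    cᵀ * ⋆ x (T.column j) + cᵀ * ⋆ x (T.chain j)
      ≈⟨ +-cong (T.chain-garnir (ℕ.<-trans j<k k<J) k<J (λ j≡k → ℕ.<-irrefl j≡k j<k) i<h (hᵀ-antitone (ℕ.<⇒≤ j<k)))
                (cᵀ-previous j (ℕ.<⇒≤ j<k) k<J i<h) ⟩
    cᵀ + nat j * cᵀ ≈⟨ solve (cᵀ ∷ []) (natural j ∷ []) (λ c j → c :+ j :* c := (:1 :+ j) :* c) ≡.refl ⟩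
    (1# + nat j) * cᵀ ≈⟨ *-congʳ (nat-suc j) ⟨
    nat (suc j) * cᵀ ∎
    where x = E i k

  column-v : T.column v ≡ a ∷ S.column v
  column-v = ≡.trans (≡.cong (T.Col v) hᵀ-v) (≡.cong (λ k → a ∷ T.Col v k) (≡.sym h-v))

  cᵀ-column-a : cᵀ * ⋆ a (S.column v) ≈ nat u * (-1ᴬ * cᵀ)
  cᵀ-column-a = trans (absorb-star col -1K -1² λ y∈ → mate (S.∈-Col v (h v) y∈))
    (*-congʳ (reflexive (≡.cong nat (≡.trans (length-applyDownFrom _ (h v)) h-v))))
    where
    open import Data.List.Properties using (length-applyDownFrom)
    mate : ∀ {y} → (∃ λ k → k < h v × y ≡ E k v) → cᵀ * t a y ≈ -1ᴬ * cᵀ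
    mate (k , k<h , ≡.refl) = T.chain-antisymmetric v<J u<hᵀ (ℕ.<-≤-trans k<h (h≤hᵀ v))
      λ { ≡.refl → ℕ.<-irrefl ≡.refl (≡.subst (u <_) h-v k<h) }

  -- The first v + 1 columns meet no block, so the induction can start behind them with c(T) itself,
  -- on which a acts by its content v - u in T.
  first-stage : Stage (suc v) cᵀ
  first-stage .Stage.content-a = begin
    cᵀ * ⋆ a (S.column v ++ S.chain v) + nat u * cᵀ
      ≈⟨ +-congʳ (trans (*-congˡ (∑-++ (t a) (S.column v) (S.chain v))) (distribˡ _ _ _)) ⟩
    cᵀ * ⋆ a (S.column v) + cᵀ * ⋆ a (S.chain v) + nat u * cᵀ
      ≈⟨ +-congʳ (+-cong cᵀ-column-a (trans (*-congˡ (reflexive (≡.cong (⋆ a) (≡.sym (chain≡ ℕ.≤-refl))))) (cᵀ-previous v ℕ.≤-refl v<J u<hᵀ))) ⟩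
    nat u * (-1ᴬ * cᵀ) + nat v * cᵀ + nat u * cᵀ
      ≈⟨ solve (cᵀ ∷ []) (natural u ∷ natural v ∷ scalar -1K ∷ []) (λ w i j e → i :* (e :* w) :+ j :* w :+ i :* w := j :* w :+ (:1 :+ e) :* (i :* w)) ≡.refl ⟩
    nat v * cᵀ + (1# + -1ᴬ) * (nat u * cᵀ) ≈⟨ trans (+-congˡ (trans (*-congʳ 1-1≈0) (zeroˡ _))) (+-identityʳ _) ⟩
    nat v * cᵀ ∎
  first-stage .Stage.antisymmetric {j′ = j} j<J i<h i′<h = T.chain-antisymmetric j<J (ℕ.<-≤-trans i<h (h≤hᵀ j)) (ℕ.<-≤-trans i′<h (h≤hᵀ j))
  first-stage .Stage.previous {i} {j} j≤v i<h = trans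
    (*-congˡ (reflexive (≡.cong (⋆ (E i j)) (≡.sym (chain≡ (ℕ.≤-pred j≤v))))))
    (cᵀ-previous j ℕ.≤-refl (ℕ.≤-<-trans (ℕ.≤-pred j≤v) v<J) (ℕ.<-≤-trans i<h (h≤hᵀ j)))
  -- Adding a completes column v of S to column v of T, so the Garnir relations of T cover all v + 1
  -- columns.
  first-stage .Stage.next {i} {k} v<k k<J i<h = begin
    cᵀ * (⋆ x (S.column v ++ S.chain v) + t x a)
      ≈⟨ *-congˡ (trans (+-comm _ _) (reflexive (≡.cong (⋆ x) (≡.cong₂ _++_ (≡.sym column-v) (≡.sym (chain≡ ℕ.≤-refl)))))) ⟩
    cᵀ * ⋆ x (T.chain (suc v)) ≈⟨ cᵀ-previous (suc v) v<k k<J (ℕ.<-≤-trans i<h (h≤hᵀ k)) ⟩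
    nat (suc v) * cᵀ ∎
    where x = E i k
  first-stage .Stage.next-columns {i} {k} {k′} v<k k<J v<k′ k′<J k′≢k i<h tall =
    trans (*-congˡ (reflexive (≡.cong (⋆ (E i k)) (≡.sym (column≡ k′≢v)))))
      (T.chain-garnir k′<J k<J k′≢k (ℕ.<-≤-trans i<h (h≤hᵀ k)) (≡.subst₂ _≤_ (≡.sym (hᵀ≡h k≢v)) (≡.sym (hᵀ≡h k′≢v)) tall))
    where
    k≢v : k ≢ v
    k≢v eq = ℕ.<-irrefl (≡.sym eq) v<k
    k′≢v : k′ ≢ v
    k′≢v eq = ℕ.<-irrefl (≡.sym eq) v<k′

  -- This is -1 / r̃: the index j already counts the first v + 1 columns, whence the subtraction of
  -- v, and the inner `suc` compensates for `recip` inverting the successor of its argument.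
  blockScalar : ℕ → ℕ → K.Carrier
  blockScalar j l = K.- recip (j +ⁿ l +ⁿ u ∸ suc (h j +ⁿ v))

  blockFactor : ℕ → ℕ → Carrier
  blockFactor j l = 1# + ι (blockScalar j l) * ⋆ a (block j l)

  blockProduct : ℕ → List ℕ → Carrier
  blockProduct j []       = 1#
  blockProduct j (l ∷ ls) = blockFactor j l * blockProduct (j +ⁿ l) ls

  data Levels : ℕ → List ℕ → Set where
    done : Levels J []
    next : ∀ {j l ls} → (∀ {k} → j ≤ k → k < j +ⁿ suc l → h k ≡ h j) → Levels (j +ⁿ suc l) ls → Levels j (suc l ∷ ls)

  levels≤J : ∀ {j ls} → Levels j ls → j ≤ J
  levels≤J done          = ℕ.≤-refl
  levels≤J (next {j} _ lv) = ℕ.≤-trans (ℕ.m≤m+n j _) (levels≤J lv)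

  stage-resp : ∀ {j w w′} → w ≈ w′ → Stage j w → Stage j w′
  stage-resp eq st = record
    { content-a     = trans (+-cong (*-congʳ (sym eq)) (*-congˡ (sym eq))) (trans content-a (*-congˡ eq))
    ; antisymmetric = λ p q r s → trans (*-congʳ (sym eq)) (trans (antisymmetric p q r s) (*-congˡ eq))
    ; previous      = λ p q → trans (*-congʳ (sym eq)) (trans (previous p q) (*-congˡ eq))
    ; next          = λ p q r → trans (*-congʳ (sym eq)) (trans (Stage.next st p q r) (*-congˡ eq))
    ; next-columns  = λ p q r s x y z → trans (*-congʳ (sym eq)) (trans (next-columns p q r s x y z) eq)
    }
    where open Stage st

  final-stage : ∀ {j ls w} → v < j → Stage j w → Levels j ls → Stage J (w * blockProduct j ls)
  final-stage v<j st done = stage-resp (sym (*-identityʳ _)) st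
  final-stage {j} {suc l ∷ ls} {w} v<j st (next level lv) = stage-resp (*-assoc _ _ _)
    (final-stage (ℕ.<-≤-trans v<j (ℕ.m≤m+n j _)) (AddBlock.stage-next {r = r} st (levels≤J lv) level r-eq (blockScalar j (suc l)) s-eq) lv)
    where
    r : ℕ
    r = j +ⁿ suc l +ⁿ u ∸ suc (h j +ⁿ v)
    r-eq : suc r +ⁿ (h j +ⁿ v) ≡ j +ⁿ suc l +ⁿ u
    -- The truncated subtraction is exact because h j ≤ h v = u and v < j.
    r-eq = ≡.trans (≡.sym (ℕ.+-suc r (h j +ⁿ v))) (ℕ.m∸n+n≡m (ℕ.≤-trans (ℕ.≤-reflexive (≡.sym (ℕ.+-suc (h j) v)))
      (ℕ.≤-trans (ℕ.+-mono-≤ (≡.subst (h j ≤_) h-v (h-antitone (ℕ.<⇒≤ v<j))) v<j)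
        (ℕ.≤-trans (ℕ.≤-reflexive (ℕ.+-comm u j)) (ℕ.+-monoˡ-≤ u (ℕ.m≤m+n j (suc l)))))))
    s-eq : nat (suc r) * ι (blockScalar j (suc l)) + 1# ≈ 0#
    s-eq = begin
      nat (suc r) * ι (K.- recip r) + 1#
        ≈⟨ +-cong (trans (sym (ι-* _ _)) (ι-cong (K.trans (K.sym (KP.-‿distribʳ-* _ _)) (K.-‿cong (proj₂ (K.inverse _ (charZero r))))))) (sym ι-1) ⟩
      ι (K.- K.1#) + ι K.1#   ≈⟨ ι-+ _ _ ⟨
      ι (K.- K.1# K.+ K.1#)   ≈⟨ trans (ι-cong (K.-‿inverseˡ K.1#)) ι-0 ⟩
      0#                      ∎

  blockProduct-commutes : ∀ {j g} ls → (∀ k l → j ≤ k → g * ⋆ a (block k l) ≈ ⋆ a (block k l) * g) →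
    blockProduct j ls * g ≈ g * blockProduct j ls
  blockProduct-commutes []       com = trans (*-identityˡ _) (sym (*-identityʳ _))
  blockProduct-commutes {j} {g} (l ∷ ls) com = begin
    (1# + ι s * X) * Z * g
      ≈⟨ trans (*-assoc _ _ _) (*-congˡ (blockProduct-commutes ls λ k l′ p → com k l′ (ℕ.≤-trans (ℕ.m≤m+n j l) p))) ⟩
    (1# + ι s * X) * (g * Z)
      ≈⟨ solve (X ∷ Z ∷ g ∷ []) (scalar s ∷ []) (λ x z g s → (:1 :+ s :* x) :* (g :* z) := g :* z :+ s :* (x :* g) :* z) ≡.refl ⟩
    g * Z + ι s * (X * g) * Z ≈⟨ +-congˡ (*-congʳ (*-congˡ (sym (com j l ℕ.≤-refl)))) ⟩
    g * Z + ι s * (g * X) * Z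
      ≈⟨ solve (X ∷ Z ∷ g ∷ []) (scalar s ∷ []) (λ x z g s → g :* z :+ s :* (g :* x) :* z := g :* ((:1 :+ s :* x) :* z)) ≡.refl ⟩
    g * ((1# + ι s * X) * Z)  ∎
    where
    s = blockScalar j l
    X = ⋆ a (block j l)
    Z = blockProduct (j +ⁿ l) ls

  -- The blocks are removed from the left. For b in the leftmost block, the row transposition (e ,
  -- b) must come from c(S) through the later factors Z, and it does so because neither e nor b lies
  -- in a later block.
  product-absorbed : ∀ {j ls} → v < j → Levels j ls → cᵀ * (blockProduct j ls * cˢ) ≈ cᵀ * cˢ
  product-absorbed v<j done = *-congˡ (*-identityˡ _)
  product-absorbed {j} {suc l ∷ ls} v<j (next level lv) = begin
    cᵀ * ((1# + ι s * X) * Z * cˢ)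
      ≈⟨ solve (cᵀ ∷ X ∷ Z ∷ cˢ ∷ []) (scalar s ∷ [])
           (λ c x z d s → c :* ((:1 :+ s :* x) :* z :* d) := c :* (z :* d) :+ s :* (c :* x :* (z :* d))) ≡.refl ⟩
    cᵀ * (Z * cˢ) + ι s * (cᵀ * X * (Z * cˢ))
      ≈⟨ +-cong (product-absorbed (ℕ.<-≤-trans v<j (ℕ.m≤m+n j _)) lv) (*-congˡ block-vanishes) ⟩
    cᵀ * cˢ + ι s * 0# ≈⟨ trans (+-congˡ (zeroʳ _)) (+-identityʳ _) ⟩
    cᵀ * cˢ ∎
    where
    s = blockScalar j (suc l)
    X = ⋆ a (block j (suc l))
    Z = blockProduct (j +ⁿ suc l) ls
    -- In row i the cells e = (i, v) and b are row mates in S, while e shares the column of a in T.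
    cell-vanishes : ∀ {b} → BlockCell j (suc l) b → cᵀ * t a b * (Z * cˢ) ≈ 0#
    cell-vanishes (cell {i} {k} j≤k k<j+l i<h) = x+x≈0⇒x≈0 (begin
      y + y            ≈⟨ +-congʳ negate ⟩
      -1ᴬ * y + y      ≈⟨ solve (y ∷ []) (scalar -1K ∷ []) (λ y e → e :* y :+ y := (:1 :+ e) :* y) ≡.refl ⟩
      (1# + -1ᴬ) * y   ≈⟨ trans (*-congʳ 1-1≈0) (zeroˡ _) ⟩
      0#               ∎)
      where
      b e : V
      b = E i k
      e = E i v
      y : Carrier
      y = cᵀ * t a b * (Z * cˢ)
      v<k : v < k
      v<k = ℕ.<-≤-trans v<j j≤k
      i<hv : i < h v
      i<hv = ℕ.<-≤-trans i<h (h-antitone (ℕ.<⇒≤ v<k))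
      e≢b : e ≢ b
      e≢b = E≢E i<hv i<h λ eq → ℕ.<-irrefl eq v<k
      e-b-commutes : Z * t e b ≈ t e b * Z
      e-b-commutes = blockProduct-commutes ls λ k′ l′ p → ⋆-disjoint (block k′ l′) (a≢E i<hv) (a≢E i<h)
        (E#block {l = l′} i<hv λ { (q , _) → ℕ.<⇒≱ v<j (ℕ.≤-trans (ℕ.≤-trans (ℕ.m≤m+n j _) p) q) })
        (E#block {l = l′} i<h λ { (q , _) → ℕ.<⇒≱ k<j+l (ℕ.≤-trans p q) })
      negate : y ≈ -1ᴬ * y
      negate = begin
        cᵀ * t a b * (Z * cˢ)
          ≈⟨ *-congˡ (*-congˡ (cc-row (S.chain-unique J) e≢b (S.∈-chain⁺ v<J i<hv) (S.∈-chain⁺ (ℕ.<-≤-trans k<j+l (levels≤J lv)) i<h) (≡.trans (S-row i<hv) (≡.sym (S-row i<h))))) ⟨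
        cᵀ * t a b * (Z * (t e b * cˢ))  ≈⟨ *-congˡ (trans (sym (*-assoc _ _ _)) (trans (*-congʳ e-b-commutes) (*-assoc _ _ _))) ⟩
        cᵀ * t a b * (t e b * (Z * cˢ))
          ≈⟨ solve (cᵀ ∷ t a b ∷ t e b ∷ Z * cˢ ∷ []) [] (λ c x y z → c :* x :* (y :* z) := c :* (x :* y) :* z) ≡.refl ⟩
        cᵀ * (t a b * t e b) * (Z * cˢ)
          ≈⟨ *-congʳ (*-congˡ (trans (*-congˡ (t-sym e b)) (t-braid (a≢E i<h) (a≢E i<hv) (≢-sym e≢b)))) ⟩
        cᵀ * (t a e * t a b) * (Z * cˢ)
          ≈⟨ solve (cᵀ ∷ t a e ∷ t a b ∷ Z * cˢ ∷ []) [] (λ c x y z → c :* (x :* y) :* z := c :* x :* (y :* z)) ≡.refl ⟩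
        cᵀ * t a e * (t a b * (Z * cˢ))
          ≈⟨ *-congʳ (T.chain-antisymmetric v<J u<hᵀ (ℕ.<-≤-trans i<hv (h≤hᵀ v)) λ { ≡.refl → ℕ.<-irrefl ≡.refl (≡.subst (u <_) h-v i<hv) }) ⟩
        -1ᴬ * cᵀ * (t a b * (Z * cˢ))
          ≈⟨ solve (cᵀ ∷ t a b ∷ Z * cˢ ∷ []) (scalar -1K ∷ []) (λ c x z e → e :* c :* (x :* z) := e :* (c :* x :* z)) ≡.refl ⟩
        -1ᴬ * y ∎
    block-vanishes : cᵀ * X * (Z * cˢ) ≈ 0#
    block-vanishes = begin
      cᵀ * X * (Z * cˢ)                          ≈⟨ *-congʳ (∑-*ˡ cᵀ (t a) B) ⟩
      ∑ (λ b → cᵀ * t a b) B * (Z * cˢ)          ≈⟨ ∑-*ʳ (Z * cˢ) (λ b → cᵀ * t a b) B ⟩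
      ∑ (λ b → cᵀ * t a b * (Z * cˢ)) B          ≈⟨ ∑-cong B (λ b∈ → cell-vanishes (∈-block⁻ j (suc l) b∈)) ⟩
      ∑ (λ _ → 0#) B                             ≈⟨ trans (∑-const 0# B) (zeroʳ _) ⟩
      0#                                         ∎
      where B = block j (suc l)

  module _ (N : ℕ) (h≤N : ∀ j → h j ≤ N) where

    open S.Hooks N h≤N h-antitone

    product-formula : ∀ {ls} → Levels (suc v) ls → cᵀ * cˢ ≈ cᵀ * (ι (weight J) * blockProduct (suc v) ls)
    product-formula {ls} lv = begin
      cᵀ * cˢ             ≈⟨ product-absorbed (ℕ.n<1+n v) lv ⟨
      cᵀ * (Z * cˢ)       ≈⟨ *-assoc _ _ _ ⟨
      cᵀ * Z * cˢ         ≈⟨ chain-absorbs (stage-compatible (final-stage (ℕ.n<1+n v) first-stage lv)) J ℕ.≤-refl ⟩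
      ι (weight J) * (cᵀ * Z)
        ≈⟨ solve (cᵀ ∷ Z ∷ []) (scalar (weight J) ∷ []) (λ c z s → s :* (c :* z) := c :* (s :* z)) ≡.refl ⟩
      cᵀ * (ι (weight J) * Z) ∎
      where Z = blockProduct (suc v) ls

-- Products of hook lengths

module HookProducts where

  open CellCounts
  open import Data.List using (List; []; _∷_)
  open import Data.List.Relation.Unary.All as All using (All; []; _∷_)
  open import Data.List.Relation.Unary.AllPairs using (AllPairs; []; _∷_)
  open import Data.Nat using (zero; suc; _+_; _*_; _∸_; _<?_; z≤n; _≟_)
  open import Data.Nat.Properties as ℕ
  open import Data.Nat.Solver using (module +-*-Solver)
  open import Data.Empty using (⊥-elim)
  open import Relation.Nullary using (yes; no; ¬_)
  open ≡ using (refl; sym; trans; cong; cong₂; subst)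
  open ≡.≡-Reasoning

  ∏ : ℕ → (ℕ → ℕ) → ℕ
  ∏ zero    g = 1
  ∏ (suc n) g = ∏ n g * g n

  ∏-cong : ∀ n {g g′} → (∀ i → i < n → g i ≡ g′ i) → ∏ n g ≡ ∏ n g′
  ∏-cong zero    eq = refl
  ∏-cong (suc n) eq = cong₂ _*_ (∏-cong n λ i i<n → eq i (m<n⇒m<1+n i<n)) (eq n ≤-refl)

  ∏-split : ∀ m n g → ∏ (m + n) g ≡ ∏ m g * ∏ n (λ i → g (m + i))
  ∏-split m zero    g = trans (cong (λ k → ∏ k g) (+-identityʳ m)) (sym (*-identityʳ _))
  ∏-split m (suc n) g = trans (cong (λ k → ∏ k g) (+-suc m n))
    (trans (cong (_* g (m + n)) (∏-split m n g)) (*-assoc (∏ m g) _ _))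

  ∏-head : ∀ n g → ∏ (suc n) g ≡ g 0 * ∏ n (λ i → g (suc i))
  ∏-head n g = trans (∏-split 1 n g) (cong (_* ∏ n (λ i → g (suc i))) (+-identityʳ (g 0)))

  ∏-reverse : ∀ n → ∏ n (λ i → n ∸ i) ≡ ∏ n suc
  ∏-reverse zero    = refl
  ∏-reverse (suc n) = trans (∏-head n (λ i → suc n ∸ i)) (trans (cong (suc n *_) (∏-reverse n)) (*-comm (suc n) (∏ n suc)))

  legs : ℕ → List ℕ → ℕ
  legs y []       = 0
  legs y (q ∷ qs) = indicator (y <? q) + legs y qs

  legs-zero : ∀ {y} qs → All (_≤ y) qs → legs y qs ≡ 0
  legs-zero []       []       = refl
  legs-zero {y} (q ∷ qs) (q≤y ∷ ≤y) with y <? q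
  ... | yes y<q = ⊥-elim (<⇒≱ y<q q≤y)
  ... | no _    = legs-zero qs ≤y

  -- For a row of length l above rows of lengths qs, this is the product of its hook lengths, each
  -- increased by d. The value d = 1 describes the same cells after the row has been extended by one
  -- cell.
  armLeg : ℕ → ℕ → List ℕ → ℕ
  armLeg d l qs = ∏ l (λ y → l ∸ y + legs y qs + d)

  -- Lengthening the row by a cell while deleting the row q below it changes nothing in the first q
  -- columns, where an arm gained replaces a leg lost. In the later columns there are no legs, and
  -- the arms acquire one new largest value.
  armLeg-shift : ∀ d l q qs → q ≤ l → All (_≤ q) qs → armLeg d (suc l) qs ≡ (suc l ∸ q + d) * armLeg d l (q ∷ qs)
  armLeg-shift d l q qs q≤l ≤q with l ∸ q | m+[n∸m]≡n q≤l
  ... | n | refl = begin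
    ∏ (suc (q + n)) long                                 ≡⟨ cong (λ k → ∏ k long) (sym (+-suc q n)) ⟩
    ∏ (q + suc n) long                                   ≡⟨ ∏-split q (suc n) long ⟩
    ∏ q long * ∏ (suc n) (λ z → long (q + z))            ≡⟨ cong₂ _*_ (∏-cong q near) (∏-cong (suc n) λ z _ → far-long z) ⟩
    ∏ q short * ∏ (suc n) (λ z → suc n ∸ z + d)          ≡⟨ cong (∏ q short *_) (∏-head n (λ z → suc n ∸ z + d)) ⟩
    ∏ q short * ((suc n + d) * ∏ n (λ z → n ∸ z + d))    ≡⟨ solve 3 (λ a b c → a :* (b :* c) := b :* (a :* c)) refl (∏ q short) (suc n + d) _ ⟩
    (suc n + d) * (∏ q short * ∏ n (λ z → n ∸ z + d))
      ≡⟨ cong₂ _*_ (cong (_+ d) (sym (trans (cong (_∸ q) (sym (+-suc q n))) (m+n∸m≡n q (suc n))))) (cong (∏ q short *_) (∏-cong n λ z _ → sym (far-short z))) ⟩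
    (suc (q + n) ∸ q + d) * (∏ q short * ∏ n (λ z → short (q + z))) ≡⟨ cong ((suc (q + n) ∸ q + d) *_) (sym (∏-split q n short)) ⟩
    (suc (q + n) ∸ q + d) * ∏ (q + n) short              ∎
    where
    open +-*-Solver
    long short : ℕ → ℕ
    long y  = suc (q + n) ∸ y + legs y qs + d
    short y = q + n ∸ y + legs y (q ∷ qs) + d
    near : ∀ y → y < q → long y ≡ short y
    near y y<q with y <? q
    ... | no y≮q = ⊥-elim (y≮q y<q)
    ... | yes _  = cong (_+ d) (trans (cong (_+ legs y qs) (+-∸-assoc 1 (≤-trans (<⇒≤ y<q) (m≤m+n q n)))) (sym (+-suc (q + n ∸ y) (legs y qs))))
    none : ∀ z → legs (q + z) qs ≡ 0
    none z = legs-zero qs (All.map (λ x≤q → ≤-trans x≤q (m≤m+n q z)) ≤q)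
    far-long : ∀ z → long (q + z) ≡ suc n ∸ z + d
    far-long z = cong (_+ d) (trans (cong (suc (q + n) ∸ (q + z) +_) (none z)) (trans (+-identityʳ _)
      (trans (cong (_∸ (q + z)) (sym (+-suc q n))) ([m+n]∸[m+o]≡n∸o q (suc n) z))))
    far-short : ∀ z → short (q + z) ≡ n ∸ z + d
    far-short z = cong (_+ d) (trans (cong (q + n ∸ (q + z) +_) (trans (cong (_+ legs (q + z) qs) off) (none z))) (trans (+-identityʳ _)
      ([m+n]∸[m+o]≡n∸o q n z)))
      where
      off : indicator (q + z <? q) ≡ 0
      off with q + z <? q
      ... | yes lt = ⊥-elim (<⇒≱ lt (m≤m+n q z))
      ... | no _   = refl

  module Counting (h : ℕ → ℕ) (h-antitone : ∀ {i j} → i ≤ j → h j ≤ h i) where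

    rowCount-mono : ∀ k {i j} → i ≤ j → rowCount h k i ≤ rowCount h k j
    rowCount-mono k {j = zero}  z≤n = z≤n
    rowCount-mono k {i} {suc j} i≤j with i ≟ suc j
    ... | yes refl = ≤-refl
    ... | no neq   = ≤-trans (rowCount-mono k (≤-pred (≤∧≢⇒< i≤j neq))) (m≤n+m _ _)

    <-rowCount⁺ : ∀ {k y} j → y < j → k < h y → y < rowCount h k j
    <-rowCount⁺ {k} {y} j y<j k<h = subst (_≤ rowCount h k j) (rowCount-full h (suc y) λ i i≤y → <-≤-trans k<h (h-antitone (≤-pred i≤y))) (rowCount-mono k y<j)

    rowCount-stop : ∀ {k y} j → ¬ k < h y → y ≤ j → rowCount h k j ≤ y
    rowCount-stop         zero    k≮h z≤n = z≤n
    rowCount-stop {k} {y} (suc j) k≮h y≤j with y ≟ suc j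
    ... | yes refl = rowCount≤ h k (suc j)
    ... | no neq with k <? h j
    ...   | yes k<h = ⊥-elim (k≮h (<-≤-trans k<h (h-antitone (≤-pred (≤∧≢⇒< y≤j neq)))))
    ...   | no _    = rowCount-stop j k≮h (≤-pred (≤∧≢⇒< y≤j neq))

    rowCount-antitone : ∀ {k k′} j → k ≤ k′ → rowCount h k′ j ≤ rowCount h k j
    rowCount-antitone zero    k≤k′ = z≤n
    rowCount-antitone {k} {k′} (suc j) k≤k′ = +-mono-≤ ind (rowCount-antitone j k≤k′)
      where
      ind : indicator (k′ <? h j) ≤ indicator (k <? h j)
      ind with k′ <? h j | k <? h j
      ... | yes p | yes _ = ≤-refl
      ... | yes p | no ¬q = ⊥-elim (¬q (≤-<-trans k≤k′ p))
      ... | no _  | _     = z≤n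

    -- Row i reaches column y exactly when i < h y, also after the rows are cut off at column j,
    -- since y < j.
    legs-counts : ∀ {y} j k n → y < j → h y ≤ k + n → legs y (rowCounts h j k n) ≡ h y ∸ k
    legs-counts {y} j k zero    y<j h≤ = sym (m≤n⇒m∸n≡0 (subst (h y ≤_) (+-identityʳ k) h≤))
    legs-counts {y} j k (suc n) y<j h≤ with k <? h y | y <? rowCount h k j | legs-counts j (suc k) n y<j (subst (h y ≤_) (+-suc k n) h≤)
    ... | yes k<h | yes _ | ih = trans (cong suc ih) (trans (sym (+-∸-assoc 1 k<h)) refl)
    ... | yes k<h | no ¬p | ih = ⊥-elim (¬p (<-rowCount⁺ j y<j k<h))
    ... | no k≮h  | yes p | ih = ⊥-elim (<⇒≱ p (rowCount-stop j k≮h (<⇒≤ y<j)))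
    ... | no k≮h  | no _  | ih = trans ih (trans (m≤n⇒m∸n≡0 (m≤n⇒m≤1+n (≮⇒≥ k≮h))) (sym (m≤n⇒m∸n≡0 (≮⇒≥ k≮h))))

    counts-bounded : ∀ {i} j k n → i ≤ k → All (_≤ rowCount h i j) (rowCounts h j k n)
    counts-bounded j k zero    i≤k = []
    counts-bounded j k (suc n) i≤k = rowCount-antitone j i≤k ∷ counts-bounded j (suc k) n (m≤n⇒m≤1+n i≤k)

    counts-sorted : ∀ j k n → AllPairs (λ q q′ → q′ ≤ q) (rowCounts h j k n)
    counts-sorted j k zero    = []
    counts-sorted j k (suc n) = counts-bounded j (suc k) n (n≤1+n k) ∷ counts-sorted j (suc k) n

    rowHooks : ℕ → ℕ → ℕ
    rowHooks k l = ∏ l (λ y → l ∸ y + (h y ∸ suc k))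

    -- Arms are cut off at column J, so that the product follows the construction of the shape by
    -- columns.
    hookProduct : ℕ → ℕ → ℕ
    hookProduct N J = ∏ N (λ k → rowHooks k (rowCount h k J))

-- The weight as a product of hook lengths

module HookFormula {f ℓf} {F : Field f ℓf} (charZero : CharZero F) where

  open Field F
  open CharacteristicZero {F = F} charZero
  open CellCounts
  open HookProducts
  open CentralSemiringSolver semiring
  open import Data.List using (List; []; _∷_)
  open import Data.List.Relation.Unary.All as All using (All; []; _∷_)
  open import Data.List.Relation.Unary.AllPairs using (AllPairs; []; _∷_)
  open import Data.Nat using (zero; suc; _∸_; _<?_) renaming (_+_ to _+ⁿ_; _*_ to _*ⁿ_)
  import Data.Nat.Properties as ℕ
  open import Data.Product using (_,_)
  open import Data.Vec using ([]; _∷_)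
  open import Relation.Nullary using (yes; no)
  open import Data.Empty using (⊥-elim)
  open import Relation.Binary.Reasoning.Setoid setoid

  private
    ! : Carrier → CentralElement
    ! x = x , *-comm x

  embed-+ : ∀ m n → embed F (m +ⁿ n) ≈ embed F m + embed F n
  embed-+ zero    n = sym (+-identityˡ _)
  embed-+ (suc m) n = trans (+-congˡ (embed-+ m n)) (sym (+-assoc _ _ _))

  embed-* : ∀ m n → embed F (m *ⁿ n) ≈ embed F m * embed F n
  embed-* zero    n = sym (zeroˡ _)
  embed-* (suc m) n = trans (embed-+ n (m *ⁿ n)) (trans (+-congˡ (embed-* m n))
    (trans (+-congʳ (sym (*-identityˡ _))) (sym (distribʳ _ _ _))))

  ∏ᴷ : ℕ → (ℕ → Carrier) → Carrier
  ∏ᴷ zero    g = 1#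
  ∏ᴷ (suc n) g = ∏ᴷ n g * g n

  -- Applying `armLeg-shift` for d = 0 and d = 1 moves both products to a row of length l + 1
  -- without q below it; the two scalars that appear have exactly the quotient which q contributes
  -- to `rowFactor`. With no rows below, the claim is l! (l + 1) = (l + 1)!.
  rowFactor-hooks : ∀ l qs → All (_≤ l) qs → AllPairs (λ q q′ → q′ ≤ q) qs →
    embed F (armLeg 0 l qs) * rowFactor (suc l) qs ≈ embed F (armLeg 1 l qs)
  rowFactor-hooks l [] ≤l sorted = trans (sym (embed-* (armLeg 0 l []) (suc l))) (reflexive (≡.cong (embed F) shift))
    where
    shift : armLeg 0 l [] *ⁿ suc l ≡ armLeg 1 l []
    shift = ≡.trans (≡.cong (_*ⁿ suc l) (∏-cong l λ y _ → ≡.trans (ℕ.+-identityʳ _) (ℕ.+-identityʳ _)))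
      (≡.trans (≡.cong (_*ⁿ suc l) (∏-reverse l)) (≡.trans (≡.sym (∏-reverse (suc l)))
        (≡.trans (≡.cong (∏ l (λ i → suc l ∸ i) *ⁿ_) (ℕ.m+n∸n≡m 1 l)) (≡.trans (ℕ.*-identityʳ _)
          (∏-cong l λ y y<l → ≡.trans (ℕ.+-∸-assoc 1 (ℕ.<⇒≤ y<l)) (≡.trans (≡.sym (ℕ.+-comm (l ∸ y) 1)) (≡.cong (_+ⁿ 1) (≡.sym (ℕ.+-identityʳ _)))))))))
  rowFactor-hooks l (q ∷ qs) (q≤l ∷ ≤l) (≤q ∷ sorted) = begin
    embed F A * (R * (embed F d * recip d))
      ≈⟨ solve [] (! (embed F A) ∷ ! R ∷ ! (embed F d) ∷ ! (recip d) ∷ []) (λ a r d i → a :* (r :* (d :* i)) := d :* a :* r :* i) ≡.refl ⟩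
    embed F d * embed F A * R * recip d
      ≈⟨ *-congʳ (*-congʳ (trans (sym (embed-* d A)) (reflexive (≡.cong (embed F) (≡.trans (≡.cong (_*ⁿ A) (≡.sym (ℕ.+-identityʳ d))) (≡.sym (armLeg-shift 0 l q qs q≤l ≤q))))))) ⟩
    embed F (armLeg 0 (suc l) qs) * R * recip d
      ≈⟨ *-congʳ (rowFactor-hooks (suc l) qs (All.map ℕ.m≤n⇒m≤1+n ≤l) sorted) ⟩
    embed F (armLeg 1 (suc l) qs) * recip d
      ≈⟨ *-congʳ (trans (reflexive (≡.cong (embed F) (≡.trans (armLeg-shift 1 l q qs q≤l ≤q) (≡.cong (_*ⁿ A⁺) (ℕ.+-comm d 1))))) (embed-* (suc d) A⁺)) ⟩
    embed F (suc d) * embed F A⁺ * recip d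
      ≈⟨ solve [] (! (embed F (suc d)) ∷ ! (embed F A⁺) ∷ ! (recip d) ∷ []) (λ d a i → d :* a :* i := d :* i :* a) ≡.refl ⟩
    embed F (suc d) * recip d * embed F A⁺ ≈⟨ trans (*-congʳ (embed-recip d)) (*-identityˡ _) ⟩
    embed F A⁺ ∎
    where
    d = suc l ∸ q
    A = armLeg 0 l (q ∷ qs)
    A⁺ = armLeg 1 l (q ∷ qs)
    R = rowFactor (suc (suc l)) qs

  module _ (h : ℕ → ℕ) (N : ℕ) (h≤N : ∀ j → h j ≤ N) (h-antitone : ∀ {i j} → i ≤ j → h j ≤ h i) where

    open HookWeights {F = F} charZero h N
    open Counting h h-antitone

    private
      factor : ℕ → ℕ → Carrier
      factor i j = rowFactor (suc j) (rowCounts h j (suc i) (N ∸ suc i))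

    columnWeight-factorial : ∀ j i → columnWeight j i ≈ ∏ᴷ i (λ k → factor k j) * embed F (∏ i suc)
    columnWeight-factorial j zero    = sym (trans (*-identityˡ _) (+-identityʳ 1#))
    columnWeight-factorial j (suc i) = begin
      factor i j * embed F (suc i) * columnWeight j i ≈⟨ *-congˡ (columnWeight-factorial j i) ⟩
      factor i j * embed F (suc i) * (Q * embed F (∏ i suc))
        ≈⟨ solve [] (! (factor i j) ∷ ! (embed F (suc i)) ∷ ! Q ∷ ! (embed F (∏ i suc)) ∷ []) (λ f s q p → f :* s :* (q :* p) := q :* f :* (p :* s)) ≡.refl ⟩
      Q * factor i j * (embed F (∏ i suc) * embed F (suc i)) ≈⟨ *-congˡ (embed-* (∏ i suc) (suc i)) ⟨
      Q * factor i j * embed F (∏ i suc *ⁿ suc i) ∎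
      where Q = ∏ᴷ i (λ k → factor k j)

    -- A new cell at the end of row k increases the j hooks before it by 1, which `factor` accounts
    -- for, and its own hook has length h j - k.
    row-grows : ∀ j k → k < h j → embed F (rowHooks k j) * factor k j * embed F (h j ∸ k) ≈ embed F (rowHooks k (suc j))
    row-grows j k k<h = begin
      embed F (rowHooks k j) * factor k j * embed F (h j ∸ k)
        ≈⟨ *-congʳ (*-congʳ (reflexive (≡.cong (embed F) (∏-cong j λ y y<j → ≡.trans (≡.cong (j ∸ y +ⁿ_) (≡.sym (leg y y<j))) (≡.sym (ℕ.+-identityʳ _)))))) ⟩
      embed F (armLeg 0 j qs) * factor k j * embed F (h j ∸ k)
        ≈⟨ *-congʳ (rowFactor-hooks j qs (All.map (λ q≤ → ℕ.≤-trans q≤ (rowCount≤ h k j)) (counts-bounded j (suc k) _ (ℕ.n≤1+n k))) (counts-sorted j (suc k) _)) ⟩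
      embed F (armLeg 1 j qs) * embed F (h j ∸ k) ≈⟨ embed-* (armLeg 1 j qs) (h j ∸ k) ⟨
      embed F (armLeg 1 j qs *ⁿ (h j ∸ k))
        ≡⟨ ≡.cong (embed F) (≡.cong₂ _*ⁿ_ (∏-cong j λ y y<j → arm y y<j) last) ⟩
      embed F (rowHooks k (suc j)) ∎
      where
      qs = rowCounts h j (suc k) (N ∸ suc k)
      leg : ∀ y → y < j → legs y qs ≡ h y ∸ suc k
      leg y y<j = legs-counts j (suc k) (N ∸ suc k) y<j (≡.subst (h y ≤_) (≡.sym (ℕ.m+[n∸m]≡n (ℕ.<-≤-trans k<h (h≤N j)))) (h≤N y))
      arm : ∀ y → y < j → j ∸ y +ⁿ legs y qs +ⁿ 1 ≡ suc j ∸ y +ⁿ (h y ∸ suc k)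
      arm y y<j = ≡.trans (ℕ.+-comm _ 1) (≡.trans (≡.cong (λ m → suc (j ∸ y +ⁿ m)) (leg y y<j)) (≡.cong (_+ⁿ (h y ∸ suc k)) (≡.sym (ℕ.+-∸-assoc 1 (ℕ.<⇒≤ y<j)))))
      last : h j ∸ k ≡ suc j ∸ j +ⁿ (h j ∸ suc k)
      last = ≡.trans (ℕ.+-∸-assoc 1 k<h) (≡.cong (_+ⁿ (h j ∸ suc k)) (≡.sym (ℕ.m+n∸n≡m 1 j)))

    rows-grow : ∀ j n → n ≤ h j →
      embed F (∏ n (λ k → rowHooks k (rowCount h k j))) * ∏ᴷ n (λ k → factor k j) * embed F (∏ n (λ k → h j ∸ k))
        ≈ embed F (∏ n (λ k → rowHooks k (rowCount h k (suc j))))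
    rows-grow j zero    n≤h = trans (*-cong (trans (*-identityʳ _) (+-identityʳ 1#)) (+-identityʳ 1#)) (trans (*-identityʳ _) (sym (+-identityʳ 1#)))
    rows-grow j (suc n) n<h = begin
      embed F (P *ⁿ p) * (Q * q) * embed F (M *ⁿ m)
        ≈⟨ *-cong (*-congʳ (embed-* P p)) (embed-* M m) ⟩
      embed F P * embed F p * (Q * q) * (embed F M * embed F m)
        ≈⟨ solve [] (! (embed F P) ∷ ! (embed F p) ∷ ! Q ∷ ! q ∷ ! (embed F M) ∷ ! (embed F m) ∷ [])
             (λ P p Q q M m → P :* p :* (Q :* q) :* (M :* m) := P :* Q :* M :* (p :* q :* m)) ≡.refl ⟩
      embed F P * Q * embed F M * (embed F p * q * embed F m)
        ≈⟨ *-cong (rows-grow j n (ℕ.<⇒≤ n<h)) (trans (*-congʳ (*-congʳ (reflexive (≡.cong (λ l → embed F (rowHooks n l)) (full j ℕ.≤-refl))))) (row-grows j n n<h)) ⟩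
      embed F P⁺ * embed F (rowHooks n (suc j))
        ≈⟨ *-congˡ (reflexive (≡.cong (λ l → embed F (rowHooks n l)) (≡.sym full⁺))) ⟩
      embed F P⁺ * embed F (rowHooks n (rowCount h n (suc j))) ≈⟨ embed-* P⁺ _ ⟨
      embed F (P⁺ *ⁿ rowHooks n (rowCount h n (suc j))) ∎
      where
      P = ∏ n (λ k → rowHooks k (rowCount h k j))
      P⁺ = ∏ n (λ k → rowHooks k (rowCount h k (suc j)))
      p = rowHooks n (rowCount h n j)
      Q = ∏ᴷ n (λ k → factor k j)
      q = factor n j
      M = ∏ n (λ k → h j ∸ k)
      m = h j ∸ n
      full : ∀ i → i ≤ j → rowCount h n i ≡ i
      full i i≤j = rowCount-full h i λ y y<i → ℕ.<-≤-trans n<h (h-antitone (ℕ.<⇒≤ (ℕ.<-≤-trans y<i i≤j)))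
      full⁺ : rowCount h n (suc j) ≡ suc j
      full⁺ = rowCount-full h (suc j) λ y y<i → ℕ.<-≤-trans n<h (h-antitone (ℕ.≤-pred y<i))

    -- The column symmetrizer contributes the factorial of h j; taken in reverse order, its factors
    -- are the hook lengths of the cells of the new last column. Rows from h j on are unaffected by
    -- that column.
    hooks-grow : ∀ j → columnWeight j (h j) * embed F (hookProduct N j) ≈ embed F (hookProduct N (suc j))
    hooks-grow j = begin
      columnWeight j (h j) * embed F (hookProduct N j)
        ≈⟨ *-cong (trans (columnWeight-factorial j (h j)) (*-congˡ (reflexive (≡.cong (embed F) (≡.sym (∏-reverse (h j)))))))
             (trans (reflexive (≡.cong (embed F) (split j))) (embed-* P D)) ⟩
      Q * embed F (∏ (h j) (λ k → h j ∸ k)) * (embed F P * embed F D)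
        ≈⟨ solve [] (! Q ∷ ! (embed F (∏ (h j) (λ k → h j ∸ k))) ∷ ! (embed F P) ∷ ! (embed F D) ∷ [])
             (λ Q M P D → Q :* M :* (P :* D) := P :* Q :* M :* D) ≡.refl ⟩
      embed F P * Q * embed F (∏ (h j) (λ k → h j ∸ k)) * embed F D
        ≈⟨ *-congʳ (rows-grow j (h j) ℕ.≤-refl) ⟩
      embed F P⁺ * embed F D ≈⟨ embed-* P⁺ D ⟨
      embed F (P⁺ *ⁿ D)
        ≡⟨ ≡.cong (λ d → embed F (P⁺ *ⁿ d)) (∏-cong (N ∸ h j) λ i _ → ≡.cong (rowHooks (h j +ⁿ i)) (≡.sym (unchanged i))) ⟩
      embed F (P⁺ *ⁿ ∏ (N ∸ h j) (λ i → rowHooks (h j +ⁿ i) (rowCount h (h j +ⁿ i) (suc j))))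
        ≡⟨ ≡.cong (embed F) (split (suc j)) ⟨
      embed F (hookProduct N (suc j)) ∎
      where
      P = ∏ (h j) (λ k → rowHooks k (rowCount h k j))
      P⁺ = ∏ (h j) (λ k → rowHooks k (rowCount h k (suc j)))
      D = ∏ (N ∸ h j) (λ i → rowHooks (h j +ⁿ i) (rowCount h (h j +ⁿ i) j))
      Q = ∏ᴷ (h j) (λ k → factor k j)
      split : ∀ J → hookProduct N J ≡ ∏ (h j) (λ k → rowHooks k (rowCount h k J)) *ⁿ ∏ (N ∸ h j) (λ i → rowHooks (h j +ⁿ i) (rowCount h (h j +ⁿ i) J))
      split J = ≡.trans (≡.cong (λ n → ∏ n (λ k → rowHooks k (rowCount h k J))) (≡.sym (ℕ.m+[n∸m]≡n (h≤N j)))) (∏-split (h j) (N ∸ h j) _)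
      unchanged : ∀ i → rowCount h (h j +ⁿ i) (suc j) ≡ rowCount h (h j +ⁿ i) j
      unchanged i with h j +ⁿ i <? h j
      ... | yes lt = ⊥-elim (ℕ.<⇒≱ lt (ℕ.m≤m+n (h j) i))
      ... | no _   = ≡.refl

    weight-hooks : ∀ J → weight J ≈ embed F (hookProduct N J)
    weight-hooks zero    = sym (trans (reflexive (≡.cong (embed F) (∏-one N))) (+-identityʳ 1#))
      where
      ∏-one : ∀ n → ∏ n (λ k → rowHooks k 0) ≡ 1
      ∏-one zero    = ≡.refl
      ∏-one (suc n) = ≡.trans (ℕ.*-identityʳ _) (∏-one n)
    weight-hooks (suc J) = trans (*-congˡ (weight-hooks J)) (hooks-grow J)

-- Transpositions as functions

module Transpositions {n : ℕ} where

  open import Data.Fin using (Fin)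
  open import Data.Fin.Properties using (_≟_)
  open import Data.Fin.Permutation.Components using (transpose)
  open import Relation.Nullary using (Dec; yes; no)
  open import Relation.Nullary.Decidable using (dec-true; dec-false)
  open ≡ using (refl; sym; trans; cong)

  transpose-first : ∀ (x y : Fin n) → transpose x y x ≡ y
  transpose-first x y rewrite dec-true (x ≟ x) refl = refl

  transpose-second : ∀ (x y : Fin n) → transpose x y y ≡ x
  transpose-second x y with y ≟ x
  ... | yes y≡x = y≡x
  ... | no _ rewrite dec-true (y ≟ y) refl = refl

  transpose-other : ∀ {x y k : Fin n} → k ≢ x → k ≢ y → transpose x y k ≡ k
  transpose-other {x} {y} {k} k≢x k≢y rewrite dec-false (k ≟ x) k≢x | dec-false (k ≟ y) k≢y = refl

  transpose-conjugate : ∀ (π : Fin n → Fin n) → (∀ {i j} → π i ≡ π j → i ≡ j) →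
    ∀ x y k → π (transpose x y k) ≡ transpose (π x) (π y) (π k)
  transpose-conjugate π inj x y k = go (k ≟ x) (k ≟ y)
    where
    go : Dec (k ≡ x) → Dec (k ≡ y) → π (transpose x y k) ≡ transpose (π x) (π y) (π k)
    go (yes refl) _          = trans (cong π (transpose-first x y)) (sym (transpose-first (π x) (π y)))
    go (no _)     (yes refl) = trans (cong π (transpose-second x y)) (sym (transpose-second (π x) (π y)))
    go (no k≢x)   (no k≢y)   = trans (cong π (transpose-other k≢x k≢y))
      (sym (transpose-other (λ eq → k≢x (inj eq)) (λ eq → k≢y (inj eq))))

  transpose-sym : ∀ (x y k : Fin n) → transpose x y k ≡ transpose y x k
  transpose-sym x y k = go (k ≟ x) (k ≟ y)
    where
    go : Dec (k ≡ x) → Dec (k ≡ y) → transpose x y k ≡ transpose y x k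
    go (yes refl) _          = trans (transpose-first x y) (sym (transpose-second y x))
    go (no _)     (yes refl) = trans (transpose-second x y) (sym (transpose-first y x))
    go (no k≢x)   (no k≢y)   = trans (transpose-other k≢x k≢y) (sym (transpose-other k≢y k≢x))

-- Parity of the number of inversions

module InversionParity where

  open CellCounts using (indicator; count; count-∷)
  open Transpositions using (transpose-first; transpose-second; transpose-other)
  open import Data.Fin as Fin using (Fin; zero; suc)
  open import Data.Fin.Properties using (<-cmp; <-irrefl; _≟_)
  open import Data.Fin.Permutation using (Permutation; _⟨$⟩ʳ_; transpose)
  import Data.Fin.Permutation.Components as PC
  open import Data.List using (List; []; _∷_; map; length; filter; cartesianProduct; tabulate)
  open import Data.List.Properties using (filter-++; length-++)
  open import Data.Nat using (zero; suc; _+_; _*_; _%_)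
  open import Data.Nat.Properties as ℕ using (+-0-commutativeMonoid)
  open import Data.Nat.DivMod using ([m+kn]%n≡m%n)
  open import Data.Nat.Solver using (module +-*-Solver)
  open import Data.Empty using (⊥-elim)
  open import Data.Product using (_×_; _,_)
  open import Data.Sum using (_⊎_; inj₁; inj₂)
  open import Function.Bundles using (Injection)
  open import Function.Properties.Inverse using (↔⇒↣)
  open import Relation.Binary.Definitions using (tri<; tri≈; tri>)
  open import Relation.Nullary using (Dec; yes; no; ¬_)
  open import Relation.Unary using (Decidable)
  open import Algebra.Properties.CommutativeMonoid.Sum +-0-commutativeMonoid using (sum; sum-cong-≗; sum-replicate-zero; ∑-distrib-+; ∑-comm; sum-permute)
  open import Algebra.Properties.Semiring.Sum ℕ.+-*-semiring using (*-distribˡ-sum; *-distribʳ-sum)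
  open ≡ using (refl; sym; trans; cong; cong₂)

  count-map : ∀ {A B : Set} {P : B → Set} (P? : Decidable P) (g : A → B) L → count P? (map g L) ≡ count (λ x → P? (g x)) L
  count-map P? g []      = refl
  count-map P? g (x ∷ L) = trans (count-∷ P? (g x) (map g L))
    (trans (cong (indicator (P? (g x)) +_) (count-map P? g L)) (sym (count-∷ (λ x → P? (g x)) x L)))

  count-tabulate : ∀ {A : Set} {P : A → Set} (P? : Decidable P) {n} (g : Fin n → A) → count P? (tabulate g) ≡ sum (λ i → indicator (P? (g i)))
  count-tabulate P? {zero}  g = refl
  count-tabulate P? {suc n} g = trans (count-∷ P? (g zero) (tabulate (λ i → g (suc i))))
    (cong (indicator (P? (g zero)) +_) (count-tabulate P? (λ i → g (suc i))))

  count-product : ∀ {A B : Set} {P : A × B → Set} (P? : Decidable P) {n} (g : Fin n → A) L →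
    count P? (cartesianProduct (tabulate g) L) ≡ sum (λ i → count (λ y → P? (g i , y)) L)
  count-product P? {zero}  g L = refl
  count-product P? {suc n} g L = trans
    (trans (cong length (filter-++ P? (map (g zero ,_) L) _)) (length-++ (filter P? (map (g zero ,_) L))))
    (cong₂ _+_ (count-map P? (g zero ,_) L) (count-product P? (λ i → g (suc i)) L))

  sum-indicator : ∀ {n} (x : Fin n) → sum (λ b → indicator (b ≟ x)) ≡ 1
  sum-indicator {suc n} zero = cong suc (sum-replicate-zero n)
  sum-indicator (suc x) = trans (sum-cong-≗ λ b → shift b (b ≟ x)) (sum-indicator x)
    where
    shift : ∀ b → Dec (b ≡ x) → indicator (suc b ≟ suc x) ≡ indicator (b ≟ x)
    shift b _ with b ≟ x
    ... | yes _ = refl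
    ... | no _  = refl

  module _ {n : ℕ} where

    lt : Fin n → Fin n → ℕ
    lt i j = indicator (i Fin.<? j)

    lt-yes : ∀ {i j} → i Fin.< j → lt i j ≡ 1
    lt-yes {i} {j} i<j with i Fin.<? j
    ... | yes _ = refl
    ... | no ¬p = ⊥-elim (¬p i<j)

    lt-no : ∀ {i j} → ¬ i Fin.< j → lt i j ≡ 0
    lt-no {i} {j} i≮j with i Fin.<? j
    ... | yes p = ⊥-elim (i≮j p)
    ... | no _  = refl

    lt-refl : ∀ i → lt i i ≡ 0
    lt-refl i = lt-no (<-irrefl refl)

    Complementary : ℕ → ℕ → Set
    Complementary p q = (p ≡ 1 × q ≡ 0) ⊎ (p ≡ 0 × q ≡ 1)

    lt-cases : ∀ {i j} → i ≢ j → Complementary (lt i j) (lt j i)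
    lt-cases {i} {j} i≢j with <-cmp i j
    ... | tri< i<j _ j≮i = inj₁ (lt-yes i<j , lt-no j≮i)
    ... | tri≈ _ eq _    = ⊥-elim (i≢j eq)
    ... | tri> i≮j _ j<i = inj₂ (lt-no i≮j , lt-yes j<i)

    ∑∑ : (Fin n → Fin n → ℕ) → ℕ
    ∑∑ m = sum (λ i → sum (λ j → m i j))

    ∑∑-cong : ∀ {m m′} → (∀ i j → m i j ≡ m′ i j) → ∑∑ m ≡ ∑∑ m′
    ∑∑-cong eq = sum-cong-≗ λ i → sum-cong-≗ (eq i)

    ∑∑-+ : ∀ m m′ → ∑∑ (λ i j → m i j + m′ i j) ≡ ∑∑ m + ∑∑ m′
    ∑∑-+ m m′ = trans (sum-cong-≗ λ i → ∑-distrib-+ (m i) (m′ i)) (∑-distrib-+ (λ i → sum (m i)) (λ i → sum (m′ i)))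

    ∑∑-zero : ∀ {m} → (∀ i j → m i j ≡ 0) → ∑∑ m ≡ 0
    ∑∑-zero {m} eq = trans (sum-cong-≗ {n} {λ i → sum (m i)} {λ _ → 0}
      λ i → trans (sum-cong-≗ {n} {m i} {λ _ → 0} (eq i)) (sum-replicate-zero n)) (sum-replicate-zero n)

    ∑∑-symmetric : ∀ m → (∀ i j → m i j ≡ m j i) → (∀ i → m i i ≡ 0) → ∑∑ m ≡ ∑∑ (λ i j → lt i j * m i j) + ∑∑ (λ i j → lt i j * m i j)
    ∑∑-symmetric m m-sym m-diag = trans (∑∑-cong split) (trans (∑∑-+ (λ i j → lt i j * m i j) (λ i j → lt j i * m i j))
      (cong (∑∑ (λ i j → lt i j * m i j) +_) (trans (∑-comm (λ i j → lt j i * m i j)) (∑∑-cong λ i j → cong (lt i j *_) (m-sym j i)))))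
      where
      split : ∀ i j → m i j ≡ lt i j * m i j + lt j i * m i j
      split i j with i ≟ j
      ... | yes refl rewrite m-diag i | ℕ.*-zeroʳ (lt i i) = refl
      ... | no i≢j with lt i j | lt j i | lt-cases i≢j
      ...   | _ | _ | inj₁ (refl , refl) = sym (trans (ℕ.+-identityʳ _) (ℕ.+-identityʳ _))
      ...   | _ | _ | inj₂ (refl , refl) = sym (ℕ.+-identityʳ _)

    -- The indicator that f reverses the order of i and j. Unlike that of an inversion it is
    -- symmetric in i and j, so its sum over all pairs can be reindexed by a permutation.
    reorders : (Fin n → Fin n) → Fin n → Fin n → ℕ
    reorders f i j = lt i j * lt (f j) (f i) + lt j i * lt (f i) (f j)

    reorders-sym : ∀ f i j → reorders f i j ≡ reorders f j i
    reorders-sym f i j = ℕ.+-comm (lt i j * lt (f j) (f i)) _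

    reorders-diag : ∀ f i → reorders f i i ≡ 0
    reorders-diag f i rewrite lt-refl i = refl

    inversionSum : (Fin n → Fin n) → ℕ
    inversionSum f = ∑∑ λ i j → lt i j * lt (f j) (f i)

    ∑∑-reorders : ∀ f → ∑∑ (reorders f) ≡ inversionSum f + inversionSum f
    ∑∑-reorders f = trans (∑∑-symmetric (reorders f) (reorders-sym f) (reorders-diag f)) (cong₂ _+_ half half)
      where
      entry : ∀ i j → lt i j * reorders f i j ≡ lt i j * lt (f j) (f i)
      entry i j with i ≟ j
      ... | yes refl rewrite lt-refl i = refl
      ... | no i≢j with lt i j | lt j i | lt-cases i≢j
      ...   | _ | _ | inj₁ (refl , refl) = trans (ℕ.+-identityʳ _) (ℕ.+-identityʳ _)
      ...   | _ | _ | inj₂ (refl , refl) = refl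
      half : ∑∑ (λ i j → lt i j * reorders f i j) ≡ inversionSum f
      half = ∑∑-cong entry

    module _ (σ : Permutation n n) (τ : Permutation n n) where

      private
        s t : Fin n → Fin n
        s = σ ⟨$⟩ʳ_
        t = τ ⟨$⟩ʳ_

        injective : ∀ (π : Permutation n n) {i j} → i ≢ j → π ⟨$⟩ʳ i ≢ π ⟨$⟩ʳ j
        injective π i≢j eq = i≢j (Injection.injective (↔⇒↣ π) eq)

      -- Exclusive or, in the form p xor r + 2 (p xor q) (q xor r) = p xor q + q xor r.
      reorders-∘ : ∀ i j → reorders (λ k → t (s k)) i j + (reorders s i j * reorders t (s i) (s j) + reorders s i j * reorders t (s i) (s j))
        ≡ reorders s i j + reorders t (s i) (s j)
      reorders-∘ i j with i ≟ j
      ... | yes refl rewrite lt-refl i | lt-refl (s i) = refl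
      ... | no i≢j with lt i j | lt j i | lt-cases i≢j | lt (s i) (s j) | lt (s j) (s i) | lt-cases (injective σ i≢j)
                      | lt (t (s i)) (t (s j)) | lt (t (s j)) (t (s i)) | lt-cases (injective τ (injective σ i≢j))
      ... | _ | _ | inj₁ (refl , refl) | _ | _ | inj₁ (refl , refl) | _ | _ | inj₁ (refl , refl) = refl
      ... | _ | _ | inj₁ (refl , refl) | _ | _ | inj₁ (refl , refl) | _ | _ | inj₂ (refl , refl) = refl
      ... | _ | _ | inj₁ (refl , refl) | _ | _ | inj₂ (refl , refl) | _ | _ | inj₁ (refl , refl) = refl
      ... | _ | _ | inj₁ (refl , refl) | _ | _ | inj₂ (refl , refl) | _ | _ | inj₂ (refl , refl) = refl
      ... | _ | _ | inj₂ (refl , refl) | _ | _ | inj₁ (refl , refl) | _ | _ | inj₁ (refl , refl) = refl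
      ... | _ | _ | inj₂ (refl , refl) | _ | _ | inj₁ (refl , refl) | _ | _ | inj₂ (refl , refl) = refl
      ... | _ | _ | inj₂ (refl , refl) | _ | _ | inj₂ (refl , refl) | _ | _ | inj₁ (refl , refl) = refl
      ... | _ | _ | inj₂ (refl , refl) | _ | _ | inj₂ (refl , refl) | _ | _ | inj₂ (refl , refl) = refl

      inversionSum-∘ : ∑∑ (reorders (λ k → t (s k))) + (∑∑ (λ i j → reorders s i j * reorders t (s i) (s j)) + ∑∑ (λ i j → reorders s i j * reorders t (s i) (s j)))
        ≡ ∑∑ (reorders s) + ∑∑ (reorders t)
      inversionSum-∘ = trans (sym (trans (∑∑-+ (reorders (λ k → t (s k))) (λ i j → m i j + m i j)) (cong (∑∑ (reorders (λ k → t (s k))) +_) (∑∑-+ m m))))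
        (trans (∑∑-cong reorders-∘) (trans (∑∑-+ (reorders s) (λ i j → reorders t (s i) (s j))) (cong (∑∑ (reorders s) +_) (sym permuted))))
        where
        m : Fin n → Fin n → ℕ
        m i j = reorders s i j * reorders t (s i) (s j)
        permuted : ∑∑ (reorders t) ≡ ∑∑ (λ i j → reorders t (s i) (s j))
        permuted = trans (sum-permute (λ i → sum (reorders t i)) σ) (sum-cong-≗ λ i → sum-permute (reorders t (s i)) σ)

    module _ {x y : Fin n} (x≢y : x ≢ y) where

      swap : Fin n → Fin n
      swap = PC.transpose x y

      swap-x : swap x ≡ y
      swap-x = transpose-first x y

      swap-y : swap y ≡ x
      swap-y = transpose-second x y

      open +-*-Solver

      private
        g : Fin n → Fin n → ℕ
        g = reorders swap

        -- β marks the elements strictly between x and y. The decisions are passed as arguments so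
        -- that `g-cases` can match on them.
        β′ : ∀ a → Dec (a ≡ x) → Dec (a ≡ y) → ℕ
        β′ a (yes _) _       = 0
        β′ a (no _)  (yes _) = 0
        β′ a (no _)  (no _)  = g x a

        β : Fin n → ℕ
        β a = β′ a (a ≟ x) (a ≟ y)

        δx δy : Fin n → ℕ
        δx a = indicator (a ≟ x)
        δy a = indicator (a ≟ y)

        g-xy : g x y ≡ 1
        g-xy rewrite swap-x | swap-y with lt x y | lt y x | lt-cases x≢y
        ... | _ | _ | inj₁ (refl , refl) = refl
        ... | _ | _ | inj₂ (refl , refl) = refl

        g-y : ∀ {b} → b ≢ x → b ≢ y → g y b ≡ g x b
        g-y {b} b≢x b≢y rewrite swap-x | swap-y | transpose-other b≢x b≢y = 
          trans (cong₂ _+_ (ℕ.*-comm (lt y b) (lt b x)) (ℕ.*-comm (lt b y) (lt x b))) (ℕ.+-comm (lt b x * lt y b) (lt x b * lt b y))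

        g-others : ∀ {a b} → a ≢ x → a ≢ y → b ≢ x → b ≢ y → g a b ≡ 0
        g-others {a} {b} a≢x a≢y b≢x b≢y rewrite transpose-other a≢x a≢y | transpose-other b≢x b≢y with a ≟ b
        ... | yes refl rewrite lt-refl a = refl
        ... | no a≢b with lt a b | lt b a | lt-cases a≢b
        ...   | _ | _ | inj₁ (refl , refl) = refl
        ...   | _ | _ | inj₂ (refl , refl) = refl

        g-cases : ∀ a b (p : Dec (a ≡ x)) (p′ : Dec (a ≡ y)) (q : Dec (b ≡ x)) (q′ : Dec (b ≡ y)) →
          g a b ≡ β′ a p p′ * (indicator q + indicator q′) + β′ b q q′ * (indicator p + indicator p′)
                    + (indicator p * indicator q′ + indicator p′ * indicator q)
        g-cases a b (yes refl) (yes eq) _ _ = ⊥-elim (x≢y eq)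
        g-cases a b _ _ (yes refl) (yes eq) = ⊥-elim (x≢y eq)
        g-cases a b (yes refl) (no _) (yes refl) (no _) = reorders-diag swap x
        g-cases a b (yes refl) (no _) (no _) (yes refl) = g-xy
        g-cases a b (yes refl) (no _) (no _) (no _) = solve 1 (λ k → k := k :* con 1 :+ con 0) refl (g x b)
        g-cases a b (no _) (yes refl) (yes refl) (no _) = trans (reorders-sym swap y x) g-xy
        g-cases a b (no _) (yes refl) (no _) (yes refl) = reorders-diag swap y
        g-cases a b (no _) (yes refl) (no b≢x) (no b≢y) = trans (g-y b≢x b≢y) (solve 1 (λ k → k := k :* con 1 :+ con 0) refl (g x b))
        g-cases a b (no _) (no _) (yes refl) (no _) = trans (reorders-sym swap a x) (solve 1 (λ k → k := k :* con 1 :+ con 0 :+ con 0) refl (g x a))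
        g-cases a b (no a≢x) (no a≢y) (no _) (yes refl) = trans (reorders-sym swap a y) (trans (g-y a≢x a≢y) (solve 1 (λ k → k := k :* con 1 :+ con 0 :+ con 0) refl (g x a)))
        g-cases a b (no a≢x) (no a≢y) (no b≢x) (no b≢y) = trans (g-others a≢x a≢y b≢x b≢y)
            (solve 2 (λ k l → con 0 := k :* con 0 :+ l :* con 0 :+ con 0) refl (g x a) (g x b))

        g-formula : ∀ a b → g a b ≡ β a * (δx b + δy b) + β b * (δx a + δy a) + (δx a * δy b + δy a * δx b)
        g-formula a b = g-cases a b (a ≟ x) (a ≟ y) (b ≟ x) (b ≟ y)

        δ-sum : sum (λ b → δx b + δy b) ≡ 2
        δ-sum = trans (∑-distrib-+ δx δy) (cong₂ _+_ (sum-indicator x) (sum-indicator y))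

        ∑∑-product : ∀ (p q : Fin n → ℕ) → ∑∑ (λ a b → p a * q b) ≡ sum p * sum q
        ∑∑-product p q = trans (sum-cong-≗ λ a → sym (*-distribˡ-sum (p a) q)) (sym (*-distribʳ-sum (sum q) p))

      -- The swap reverses the pair x, y and, for each a between them, the pairs a, x and a, y;
      -- every pair is counted in both orders.
      ∑∑-swap : ∑∑ (reorders swap) ≡ 2 + 4 * sum β
      ∑∑-swap = begin
        ∑∑ g ≡⟨ ∑∑-cong g-formula ⟩
        ∑∑ (λ a b → p₁ a b + p₂ a b + (p₃ a b + p₄ a b)) ≡⟨ ∑∑-+ (λ a b → p₁ a b + p₂ a b) (λ a b → p₃ a b + p₄ a b) ⟩
        ∑∑ (λ a b → p₁ a b + p₂ a b) + ∑∑ (λ a b → p₃ a b + p₄ a b) ≡⟨ cong₂ _+_ (∑∑-+ p₁ p₂) (∑∑-+ p₃ p₄) ⟩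
        ∑∑ p₁ + ∑∑ p₂ + (∑∑ p₃ + ∑∑ p₄)
          ≡⟨ cong₂ _+_ (cong₂ _+_ (trans (∑∑-product β (λ b → δx b + δy b)) (cong (sum β *_) δ-sum))
                                  (trans (∑-comm p₂) (trans (∑∑-product β (λ b → δx b + δy b)) (cong (sum β *_) δ-sum))))
                       (cong₂ _+_ (trans (∑∑-product δx δy) (cong₂ _*_ (sum-indicator x) (sum-indicator y)))
                                  (trans (∑∑-product δy δx) (cong₂ _*_ (sum-indicator y) (sum-indicator x)))) ⟩
        sum β * 2 + sum β * 2 + 2 ≡⟨ solve 1 (λ k → k :* con 2 :+ k :* con 2 :+ con 2 := con 2 :+ con 4 :* k) refl (sum β) ⟩
        2 + 4 * sum β ∎
        where
        open ≡.≡-Reasoning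
        p₁ p₂ p₃ p₄ : Fin n → Fin n → ℕ
        p₁ a b = β a * (δx b + δy b)
        p₂ a b = β b * (δx a + δy a)
        p₃ a b = δx a * δy b
        p₄ a b = δy a * δx b

      -- The sums over ordered pairs count everything twice, so the composition identity is halved
      -- first; reduction modulo 2 then removes the remaining even terms.
      inversionSum-swap : ∀ (σ : Permutation n n) →
        inversionSum (λ k → swap (σ ⟨$⟩ʳ k)) % 2 ≡ suc (inversionSum (σ ⟨$⟩ʳ_)) % 2
      inversionSum-swap σ = trans (sym ([m+kn]%n≡m%n I′ M 2)) (trans (cong (_% 2) halved) ([m+kn]%n≡m%n (suc I) (sum β) 2))
        where
        s = σ ⟨$⟩ʳ_
        I′ = inversionSum (λ k → swap (s k))
        I = inversionSum s
        m : Fin n → Fin n → ℕ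
        m i j = reorders s i j * reorders swap (s i) (s j)
        M = ∑∑ λ i j → lt i j * m i j
        ∑∑-m : ∑∑ m ≡ M + M
        ∑∑-m = ∑∑-symmetric m (λ i j → cong₂ _*_ (reorders-sym s i j) (reorders-sym swap (s i) (s j))) (λ i → cong (_* reorders swap (s i) (s i)) (reorders-diag s i))
        doubled : (I′ + I′) + ((M + M) + (M + M)) ≡ (I + I) + (2 + 4 * sum β)
        doubled = trans (cong₂ _+_ (sym (∑∑-reorders (λ k → swap (s k)))) (cong₂ _+_ (sym ∑∑-m) (sym ∑∑-m)))
          (trans (inversionSum-∘ σ (transpose x y)) (cong₂ _+_ (∑∑-reorders s) ∑∑-swap))
        halved : I′ + M * 2 ≡ suc I + sum β * 2
        halved = ℕ.*-cancelˡ-≡ _ _ 2 (trans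
          (solve 2 (λ i m → con 2 :* (i :+ m :* con 2) := (i :+ i) :+ ((m :+ m) :+ (m :+ m))) refl I′ M)
          (trans doubled (solve 2 (λ i b → (i :+ i) :+ (con 2 :+ con 4 :* b) := con 2 :* (con 1 :+ i :+ b :* con 2)) refl I (sum β))))

-- Signs of permutations

module Signs {c ℓ} (F : Field c ℓ) (charZero : CharZero F) (n : ℕ) where

  open import Defs using (module GroupAlgebra)
  open CellCounts using (indicator)
  open InversionParity
  open Field F using (_≈_; 1#; -_; refl; sym; ring)
  open GroupAlgebra F charZero n
  open import Algebra.Properties.Ring ring using (-‿involutive)
  open import Data.Fin as Fin using (Fin)
  open import Data.Fin.Permutation using (_⟨$⟩ʳ_; transpose) renaming (id to idₚ)
  open import Data.List using (allFin)
  open import Data.Nat using (suc; _*_; _%_; s≤s)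
  open import Data.Nat.DivMod using (%-distribˡ-+; m%n<n)
  open import Data.Product using (_,_)
  open import Function using (id)
  open import Relation.Nullary using (yes; no)
  open import Relation.Nullary.Decidable using (_×-dec_)
  open import Data.Sum using (inj₁; inj₂)
  open import Data.Nat.Properties using (+-0-commutativeMonoid)
  open import Algebra.Properties.CommutativeMonoid.Sum +-0-commutativeMonoid using (sum-cong-≗)

  inversions≡inversionSum : ∀ σ → inversions σ ≡ inversionSum (σ ⟨$⟩ʳ_)
  inversions≡inversionSum σ = ≡.trans (count-product _ {n} id (allFin n))
    (sum-cong-≗ {n} λ i → ≡.trans (count-tabulate _ {n} id) (sum-cong-≗ {n} λ j → entry i j))
    where
    entry : ∀ i j → indicator ((i Fin.<? j) ×-dec (σ ⟨$⟩ʳ j Fin.<? σ ⟨$⟩ʳ i)) ≡ lt i j * lt (σ ⟨$⟩ʳ j) (σ ⟨$⟩ʳ i)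
    entry i j with i Fin.<? j | σ ⟨$⟩ʳ j Fin.<? σ ⟨$⟩ʳ i
    ... | yes _ | yes _ = ≡.refl
    ... | yes _ | no _  = ≡.refl
    ... | no _  | yes _ = ≡.refl
    ... | no _  | no _  = ≡.refl

  sgn-transpose : ∀ {x y} → x ≢ y → ∀ τ → sgn (transpose x y · τ) ≈ - sgn τ
  sgn-transpose {x} {y} x≢y τ
    with inversions (transpose x y · τ) % 2 | inversions τ % 2 | parity | m%n<n (inversions τ) 2
    where
    parity : inversions (transpose x y · τ) % 2 ≡ suc (inversions τ % 2) % 2
    parity = ≡.trans (≡.cong (_% 2) (inversions≡inversionSum (transpose x y · τ)))
      (≡.trans (inversionSum-swap x≢y τ) (≡.trans (≡.cong (λ m → suc m % 2) (≡.sym (inversions≡inversionSum τ)))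
        (%-distribˡ-+ 1 (inversions τ) 2)))
  ... | _ | 0 | ≡.refl | _ = refl
  ... | _ | 1 | ≡.refl | _ = sym (-‿involutive 1#)
  ... | _ | suc (suc _) | _ | s≤s (s≤s ())

  sgn-id : sgn idₚ ≈ 1#
  sgn-id with inversions idₚ % 2 | even
    where
    even : inversions idₚ % 2 ≡ 0
    even = ≡.cong (_% 2) (≡.trans (inversions≡inversionSum idₚ) (∑∑-zero {n} none))
      where
      none : ∀ i j → lt i j * lt j i ≡ 0
      none i j with i Fin.≟ j
      ... | yes ≡.refl rewrite lt-refl i = ≡.refl
      ... | no i≢j with lt i j | lt j i | lt-cases i≢j
      ...   | _ | _ | inj₁ (≡.refl , ≡.refl) = ≡.refl
      ...   | _ | _ | inj₂ (≡.refl , ≡.refl) = ≡.refl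
  ... | _ | ≡.refl = refl

-- The group algebra as an algebra with transpositions

module GroupAlgebraRing {c ℓ} (F : Field c ℓ) (charZero : CharZero F) (n : ℕ) where

  open import Defs using (module GroupAlgebra)
  open Field F hiding (ring)
  open GroupAlgebra F charZero n
  open import Algebra.Bundles using (Ring)
  open import Data.Fin as Fin using (Fin)
  open import Data.Fin.Permutation using (_⟨$⟩ʳ_; _⟨$⟩ˡ_; transpose; flip; inverseˡ; inverseʳ) renaming (id to idₚ)
  import Data.Fin.Permutation.Components as PC
  open import Data.List using (List; []; _∷_; [_]; _++_)
  open import Data.List.Properties using (++-identityʳ; ++-assoc; concatMap-++)
  open import Data.Product using (_,_)
  open import Data.Empty using (⊥-elim)
  open import Relation.Nullary using (yes; no)
  open import Relation.Binary.Reasoning.Setoid setoid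
  import Algebra.Properties.Ring (Field.ring F) as KP
  open Transpositions

  infix 4 _≗ₚ_
  _≗ₚ_ : Perm → Perm → Set
  σ ≗ₚ τ = ∀ i → σ ⟨$⟩ʳ i ≡ τ ⟨$⟩ʳ i

  pick : Carrier → Perm → Perm → Carrier
  pick x τ σ with τ ≟ₚ σ
  ... | yes _ = x
  ... | no _  = 0#

  coeff-∷ : ∀ x τ f σ → coeff ((x , τ) ∷ f) σ ≈ pick x τ σ + coeff f σ
  coeff-∷ x τ f σ with τ ≟ₚ σ
  ... | yes _ = refl
  ... | no _  = sym (+-identityˡ _)

  pick-cong : ∀ {x y τ σ τ′ σ′} → x ≈ y → (τ ≗ₚ σ → τ′ ≗ₚ σ′) → (τ′ ≗ₚ σ′ → τ ≗ₚ σ) → pick x τ σ ≈ pick y τ′ σ′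
  pick-cong {τ = τ} {σ} {τ′} {σ′} x≈y to from with τ ≟ₚ σ | τ′ ≟ₚ σ′
  ... | yes _ | yes _ = x≈y
  ... | yes p | no ¬q = ⊥-elim (¬q (to p))
  ... | no ¬p | yes q = ⊥-elim (¬p (from q))
  ... | no _  | no _  = refl

  pick-*ˡ : ∀ x y τ σ → pick (x * y) τ σ ≈ x * pick y τ σ
  pick-*ˡ x y τ σ with τ ≟ₚ σ
  ... | yes _ = refl
  ... | no _  = sym (zeroʳ x)

  pick-*ʳ : ∀ x y τ σ → pick (x * y) τ σ ≈ pick x τ σ * y
  pick-*ʳ x y τ σ with τ ≟ₚ σ
  ... | yes _ = refl
  ... | no _  = sym (zeroˡ y)

  pick-+ : ∀ x y τ σ → pick (x + y) τ σ ≈ pick x τ σ + pick y τ σ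
  pick-+ x y τ σ with τ ≟ₚ σ
  ... | yes _ = refl
  ... | no _  = sym (+-identityˡ 0#)

  pick-0 : ∀ τ σ → pick 0# τ σ ≈ 0#
  pick-0 τ σ with τ ≟ₚ σ
  ... | yes _ = refl
  ... | no _  = refl

  coeff-resp : ∀ f {σ σ′} → σ ≗ₚ σ′ → coeff f σ ≈ coeff f σ′
  coeff-resp []            eq = refl
  coeff-resp ((x , τ) ∷ f) {σ} {σ′} eq = trans (coeff-∷ x τ f σ)
    (trans (+-cong (pick-cong refl (λ p i → ≡.trans (p i) (eq i)) (λ p i → ≡.trans (p i) (≡.sym (eq i)))) (coeff-resp f eq))
      (sym (coeff-∷ x τ f σ′)))

  coeff-++ : ∀ f g σ → coeff (f ++ g) σ ≈ coeff f σ + coeff g σ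
  coeff-++ []            g σ = sym (+-identityˡ _)
  coeff-++ ((x , τ) ∷ f) g σ = trans (coeff-∷ x τ (f ++ g) σ)
    (trans (+-congˡ (coeff-++ f g σ)) (trans (sym (+-assoc _ _ _)) (+-congʳ (sym (coeff-∷ x τ f σ)))))

  -- The product τ ρ is σ exactly when ρ is the inverse of τ followed on the right by σ.
  coeff-single : ∀ x τ g σ → coeff ([ (x , τ) ] ⊗ g) σ ≈ x * coeff g (flip τ · σ)
  coeff-single x τ []            σ = sym (zeroʳ x)
  coeff-single x τ ((y , ρ) ∷ g) σ = begin
    coeff ((x * y , τ · ρ) ∷ ([ (x , τ) ] ⊗ g)) σ            ≈⟨ coeff-∷ (x * y) (τ · ρ) ([ (x , τ) ] ⊗ g) σ ⟩
    pick (x * y) (τ · ρ) σ + coeff ([ (x , τ) ] ⊗ g) σ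
      ≈⟨ +-cong (pick-cong {τ = τ · ρ} {σ} {ρ} {flip τ · σ} refl
           (λ p i → ≡.trans (≡.sym (inverseˡ τ)) (≡.cong (τ ⟨$⟩ˡ_) (p i)))
           (λ p i → ≡.trans (≡.cong (τ ⟨$⟩ʳ_) (p i)) (inverseʳ τ))) (coeff-single x τ g σ) ⟩
    pick (x * y) ρ (flip τ · σ) + x * coeff g (flip τ · σ)   ≈⟨ +-congʳ (pick-*ˡ x y ρ (flip τ · σ)) ⟩
    x * pick y ρ (flip τ · σ) + x * coeff g (flip τ · σ)     ≈⟨ distribˡ _ _ _ ⟨
    x * (pick y ρ (flip τ · σ) + coeff g (flip τ · σ))       ≈⟨ *-congˡ (coeff-∷ y ρ g (flip τ · σ)) ⟨
    x * coeff ((y , ρ) ∷ g) (flip τ · σ)                     ∎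

  ∷-⊗ : ∀ x τ f g → ((x , τ) ∷ f) ⊗ g ≡ [ (x , τ) ] ⊗ g ⊕ f ⊗ g
  ∷-⊗ x τ f g = concatMap-++ _ [ (x , τ) ] f

  coeff-⊗-∷ : ∀ x τ f g σ → coeff (((x , τ) ∷ f) ⊗ g) σ ≈ x * coeff g (flip τ · σ) + coeff (f ⊗ g) σ
  coeff-⊗-∷ x τ f g σ = trans (reflexive (≡.cong (λ m → coeff m σ) (∷-⊗ x τ f g)))
    (trans (coeff-++ ([ (x , τ) ] ⊗ g) (f ⊗ g) σ) (+-congʳ (coeff-single x τ g σ)))

  coeff-⊗-[] : ∀ f σ → coeff (f ⊗ []) σ ≈ 0#
  coeff-⊗-[] []            σ = refl
  coeff-⊗-[] ((x , τ) ∷ f) σ = trans (coeff-⊗-∷ x τ f [] σ) (trans (+-cong (zeroʳ x) (coeff-⊗-[] f σ)) (+-identityˡ 0#))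

  -- The product recurses on its left factor. This expansion along the right factor shows that it
  -- depends only on the coefficients of the left one.
  coeff-∷-⊗ : ∀ f y τ g σ → coeff (f ⊗ ((y , τ) ∷ g)) σ ≈ coeff f (σ · flip τ) * y + coeff (f ⊗ g) σ
  coeff-∷-⊗ []            y τ g σ = sym (trans (+-identityʳ _) (zeroˡ y))
  coeff-∷-⊗ ((x , ρ) ∷ f) y τ g σ = begin
    coeff (((x , ρ) ∷ f) ⊗ ((y , τ) ∷ g)) σ
      ≈⟨ coeff-⊗-∷ x ρ f ((y , τ) ∷ g) σ ⟩
    x * coeff ((y , τ) ∷ g) (flip ρ · σ) + coeff (f ⊗ ((y , τ) ∷ g)) σ
      ≈⟨ +-cong (*-congˡ (coeff-∷ y τ g (flip ρ · σ))) (coeff-∷-⊗ f y τ g σ) ⟩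
    x * (pick y τ (flip ρ · σ) + coeff g (flip ρ · σ)) + (coeff f (σ · flip τ) * y + coeff (f ⊗ g) σ)
      ≈⟨ +-congʳ (trans (distribˡ _ _ _) (+-congʳ (trans (sym (pick-*ˡ x y τ (flip ρ · σ)))
           (trans (pick-cong {τ = τ} {flip ρ · σ} {ρ} {σ · flip τ} refl
             (λ p i → ≡.trans (≡.cong (ρ ⟨$⟩ʳ_) (≡.trans (≡.sym (inverseʳ τ)) (p (τ ⟨$⟩ˡ i)))) (inverseʳ ρ))
             (λ p i → ≡.trans (≡.sym (inverseˡ ρ)) (≡.cong (ρ ⟨$⟩ˡ_) (≡.trans (p (τ ⟨$⟩ʳ i)) (≡.cong (σ ⟨$⟩ʳ_) (inverseˡ τ))))))
             (pick-*ʳ x y ρ (σ · flip τ)))))) ⟩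
    pick x ρ (σ · flip τ) * y + x * coeff g (flip ρ · σ) + (coeff f (σ · flip τ) * y + coeff (f ⊗ g) σ)
      ≈⟨ interchange _ _ _ _ ⟩
    pick x ρ (σ · flip τ) * y + coeff f (σ · flip τ) * y + (x * coeff g (flip ρ · σ) + coeff (f ⊗ g) σ)
      ≈⟨ +-cong (trans (sym (distribʳ _ _ _)) (*-congʳ (sym (coeff-∷ x ρ f (σ · flip τ))))) (sym (coeff-⊗-∷ x ρ f g σ)) ⟩
    coeff ((x , ρ) ∷ f) (σ · flip τ) * y + coeff (((x , ρ) ∷ f) ⊗ g) σ ∎
    where open import Algebra.Properties.CommutativeSemigroup +-commutativeSemigroup using (interchange)

  coeff-⊙ : ∀ x f σ → coeff (x ⊙ f) σ ≈ x * coeff f σ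
  coeff-⊙ x []            σ = sym (zeroʳ x)
  coeff-⊙ x ((y , τ) ∷ f) σ = trans (coeff-∷ (x * y) τ (x ⊙ f) σ)
    (trans (+-cong (pick-*ˡ x y τ σ) (coeff-⊙ x f σ)) (trans (sym (distribˡ _ _ _)) (*-congˡ (sym (coeff-∷ y τ f σ)))))

  ⊗-congˡ : ∀ f {g g′} → g ≋ g′ → f ⊗ g ≋ f ⊗ g′
  ⊗-congˡ []            eq σ = refl
  ⊗-congˡ ((x , τ) ∷ f) {g} {g′} eq σ = trans (coeff-⊗-∷ x τ f g σ)
    (trans (+-cong (*-congˡ (eq (flip τ · σ))) (⊗-congˡ f {g} {g′} eq σ)) (sym (coeff-⊗-∷ x τ f g′ σ)))

  ⊗-congʳ : ∀ {f f′} g → f ≋ f′ → f ⊗ g ≋ f′ ⊗ g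
  ⊗-congʳ {f} {f′} []            eq σ = trans (coeff-⊗-[] f σ) (sym (coeff-⊗-[] f′ σ))
  ⊗-congʳ {f} {f′} ((y , τ) ∷ g) eq σ = trans (coeff-∷-⊗ f y τ g σ)
    (trans (+-cong (*-congʳ (eq (σ · flip τ))) (⊗-congʳ {f} {f′} g eq σ)) (sym (coeff-∷-⊗ f′ y τ g σ)))

  ⊗-distribˡ : ∀ f g h → f ⊗ (g ⊕ h) ≋ f ⊗ g ⊕ f ⊗ h
  ⊗-distribˡ []            g h σ = refl
  ⊗-distribˡ ((x , τ) ∷ f) g h σ = begin
    coeff (((x , τ) ∷ f) ⊗ (g ⊕ h)) σ
      ≈⟨ coeff-⊗-∷ x τ f (g ⊕ h) σ ⟩
    x * coeff (g ⊕ h) (flip τ · σ) + coeff (f ⊗ (g ⊕ h)) σ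
      ≈⟨ +-cong (trans (*-congˡ (coeff-++ g h (flip τ · σ))) (distribˡ _ _ _)) (trans (⊗-distribˡ f g h σ) (coeff-++ (f ⊗ g) (f ⊗ h) σ)) ⟩
    (x * coeff g (flip τ · σ) + x * coeff h (flip τ · σ)) + (coeff (f ⊗ g) σ + coeff (f ⊗ h) σ)
      ≈⟨ interchange _ _ _ _ ⟩
    (x * coeff g (flip τ · σ) + coeff (f ⊗ g) σ) + (x * coeff h (flip τ · σ) + coeff (f ⊗ h) σ)
      ≈⟨ +-cong (coeff-⊗-∷ x τ f g σ) (coeff-⊗-∷ x τ f h σ) ⟨
    coeff (((x , τ) ∷ f) ⊗ g) σ + coeff (((x , τ) ∷ f) ⊗ h) σ
      ≈⟨ coeff-++ (((x , τ) ∷ f) ⊗ g) (((x , τ) ∷ f) ⊗ h) σ ⟨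
    coeff (((x , τ) ∷ f) ⊗ g ⊕ ((x , τ) ∷ f) ⊗ h) σ ∎
    where open import Algebra.Properties.CommutativeSemigroup +-commutativeSemigroup using (interchange)

  ⊗-distribʳ : ∀ h f g → (f ⊕ g) ⊗ h ≋ f ⊗ h ⊕ g ⊗ h
  ⊗-distribʳ h []            g σ = refl
  ⊗-distribʳ h ((x , τ) ∷ f) g σ = begin
    coeff (((x , τ) ∷ (f ⊕ g)) ⊗ h) σ                              ≈⟨ coeff-⊗-∷ x τ (f ⊕ g) h σ ⟩
    x * coeff h (flip τ · σ) + coeff ((f ⊕ g) ⊗ h) σ               ≈⟨ +-congˡ (trans (⊗-distribʳ h f g σ) (coeff-++ (f ⊗ h) (g ⊗ h) σ)) ⟩
    x * coeff h (flip τ · σ) + (coeff (f ⊗ h) σ + coeff (g ⊗ h) σ) ≈⟨ +-assoc _ _ _ ⟨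
    x * coeff h (flip τ · σ) + coeff (f ⊗ h) σ + coeff (g ⊗ h) σ   ≈⟨ +-congʳ (coeff-⊗-∷ x τ f h σ) ⟨
    coeff (((x , τ) ∷ f) ⊗ h) σ + coeff (g ⊗ h) σ                  ≈⟨ coeff-++ (((x , τ) ∷ f) ⊗ h) (g ⊗ h) σ ⟨
    coeff (((x , τ) ∷ f) ⊗ h ⊕ g ⊗ h) σ                            ∎

  single-assoc : ∀ x τ g h σ → coeff (([ (x , τ) ] ⊗ g) ⊗ h) σ ≈ x * coeff (g ⊗ h) (flip τ · σ)
  single-assoc x τ []            h σ = sym (zeroʳ x)
  single-assoc x τ ((y , ρ) ∷ g) h σ = begin
    coeff (((x * y , τ · ρ) ∷ ([ (x , τ) ] ⊗ g)) ⊗ h) σ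
      ≈⟨ coeff-⊗-∷ (x * y) (τ · ρ) ([ (x , τ) ] ⊗ g) h σ ⟩
    x * y * coeff h (flip (τ · ρ) · σ) + coeff (([ (x , τ) ] ⊗ g) ⊗ h) σ
      ≈⟨ +-cong (*-assoc _ _ _) (single-assoc x τ g h σ) ⟩
    x * (y * coeff h (flip ρ · (flip τ · σ))) + x * coeff (g ⊗ h) (flip τ · σ)
      ≈⟨ distribˡ _ _ _ ⟨
    x * (y * coeff h (flip ρ · (flip τ · σ)) + coeff (g ⊗ h) (flip τ · σ))
      ≈⟨ *-congˡ (coeff-⊗-∷ y ρ g h (flip τ · σ)) ⟨
    x * coeff (((y , ρ) ∷ g) ⊗ h) (flip τ · σ) ∎

  ⊗-assoc : ∀ f g h → (f ⊗ g) ⊗ h ≋ f ⊗ (g ⊗ h)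
  ⊗-assoc []            g h σ = refl
  ⊗-assoc ((x , τ) ∷ f) g h σ = begin
    coeff ((((x , τ) ∷ f) ⊗ g) ⊗ h) σ
      ≡⟨ ≡.cong (λ m → coeff (m ⊗ h) σ) (∷-⊗ x τ f g) ⟩
    coeff (([ (x , τ) ] ⊗ g ⊕ f ⊗ g) ⊗ h) σ
      ≈⟨ trans (⊗-distribʳ h ([ (x , τ) ] ⊗ g) (f ⊗ g) σ) (coeff-++ (([ (x , τ) ] ⊗ g) ⊗ h) ((f ⊗ g) ⊗ h) σ) ⟩
    coeff (([ (x , τ) ] ⊗ g) ⊗ h) σ + coeff ((f ⊗ g) ⊗ h) σ
      ≈⟨ +-cong (single-assoc x τ g h σ) (⊗-assoc f g h σ) ⟩
    x * coeff (g ⊗ h) (flip τ · σ) + coeff (f ⊗ (g ⊗ h)) σ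
      ≈⟨ coeff-⊗-∷ x τ f (g ⊗ h) σ ⟨
    coeff (((x , τ) ∷ f) ⊗ (g ⊗ h)) σ ∎

  ⊗-identityˡ : ∀ f → 1ₐ ⊗ f ≋ f
  ⊗-identityˡ f σ = trans (coeff-single 1# idₚ f σ) (trans (*-identityˡ _) (coeff-resp f λ _ → ≡.refl))

  ⊗-identityʳ : ∀ f → f ⊗ 1ₐ ≋ f
  ⊗-identityʳ f σ = trans (coeff-∷-⊗ f 1# idₚ [] σ)
    (trans (+-cong (trans (*-identityʳ _) (coeff-resp f λ _ → ≡.refl)) (coeff-⊗-[] f σ)) (+-identityʳ _))

  KS-ring : Ring c ℓ
  KS-ring = record
    { Carrier = KS ; _≈_ = _≋_ ; _+_ = _⊕_ ; _*_ = _⊗_ ; -_ = (- 1#) ⊙_ ; 0# = [] ; 1# = 1ₐ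
    ; isRing = record
      { +-isAbelianGroup = record
        { isGroup = record
          { isMonoid = record
            { isSemigroup = record
              { isMagma = record
                { isEquivalence = record
                  { refl = λ σ → refl ; sym = λ p σ → sym (p σ) ; trans = λ p q σ → trans (p σ) (q σ) }
                ; ∙-cong = λ {f} {f′} {g} {g′} p q σ → trans (coeff-++ f g σ) (trans (+-cong (p σ) (q σ)) (sym (coeff-++ f′ g′ σ)))
                }
              ; assoc = λ f g h σ → reflexive (≡.cong (λ k → coeff k σ) (++-assoc f g h))
              }
            ; identity = (λ f σ → refl) , λ f σ → reflexive (≡.cong (λ k → coeff k σ) (++-identityʳ f))
            }
          ; inverse = (λ f σ → trans (coeff-++ ((- 1#) ⊙ f) f σ) (trans (+-congʳ (negated f σ)) (-‿inverseˡ _)))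
                    , (λ f σ → trans (coeff-++ f ((- 1#) ⊙ f) σ) (trans (+-congˡ (negated f σ)) (-‿inverseʳ _)))
          ; ⁻¹-cong = λ {f} {g} p σ → trans (coeff-⊙ (- 1#) f σ) (trans (*-congˡ (p σ)) (sym (coeff-⊙ (- 1#) g σ)))
          }
        ; comm = λ f g σ → trans (coeff-++ f g σ) (trans (+-comm _ _) (sym (coeff-++ g f σ)))
        }
      ; *-cong = λ {f} {f′} {g} {g′} p q σ → trans (⊗-congˡ f {g} {g′} q σ) (⊗-congʳ {f} {f′} g′ p σ)
      ; *-assoc = ⊗-assoc
      ; *-identity = ⊗-identityˡ , ⊗-identityʳ
      ; distrib = ⊗-distribˡ , ⊗-distribʳ
      }
    }
    where
    negated : ∀ f σ → coeff ((- 1#) ⊙ f) σ ≈ - coeff f σ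
    negated f σ = trans (coeff-⊙ (- 1#) f σ) (KP.-1*x≈-x _)

  single-cong : ∀ {x y σ τ} → x ≈ y → σ ≗ₚ τ → [ (x , σ) ] ≋ [ (y , τ) ]
  single-cong {x} {y} {σ} {τ} x≈y σ≗τ ρ = trans (coeff-∷ x σ [] ρ)
    (trans (+-congʳ (pick-cong x≈y (λ p i → ≡.trans (≡.sym (σ≗τ i)) (p i)) (λ p i → ≡.trans (σ≗τ i) (p i)))) (sym (coeff-∷ y τ [] ρ)))

  transposition-product : ∀ {x y z w x′ y′ z′ w′ : Fin n} →
    (∀ k → PC.transpose x y (PC.transpose z w k) ≡ PC.transpose x′ y′ (PC.transpose z′ w′ k)) →
    ⟦ transpose x y ⟧ ⊗ ⟦ transpose z w ⟧ ≋ ⟦ transpose x′ y′ ⟧ ⊗ ⟦ transpose z′ w′ ⟧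
  transposition-product eq = single-cong refl eq

  transpose-injective : ∀ (x y : Fin n) {i j} → PC.transpose x y i ≡ PC.transpose x y j → i ≡ j
  transpose-injective x y {i} {j} eq = ≡.trans (≡.sym (inverseˡ (transpose x y)))
    (≡.trans (≡.cong (PC.transpose y x) eq) (inverseˡ (transpose x y)))

  group-algebra : TranspositionAlgebra F (Fin n) c ℓ
  group-algebra = record
    { ring         = KS-ring
    ; ι            = λ r → [ (r , idₚ) ]
    ; ι-cong       = λ eq → single-cong eq λ _ → ≡.refl
    ; ι-+          = λ r s σ → trans (coeff-∷ (r + s) idₚ [] σ) (trans (+-congʳ (pick-+ r s idₚ σ))
                       (trans (+-assoc _ _ _) (trans (+-congˡ (sym (coeff-∷ s idₚ [] σ))) (sym (coeff-∷ r idₚ [ (s , idₚ) ] σ)))))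
    ; ι-*          = λ r s → single-cong refl λ _ → ≡.refl
    ; ι-0          = λ σ → trans (coeff-∷ 0# idₚ [] σ) (trans (+-identityʳ _) (pick-0 idₚ σ))
    ; ι-1          = λ σ → refl
    ; ι-central    = λ r f σ → trans (coeff-single r idₚ f σ) (sym (trans (coeff-∷-⊗ f r idₚ [] σ)
                       (trans (+-cong (trans (*-comm _ _) (*-congˡ (coeff-resp f λ _ → ≡.refl))) (coeff-⊗-[] f σ)) (+-identityʳ _))))
    ; t            = λ x y → ⟦ transpose x y ⟧
    ; t-sym        = λ x y → single-cong refl (transpose-sym x y)
    ; t-involutive = λ x y → single-cong (*-identityˡ 1#) (λ k → ≡.trans (≡.cong (PC.transpose x y) (transpose-sym x y k)) (PC.transpose-inverse x y))
    ; t-braid      = λ {x} {y} {z} x≢y x≢z y≢z → transposition-product λ k →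
                       ≡.trans (transpose-conjugate (PC.transpose x y) (transpose-injective x y) y z k)
                         (≡.cong₂ (λ p q → PC.transpose p q (PC.transpose x y k)) (transpose-second x y) (transpose-other (≢-sym x≢z) (≢-sym y≢z)))
    ; t-comm       = λ {x} {y} {z} {w} x≢z x≢w y≢z y≢w → transposition-product λ k →
                       ≡.trans (transpose-conjugate (PC.transpose x y) (transpose-injective x y) z w k)
                         (≡.cong₂ (λ p q → PC.transpose p q (PC.transpose x y k)) (transpose-other (≢-sym x≢z) (≢-sym y≢z)) (transpose-other (≢-sym x≢w) (≢-sym y≢w)))
    }

  ⊙-scalar : ∀ s f → s ⊙ f ≋ [ (s , idₚ) ] ⊗ f
  ⊙-scalar s f σ = trans (coeff-⊙ s f σ) (sym (trans (coeff-single s idₚ f σ) (*-congˡ (coeff-resp f λ _ → ≡.refl))))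

  ⊕-cong : ∀ f f′ g g′ → f ≋ f′ → g ≋ g′ → f ⊕ g ≋ f′ ⊕ g′
  ⊕-cong f f′ g g′ p q σ = trans (coeff-++ f g σ) (trans (+-cong (p σ) (q σ)) (sym (coeff-++ f′ g′ σ)))

-- Recursion for row and column sums

module SymmetrizerRecursion {c ℓ} (F : Field c ℓ) (charZero : CharZero F) (n : ℕ) where

  open import Defs using (module GroupAlgebra)
  open import Data.Nat using (zero; suc; _%_) renaming (_*_ to _*ⁿ_)
  open Field F using (Carrier; _≈_; 1#; -_; _*_; *-identityˡ; *-identityʳ; +-cong; refl; sym; trans)
  open GroupAlgebra F charZero n
  open GroupAlgebraRing F charZero n
  open import Algebra.Bundles using (Ring)
  open import Data.Fin as Fin using (Fin)
  open import Data.Fin.Permutation using (_⟨$⟩ʳ_; transpose) renaming (id to idₚ)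
  import Data.Fin.Permutation.Components as PC
  open import Data.List using (List; []; _∷_; [_]; _++_; map; concatMap)
  open import Data.List.Properties using (map-++)
  open import Data.Product using (_,_)
  open import Data.Empty using (⊥-elim)
  open import Relation.Nullary using (yes; no)
  open import Relation.Binary.Reasoning.Setoid (Ring.setoid KS-ring)
  import Algebra.Properties.Ring (Field.ring F) as KP

  open Signs F charZero n
  open Stars group-algebra using (⋆)
  open ListLemmas
  open import Data.List.Relation.Unary.Any using (here)

  -- One sum for both symmetrizers: φ is constantly 1 for `𝔞` and the sign for `𝔟`.
  weighted : (Perm → Carrier) → List Perm → KS
  weighted φ L = map (λ σ → (φ σ , σ)) L

  module _ (φ : Perm → Carrier) (ε : Carrier) where

    weighted-translate : ∀ {ρ δ} → (∀ τ → φ (ρ · τ) ≈ δ * φ τ) → ∀ L → weighted φ (map (ρ ·_) L) ≋ [ (δ , ρ) ] ⊗ weighted φ L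
    weighted-translate φρ [] σ = refl
    weighted-translate {ρ} {δ} φρ (τ ∷ L) σ = trans (coeff-∷ _ (ρ · τ) (weighted φ (map (ρ ·_) L)) σ)
      (trans (+-cong (pick-cong {τ = ρ · τ} {σ} {ρ · τ} {σ} (φρ τ) (λ p → p) (λ p → p)) (weighted-translate {ρ} φρ L σ))
        (sym (coeff-∷ _ (ρ · τ) ([ (δ , ρ) ] ⊗ weighted φ L) σ)))

    weighted-star : ∀ {x} X → (∀ {y} → x ≢ y → ∀ τ → φ (transpose x y · τ) ≈ ε * φ τ) → x # X → ∀ L →
      weighted φ (concatMap (λ y → map (transpose x y ·_) L) X) ≋ ([ (ε , idₚ) ] ⊗ ⋆ x X) ⊗ weighted φ L
    weighted-star []    φt x# L σ = refl
    weighted-star {x} (y ∷ X) φt x# L = begin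
      weighted φ (map (transpose x y ·_) L ++ rest)
        ≡⟨ map-++ _ (map (transpose x y ·_) L) rest ⟩
      weighted φ (map (transpose x y ·_) L) ⊕ weighted φ rest
        ≈⟨ ⊕-cong (weighted φ (map (transpose x y ·_) L)) ([ (ε , transpose x y) ] ⊗ G) (weighted φ rest) (e⋆ ⊗ G)
             (weighted-translate {transpose x y} (φt (x# (here ≡.refl))) L) (weighted-star X φt (#-tail x#) L) ⟩
      [ (ε , transpose x y) ] ⊗ G ⊕ e⋆ ⊗ G
        ≈⟨ ⊗-distribʳ G [ (ε , transpose x y) ] e⋆ ⟨
      ([ (ε , transpose x y) ] ⊕ e⋆) ⊗ G
        ≈⟨ ⊗-congʳ {[ (ε , transpose x y) ] ⊕ e⋆} {[ (ε , idₚ) ] ⊗ (⟦ transpose x y ⟧ ⊕ ⋆ x X)} G (λ σ → trans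
             (⊕-cong [ (ε , transpose x y) ] ([ (ε , idₚ) ] ⊗ ⟦ transpose x y ⟧) e⋆ e⋆ (single-cong (sym (*-identityʳ ε)) λ _ → ≡.refl) (λ _ → refl) σ)
             (sym (⊗-distribˡ [ (ε , idₚ) ] ⟦ transpose x y ⟧ (⋆ x X) σ))) ⟩
      ([ (ε , idₚ) ] ⊗ (⟦ transpose x y ⟧ ⊕ ⋆ x X)) ⊗ G ∎
      where
      G = weighted φ L
      rest = concatMap (λ y → map (transpose x y ·_) L) X
      e⋆ = [ (ε , idₚ) ] ⊗ ⋆ x X

    -- Among the coset representatives (x , y) of `symGroupOn`, y = x gives the summand 1 and the
    -- others give the star, scaled by ε. This is the factor by which `Sym` grows.
    weighted-symGroup : ∀ {x X} → (∀ {σ τ} → σ ≗ₚ τ → φ σ ≈ φ τ) → (∀ {y} → x ≢ y → ∀ τ → φ (transpose x y · τ) ≈ ε * φ τ) → x # X →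
      weighted φ (symGroupOn (x ∷ X)) ≋ (1ₐ ⊕ [ (ε , idₚ) ] ⊗ ⋆ x X) ⊗ weighted φ (symGroupOn X)
    weighted-symGroup {x} {X} φ-cong φt x# = begin
      weighted φ (map (transpose x x ·_) L ++ rest)
        ≡⟨ map-++ _ (map (transpose x x ·_) L) rest ⟩
      weighted φ (map (transpose x x ·_) L) ⊕ weighted φ rest
        ≈⟨ ⊕-cong (weighted φ (map (transpose x x ·_) L)) (1ₐ ⊗ G) (weighted φ rest) (e⋆ ⊗ G)
             (λ σ → trans (weighted-translate {transpose x x} {1#} (λ τ → trans (φ-cong (λ i → fixed (τ ⟨$⟩ʳ i))) (sym (*-identityˡ _))) L σ)
               (⊗-congʳ {[ (1# , transpose x x) ]} {1ₐ} G (single-cong refl fixed) σ))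
             (weighted-star X φt x# L) ⟩
      1ₐ ⊗ G ⊕ e⋆ ⊗ G ≈⟨ ⊗-distribʳ G 1ₐ e⋆ ⟨
      (1ₐ ⊕ e⋆) ⊗ G ∎
      where
      L = symGroupOn X
      G = weighted φ L
      rest = concatMap (λ y → map (transpose x y ·_) L) X
      e⋆ = [ (ε , idₚ) ] ⊗ ⋆ x X
      fixed : ∀ k → PC.transpose x x k ≡ k
      fixed k with k Fin.≟ x
      ... | yes ≡.refl = ≡.refl
      ... | no k≢x with k Fin.≟ x
      ...   | yes k≡x = ⊥-elim (k≢x k≡x)
      ...   | no _    = ≡.refl

  -- Coefficients compare permutations as functions, so the sign has to be shown to depend on their
  -- values only.
  sgn-cong : ∀ {σ τ} → σ ≗ₚ τ → sgn σ ≈ sgn τ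
  sgn-cong {σ} {τ} eq with inversions σ % 2 | inversions τ % 2 | same
    where
    open InversionParity
    open import Data.Nat.Properties using (+-0-commutativeMonoid)
    same : inversions σ % 2 ≡ inversions τ % 2
    same = ≡.cong (_% 2) (≡.trans (inversions≡inversionSum σ)
      (≡.trans (∑∑-cong {n} λ i j → ≡.cong₂ (λ p q → lt i j *ⁿ lt p q) (eq j) (eq i)) (≡.sym (inversions≡inversionSum τ))))
  ... | zero | _ | ≡.refl = refl
  ... | suc _ | _ | ≡.refl = refl

  𝔞-∷ : ∀ {x X} → x # X → 𝔞 (x ∷ X) ≋ (1ₐ ⊕ [ (1# , idₚ) ] ⊗ ⋆ x X) ⊗ 𝔞 X
  𝔞-∷ = weighted-symGroup (λ _ → 1#) 1# (λ _ → refl) (λ _ _ → sym (*-identityˡ 1#))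

  𝔟-∷ : ∀ {x X} → x # X → 𝔟 (x ∷ X) ≋ (1ₐ ⊕ [ (- 1# , idₚ) ] ⊗ ⋆ x X) ⊗ 𝔟 X
  𝔟-∷ = weighted-symGroup sgn (- 1#) (λ {σ} {τ} → sgn-cong {σ} {τ}) (λ x≢y τ → trans (sgn-transpose x≢y τ) (sym (KP.-1*x≈-x (sgn τ))))

-- Column heights of a partition

module ColumnHeights where

  open import Defs using (part)
  open import Data.List using (List; []; _∷_; length)
  open import Data.List.Relation.Unary.Linked as Linked using (Linked; []; _∷_)
  open import Data.Nat using (zero; suc; _<?_; z≤n; s≤s; s≤s⁻¹)
  open import Data.Nat.Properties
  open import Data.Empty using (⊥-elim)
  open import Relation.Nullary using (yes; no)
  open ≡ using (refl; sym; trans; cong; subst)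

  -- The first row that is too short ends the count; for decreasing rows this is the conjugate
  -- partition.
  height : List ℕ → ℕ → ℕ
  height []       j = 0
  height (x ∷ xs) j with j <? x
  ... | yes _ = suc (height xs j)
  ... | no _  = 0

  Decreasing : List ℕ → Set
  Decreasing = Linked (λ x y → y ≤ x)

  height≤length : ∀ xs j → height xs j ≤ length xs
  height≤length []       j = z≤n
  height≤length (x ∷ xs) j with j <? x
  ... | yes _ = s≤s (height≤length xs j)
  ... | no _  = z≤n

  height-antitone : ∀ xs {i j} → i ≤ j → height xs j ≤ height xs i
  height-antitone []       i≤j = z≤n
  height-antitone (x ∷ xs) {i} {j} i≤j with j <? x | i <? x
  ... | yes _   | yes _  = s≤s (height-antitone xs i≤j)
  ... | yes j<x | no i≮x = ⊥-elim (i≮x (≤-<-trans i≤j j<x))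
  ... | no _    | _      = z≤n

  <height⇒<part : ∀ xs {i j} → i < height xs j → j < part xs i
  <height⇒<part (x ∷ xs) {i} {j} i<h with j <? x
  <height⇒<part (x ∷ xs) {zero}  i<h | yes j<x = j<x
  <height⇒<part (x ∷ xs) {suc i} i<h | yes _   = <height⇒<part xs (s≤s⁻¹ i<h)

  part-tail≤head : ∀ {x xs} → Decreasing (x ∷ xs) → ∀ i → part xs i ≤ x
  part-tail≤head {xs = []}     d         i       = z≤n
  part-tail≤head {xs = y ∷ ys} (y≤x ∷ d) zero    = y≤x
  part-tail≤head {xs = y ∷ ys} (y≤x ∷ d) (suc i) = ≤-trans (part-tail≤head d i) y≤x

  part-antitone : ∀ {xs} → Decreasing xs → ∀ {i j} → i ≤ j → part xs j ≤ part xs i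
  part-antitone {[]}     d {i}     {j}     i≤j = z≤n
  part-antitone {x ∷ xs} d {zero}  {zero}  i≤j = ≤-refl
  part-antitone {x ∷ xs} d {zero}  {suc j} i≤j = part-tail≤head d j
  part-antitone {x ∷ xs} d {suc i} {suc j} i≤j = part-antitone (Linked.tail d) (s≤s⁻¹ i≤j)

  <part⇒<height : ∀ {xs} → Decreasing xs → ∀ {i j} → j < part xs i → i < height xs j
  <part⇒<height {x ∷ xs} d {i} {j} j<p with j <? x
  <part⇒<height {x ∷ xs} d {zero}  j<p | yes _   = s≤s z≤n
  <part⇒<height {x ∷ xs} d {suc i} j<p | yes _   = s≤s (<part⇒<height (Linked.tail d) j<p)
  <part⇒<height {x ∷ xs} d {zero}  j<p | no j≮x  = ⊥-elim (j≮x j<p)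
  <part⇒<height {x ∷ xs} d {suc i} j<p | no j≮x  = ⊥-elim (j≮x (<-≤-trans j<p (part-tail≤head d i)))

  ≤-from-< : ∀ m {n} → (∀ i → i < m → i < n) → m ≤ n
  ≤-from-< zero    lt = z≤n
  ≤-from-< (suc m) lt = lt m ≤-refl

  height-unique : ∀ {xs} → Decreasing xs → ∀ {j m} → (∀ i → i < m → j < part xs i) → (∀ i → j < part xs i → i < m) → height xs j ≡ m
  height-unique {xs} d {j} {m} to from = ≤-antisym (≤-from-< (height xs j) λ i p → from i (<height⇒<part xs p))
    (≤-from-< m λ i p → <part⇒<height d (to i p))

  module AddedCell {lam mu} (d-lam : Decreasing lam) (d-mu : Decreasing mu) {u v}
    (lam-u : part lam u ≡ suc v) (mu-u : part mu u ≡ v) (others : ∀ i → i ≢ u → part lam i ≡ part mu i) where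

    height-mu : height mu v ≡ u
    height-mu = height-unique d-mu
      (λ i i<u → subst (v <_) (others i λ i≡u → <-irrefl i≡u i<u) (subst (_≤ part lam i) lam-u (part-antitone d-lam (<⇒≤ i<u))))
      (λ i v<p → ≰⇒> λ u≤i → <⇒≱ v<p (subst (part mu i ≤_) mu-u (part-antitone d-mu u≤i)))

    height-lam : height lam v ≡ suc u
    height-lam = height-unique d-lam
      (λ i i≤u → subst (_≤ part lam i) lam-u (part-antitone d-lam (s≤s⁻¹ i≤u)))
      (λ i v<p → ≰⇒> λ u<i → <⇒≱ (subst (v <_) (others i λ i≡u → <-irrefl (sym i≡u) u<i) v<p) (subst (part mu i ≤_) mu-u (part-antitone d-mu (<⇒≤ u<i))))

    height-other : ∀ {j} → j ≢ v → height lam j ≡ height mu j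
    height-other {j} j≢v = height-unique d-lam
      (λ i i<h → to i (<height⇒<part mu i<h)) (λ i j<p → <part⇒<height d-mu (from i j<p))
      where
      to : ∀ i → j < part mu i → j < part lam i
      to i j<p with i ≟ u
      ... | yes refl = subst (j <_) (sym lam-u) (m<n⇒m<1+n (subst (j <_) mu-u j<p))
      ... | no i≢u   = subst (j <_) (sym (others i i≢u)) j<p
      from : ∀ i → j < part lam i → j < part mu i
      from i j<p with i ≟ u
      ... | yes refl = subst (j <_) (sym mu-u) (≤∧≢⇒< (s≤s⁻¹ (subst (j <_) lam-u j<p)) j≢v)
      ... | no i≢u   = subst (j <_) (others i i≢u) j<p

-- Hook lengths in terms of column heights

module HookLengths where

  open import Defs using (part; hookLength; cells; α)
  open CellCounts
  open HookProducts
  open ColumnHeights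
  open import Data.List using (List; length; filter; drop; map; concatMap; upTo; applyUpTo)
  open import Data.List.Properties using (map-++; map-∘; map-upTo)
  open import Data.Nat using (zero; suc; _+_; _*_; _∸_; _<?_; z≤n)
  open import Data.Nat.ListAction using (product)
  open import Data.Nat.ListAction.Properties using (product-++)
  open import Data.Nat.Properties
  open import Data.Product using (_×_; _,_)
  open import Relation.Nullary using (yes; no)
  open ≡ using (refl; sym; trans; cong; cong₂; subst)

  product-applyUpTo : ∀ (g : ℕ → ℕ) n → product (applyUpTo g n) ≡ ∏ n g
  product-applyUpTo g zero    = refl
  product-applyUpTo g (suc n) = trans (cong (g 0 *_) (product-applyUpTo (λ i → g (suc i)) n)) (sym (∏-head n g))

  product-cells : ∀ (g : ℕ × ℕ → ℕ) mu → product (map g (cells mu)) ≡ ∏ (length mu) (λ x → ∏ (part mu x) (λ y → g (x , y)))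
  product-cells g mu = rows (length mu) (λ i → i)
    where
    row : ℕ → List (ℕ × ℕ)
    row x = map (λ y → (x , y)) (upTo (part mu x))
    row-product : ∀ x → product (map g (row x)) ≡ ∏ (part mu x) (λ y → g (x , y))
    row-product x = trans (cong product (trans (sym (map-∘ (upTo (part mu x)))) (map-upTo _ (part mu x)))) (product-applyUpTo (λ y → g (x , y)) (part mu x))
    rows : ∀ n (f : ℕ → ℕ) → product (map g (concatMap row (applyUpTo f n))) ≡ ∏ n (λ i → ∏ (part mu (f i)) (λ y → g (f i , y)))
    rows zero    f = refl
    rows (suc n) f = trans (cong product (map-++ g (row (f 0)) _)) (trans (product-++ (map g (row (f 0))) _)
      (trans (cong₂ _*_ (row-product (f 0)) (rows n (λ i → f (suc i)))) (sym (∏-head n _))))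

  module _ {mu : List ℕ} (d : Decreasing mu) where

    private
      h : ℕ → ℕ
      h = height mu

    rowCount-part : ∀ k J → part mu k ≤ J → rowCount h k J ≡ part mu k
    rowCount-part k zero    p≤J = sym (n≤0⇒n≡0 p≤J)
    rowCount-part k (suc J) p≤J with k <? h J
    ... | yes k<h = trans (cong suc (rowCount-full h J λ i i<J → <-≤-trans k<h (height-antitone mu (<⇒≤ i<J)))) (≤-antisym (<height⇒<part mu k<h) p≤J)
    ... | no k≮h  = rowCount-part k J (≮⇒≥ λ J<p → k≮h (<part⇒<height d J<p))

    leg-count : ∀ y (f : ℕ → ℕ) x n → (∀ i → f i ≡ x + i) → h y ≤ x + n → length (filter (λ i → y <? part mu i) (applyUpTo f n)) ≡ h y ∸ x
    leg-count y f x zero    f≡ h≤ = sym (m≤n⇒m∸n≡0 (subst (h y ≤_) (+-identityʳ x) h≤))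
    leg-count y f x (suc n) f≡ h≤ = trans (count-∷ (λ i → y <? part mu i) (f 0) (applyUpTo (λ i → f (suc i)) n))
      (trans (cong (indicator (y <? part mu (f 0)) +_) (leg-count y (λ i → f (suc i)) (suc x) n (λ i → trans (f≡ (suc i)) (+-suc x i)) (subst (h y ≤_) (+-suc x n) h≤)))
        step)
      where
      f0 : f 0 ≡ x
      f0 = trans (f≡ 0) (+-identityʳ x)
      step : indicator (y <? part mu (f 0)) + (h y ∸ suc x) ≡ h y ∸ x
      step with y <? part mu (f 0)
      ... | yes y<p = sym (+-∸-assoc 1 (subst (_< h y) f0 (<part⇒<height d y<p)))
      ... | no y≮p  = trans (m≤n⇒m∸n≡0 (m≤n⇒m≤1+n h≤x)) (sym (m≤n⇒m∸n≡0 h≤x))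
        where
        h≤x : h y ≤ x
        h≤x = ≮⇒≥ λ x<h → y≮p (subst (λ k → y < part mu k) (sym f0) (<height⇒<part mu x<h))

    drop-applyUpTo : ∀ {A : Set} (f : ℕ → A) m n → drop m (applyUpTo f n) ≡ applyUpTo (λ i → f (m + i)) (n ∸ m)
    drop-applyUpTo f zero    n       = refl
    drop-applyUpTo f (suc m) zero    = refl
    drop-applyUpTo f (suc m) (suc n) = drop-applyUpTo (λ i → f (suc i)) m n

    -- `hookLength` counts the corner in both arm and leg and subtracts 1 at the end. The truncated
    -- subtraction can be moved onto the leg because x < h y.
    hook-formula : ∀ {x y} → x < length mu → y < part mu x → hookLength mu x y ≡ part mu x ∸ y + (h y ∸ suc x)
    hook-formula {x} {y} x<N y<p = trans (cong (λ l → part mu x ∸ y + l ∸ 1) (trans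
        (cong (λ L → length (filter (λ i → y <? part mu i) L)) (drop-applyUpTo (λ i → i) x (length mu)))
        (leg-count y (x +_) x (length mu ∸ x) (λ _ → refl) (subst (h y ≤_) (sym (m+[n∸m]≡n (<⇒≤ x<N))) (height≤length mu y)))))
      (trans (+-∸-assoc (part mu x ∸ y) (m<n⇒0<n∸m x<h)) (cong (part mu x ∸ y +_) (trans (∸-+-assoc (h y) x 1) (cong (h y ∸_) (+-comm x 1)))))
      where
      x<h : x < h y
      x<h = <part⇒<height d y<p

    -- J is at least the length of the first row, so no arm is cut off.
    α-hooks : ∀ J → part mu 0 ≤ J → α mu ≡ Counting.hookProduct h (height-antitone mu) (length mu) J
    α-hooks J p≤J = trans (product-cells _ mu) (∏-cong (length mu) λ x x<N → trans
      (∏-cong (part mu x) λ y y<p → hook-formula x<N y<p)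
      (cong (λ l → ∏ l (λ y → l ∸ y + (h y ∸ suc x))) (sym (rowCount-part x J (≤-trans (part-antitone d z≤n) p≤J)))))

-- Cells, columns and blocks of a tableau

module TableauCells {n : ℕ} where

  open import Defs using (part; at; entry; restrict; column; blocks; Tableau; _⊂ᴰ_)
  open ColumnHeights
  open ListLemmas
  open Stacks using (columnsFrom)
  open import Data.Fin using (Fin)
  open import Data.Fin.Properties using (_≟_)
  open import Data.List using (List; []; _∷_; _++_; length; concat; map; take; drop; applyUpTo)
  open import Data.List.Properties using (length-take)
  open import Data.List.Membership.Propositional using (_∈_)
  open import Data.List.Membership.Propositional.Properties using (∈-++⁺ˡ; ∈-++⁺ʳ; ∈-++⁻)
  open import Data.List.Membership.DecPropositional (_≟_ {n}) using (_∈?_)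
  open import Data.List.Relation.Binary.Permutation.Propositional as ↭ using (_↭_; ↭-sym; ↭-trans)
  open import Data.List.Relation.Binary.Permutation.Propositional.Properties using (∈-resp-↭; ++⁺)
  open import Data.List.Relation.Binary.Sublist.Propositional as Sublist using (_⊆_; []; _∷_; _∷ʳ_; lookup)
  open import Data.List.Relation.Binary.Sublist.Propositional.Properties using (take-⊆) renaming (++⁺ to ⊆-++⁺)
  open import Data.List.Relation.Unary.Any using (here; there)
  open import Data.List.Relation.Unary.All using (All; []; _∷_)
  open import Data.List.Relation.Unary.AllPairs using ([]; _∷_)
  open import Data.List.Relation.Unary.Linked as Linked using ([]; _∷_)
  open import Data.List.Relation.Unary.Unique.Propositional using (Unique)
  open import Data.Maybe using (Maybe; just; nothing)
  open import Data.Nat using (zero; suc; _+_; _∸_; _<?_; z≤n; s≤s; s≤s⁻¹)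
  open import Data.Nat.Properties hiding (_≟_)
  open import Data.Product using (∃; ∃₂; _×_; _,_)
  open import Data.Sum using (inj₁; inj₂)
  open import Data.Empty using (⊥-elim)
  open import Relation.Nullary using (yes; no; ¬_)
  open ≡ using (refl; sym; trans; cong; cong₂; subst)

  private
    V : Set
    V = Fin n

  at-∈ : ∀ (r : List V) {j x} → at r j ≡ just x → x ∈ r
  at-∈ (y ∷ r) {zero}  refl = here refl
  at-∈ (y ∷ r) {suc j} eq   = there (at-∈ r eq)

  ∈-at : ∀ {r : List V} {x} → x ∈ r → ∃ λ j → at r j ≡ just x
  ∈-at (here refl) = 0 , refl
  ∈-at (there x∈)  = let j , eq = ∈-at x∈ in suc j , eq

  at-defined : ∀ (r : List V) {j} → j < length r → ∃ λ x → at r j ≡ just x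
  at-defined (x ∷ r) {zero}  j<l = x , refl
  at-defined (x ∷ r) {suc j} j<l = at-defined r (s≤s⁻¹ j<l)

  at-bound : ∀ (r : List V) {j x} → at r j ≡ just x → j < length r
  at-bound (y ∷ r) {zero}  eq = s≤s z≤n
  at-bound (y ∷ r) {suc j} eq = s≤s (at-bound r eq)

  at-undefined : ∀ (r : List V) {j} → length r ≤ j → at r j ≡ nothing
  at-undefined []      l≤j = refl
  at-undefined (x ∷ r) (s≤s l≤j) = at-undefined r l≤j

  entry-∈ : ∀ (R : Tableau n) i {j x} → entry R i j ≡ just x → x ∈ concat R
  entry-∈ (r ∷ R) zero    eq = ∈-++⁺ˡ (at-∈ r eq)
  entry-∈ (r ∷ R) (suc i) eq = ∈-++⁺ʳ r (entry-∈ R i eq)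

  ∈-entry : ∀ (R : Tableau n) {x} → x ∈ concat R → ∃₂ λ i j → entry R i j ≡ just x
  ∈-entry (r ∷ R) x∈ with ∈-++⁻ r x∈
  ... | inj₁ x∈r = 0 , ∈-at x∈r
  ... | inj₂ x∈R = let i , j , eq = ∈-entry R x∈R in suc i , j , eq

  entry-defined : ∀ (R : Tableau n) i {j} → j < part (map length R) i → ∃ λ x → entry R i j ≡ just x
  entry-defined (r ∷ R) zero    j<p = at-defined r j<p
  entry-defined (r ∷ R) (suc i) j<p = entry-defined R i j<p

  entry-bound : ∀ (R : Tableau n) i {j x} → entry R i j ≡ just x → j < part (map length R) i
  entry-bound (r ∷ R) zero    eq = at-bound r eq
  entry-bound (r ∷ R) (suc i) eq = entry-bound R i eq

  indexIn : List V → V → ℕ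
  indexIn []      x = 0
  indexIn (y ∷ r) x with x ≟ y
  ... | yes _ = 0
  ... | no _  = suc (indexIn r x)

  -- The symmetrizers take total labellings; for an element that does not occur in the tableau the
  -- values are placeholders.
  rowOf colOf : Tableau n → V → ℕ
  rowOf []      x = 0
  rowOf (r ∷ R) x with x ∈? r
  ... | yes _ = 0
  ... | no _  = suc (rowOf R x)
  colOf []      x = 0
  colOf (r ∷ R) x with x ∈? r
  ... | yes _ = indexIn r x
  ... | no _  = colOf R x

  unique-++-disjoint : ∀ (L : List V) {M x} → Unique (L ++ M) → x ∈ L → ¬ x ∈ M
  unique-++-disjoint (y ∷ L) U (here refl) x∈M = head# U (∈-++⁺ʳ L x∈M) refl
  unique-++-disjoint (y ∷ L) U (there x∈)  x∈M = unique-++-disjoint L (tail-unique U) x∈ x∈M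

  indexIn-at : ∀ {r : List V} {j x} → Unique r → at r j ≡ just x → indexIn r x ≡ j
  indexIn-at {y ∷ r} {zero}  {x} U refl with x ≟ x
  ... | yes _  = refl
  ... | no x≢x = ⊥-elim (x≢x refl)
  indexIn-at {y ∷ r} {suc j} {x} U eq with x ≟ y
  ... | yes refl = ⊥-elim (head# U (at-∈ r eq) refl)
  ... | no _     = cong suc (indexIn-at (tail-unique U) eq)

  rowOf-entry : ∀ {R : Tableau n} {i j x} → Unique (concat R) → entry R i j ≡ just x → rowOf R x ≡ i
  rowOf-entry {r ∷ R} {zero}  {j} {x} U eq with x ∈? r
  ... | yes _  = refl
  ... | no x∉r = ⊥-elim (x∉r (at-∈ r eq))
  rowOf-entry {r ∷ R} {suc i} {j} {x} U eq with x ∈? r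
  ... | yes x∈r = ⊥-elim (unique-++-disjoint r U x∈r (entry-∈ R i eq))
  ... | no _    = cong suc (rowOf-entry {R} {i} (unique-++⁻ʳ r U) eq)

  colOf-entry : ∀ {R : Tableau n} {i j x} → Unique (concat R) → entry R i j ≡ just x → colOf R x ≡ j
  colOf-entry {r ∷ R} {zero}  {j} {x} U eq with x ∈? r
  ... | yes _  = indexIn-at (unique-++⁻ˡ r U) eq
  ... | no x∉r = ⊥-elim (x∉r (at-∈ r eq))
  colOf-entry {r ∷ R} {suc i} {j} {x} U eq with x ∈? r
  ... | yes x∈r = ⊥-elim (unique-++-disjoint r U x∈r (entry-∈ R i eq))
  ... | no _    = colOf-entry {R} {i} (unique-++⁻ʳ r U) eq

  column-empty : ∀ (R : Tableau n) {j} → (∀ i → part (map length R) i ≤ j) → column R j ≡ []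
  column-empty []          short = refl
  column-empty (r ∷ R) {j} short rewrite at-undefined r (short 0) = column-empty R (λ i → short (suc i))

  column-entries : ∀ (R : Tableau n) (E : ℕ → ℕ → V) {j} → Decreasing (map length R) →
    (∀ i → j < part (map length R) i → entry R i j ≡ just (E i j)) →
    column R j ≡ applyUpTo (λ i → E i j) (height (map length R) j)
  column-entries []      E d eq = refl
  column-entries (r ∷ R) E {j} d eq with j <? length r
  ... | yes j<l rewrite eq 0 j<l = cong (E 0 j ∷_) (column-entries R (λ i → E (suc i)) (Linked.tail d) (λ i → eq (suc i)))
  ... | no j≮l  rewrite at-undefined r (≮⇒≥ j≮l) = column-empty R (λ i → ≤-trans (part-tail≤head d i) (≮⇒≥ j≮l))

  restrict-lengths : ∀ mu (T : Tableau n) → All (0 <_) mu → mu ⊂ᴰ map length T → map length (restrict mu T) ≡ mu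
  restrict-lengths []       T       pos sub = refl
  restrict-lengths (x ∷ mu) []      (0<x ∷ pos) sub = ⊥-elim (<⇒≱ 0<x (sub 0))
  restrict-lengths (x ∷ mu) (r ∷ T) (0<x ∷ pos) sub = cong₂ _∷_ (trans (length-take x r) (m≤n⇒m⊓n≡m (sub 0))) (restrict-lengths mu T pos (λ i → sub (suc i)))

  at-take : ∀ (r : List V) {j m} → j < m → at (take m r) j ≡ at r j
  at-take r       {j}     {zero}  ()
  at-take []      {j}     {suc m} j<m = refl
  at-take (x ∷ r) {zero}  {suc m} j<m = refl
  at-take (x ∷ r) {suc j} {suc m} j<m = at-take r (s≤s⁻¹ j<m)

  restrict-entry : ∀ mu (T : Tableau n) i {j} → j < part mu i → entry (restrict mu T) i j ≡ entry T i j
  restrict-entry (x ∷ mu) []      i       j<p = refl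
  restrict-entry (x ∷ mu) (r ∷ T) zero    j<p = at-take r j<p
  restrict-entry (x ∷ mu) (r ∷ T) (suc i) j<p = restrict-entry mu T i j<p

  restrict-⊆ : ∀ mu (T : Tableau n) → concat (restrict mu T) ⊆ concat T
  restrict-⊆ []       T       = Sublist.minimum (concat T)
  restrict-⊆ (x ∷ mu) []      = []
  restrict-⊆ (x ∷ mu) (r ∷ T) = ⊆-++⁺ (take-⊆ x r) (restrict-⊆ mu T)

  unique-⊆ : ∀ {L M : List V} → L ⊆ M → Unique M → Unique L
  unique-⊆ []          U = []
  unique-⊆ (y ∷ʳ s)    U = unique-⊆ s (tail-unique U)
  unique-⊆ (refl ∷ s)  U = #⇒All (λ e∈ → head# U (lookup s e∈)) ∷ unique-⊆ s (tail-unique U)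

  unique-same-elements : ∀ {L M : List V} → Unique L → Unique M → (∀ {x} → x ∈ L → x ∈ M) → (∀ {x} → x ∈ M → x ∈ L) → L ↭ M
  unique-same-elements {[]}    {[]}    UL UM L⊆M M⊆L = ↭.refl
  unique-same-elements {[]}    {y ∷ M} UL UM L⊆M M⊆L with M⊆L (here refl)
  ... | ()
  unique-same-elements {x ∷ L} {M} UL UM L⊆M M⊆L with pluck (L⊆M (here refl))
  ... | M′ , p = ↭-trans (↭.prep x (unique-same-elements (tail-unique UL) (tail-unique UM′) to from)) (↭-sym p)
    where
    UM′ = Unique-resp-↭ p UM
    to : ∀ {y} → y ∈ L → y ∈ M′
    to y∈ with ∈-resp-↭ p (L⊆M (there y∈))
    ... | here refl = ⊥-elim (head# UL y∈ refl)
    ... | there y∈′ = y∈′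
    from : ∀ {y} → y ∈ M′ → y ∈ L
    from y∈ with M⊆L (∈-resp-↭ (↭-sym p) (there y∈))
    ... | here refl = ⊥-elim (head# UM′ y∈ refl)
    ... | there y∈′ = y∈′

  applyUpTo-columnsFrom : ∀ (C : ℕ → List V) (f : ℕ → List V) j m → (∀ i → f i ≡ C (j + i)) → applyUpTo f m ≡ columnsFrom C j m
  applyUpTo-columnsFrom C f j zero    eq = refl
  applyUpTo-columnsFrom C f j (suc m) eq = cong₂ _∷_ (trans (eq 0) (cong C (+-identityʳ j)))
    (applyUpTo-columnsFrom C (λ i → f (suc i)) (suc j) m (λ i → trans (eq (suc i)) (cong C (+-suc j i))))

  drop-columnsFrom : ∀ (C : ℕ → List V) j m s → drop s (columnsFrom C j m) ≡ columnsFrom C (j + s) (m ∸ s)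
  drop-columnsFrom C j m       zero    = cong (λ i → columnsFrom C i m) (sym (+-identityʳ j))
  drop-columnsFrom C j zero    (suc s) = refl
  drop-columnsFrom C j (suc m) (suc s) = trans (drop-columnsFrom C (suc j) m s) (cong (λ i → columnsFrom C i (m ∸ s)) (sym (+-suc j s)))

  module _ (C : ℕ → List V) (h : ℕ → ℕ) (length-C : ∀ j → length (C j) ≡ h j) (J : ℕ) where

    -- The output of `blocks` read by position: each block is given by its first column j, its width
    -- `suc l` and the common height h j.
    data BlocksFrom : ℕ → List (ℕ × List (List V)) → Set where
      done : BlocksFrom J []
      next : ∀ {j l bs} → (∀ {k} → j ≤ k → k < j + suc l → h k ≡ h j) → BlocksFrom (j + suc l) bs →
             BlocksFrom j ((h j , columnsFrom C j (suc l)) ∷ bs)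

    single-level : ∀ {j k} → j ≤ k → k < j + 1 → h k ≡ h j
    single-level {j} {k} j≤k k<j+1 = cong h (sym (≤-antisym j≤k (s≤s⁻¹ (subst (k <_) (+-comm j 1) k<j+1))))

    blocks-columnsFrom : ∀ j m → j + m ≡ J → BlocksFrom j (blocks (columnsFrom C j m))
    blocks-columnsFrom j zero    j+m = subst (λ k → BlocksFrom k []) (trans (sym j+m) (+-identityʳ j)) done
    blocks-columnsFrom j (suc m) j+m with blocks (columnsFrom C (suc j) m) | blocks-columnsFrom (suc j) m (trans (sym (+-suc j m)) j+m)
    ... | [] | done rewrite length-C j = next single-level (subst (λ k → BlocksFrom k []) (sym (trans (+-suc j 0) (cong suc (+-identityʳ j)))) done)
    ... | (_ , _) ∷ bs | next {l = l} level rest with length (C j) Data.Nat.≟ h (suc j)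
    -- Column j joins the block that starts at column j + 1; the stored height h (suc j) has to be
    -- rewritten to h j.
    ...   | yes eq = subst (λ m → BlocksFrom j ((m , columnsFrom C j (suc (suc l))) ∷ bs)) hj≡
                (next level′ (subst (λ k → BlocksFrom k bs) (sym (+-suc j (suc l))) rest))
      where
      hj≡ : h j ≡ h (suc j)
      hj≡ = trans (sym (length-C j)) eq
      level′ : ∀ {k} → j ≤ k → k < j + suc (suc l) → h k ≡ h j
      level′ {k} j≤k k< with j Data.Nat.≟ k
      ... | yes refl = refl
      ... | no j≢k   = trans (level (≤∧≢⇒< j≤k j≢k) (subst (k <_) (+-suc j (suc l)) k<)) (sym hj≡)
    ...   | no neq rewrite length-C j = next single-level (subst (λ k → BlocksFrom k ((h (suc j) , columnsFrom C (suc j) (suc l)) ∷ bs)) (sym (trans (+-suc j 0) (cong suc (+-identityʳ j)))) (next level rest))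

open import Defs
open import Data.Fin using (Fin)
open import Data.List using (List; drop; map; length; concat; allFin)
open import Data.List.Relation.Binary.Permutation.Propositional using (_↭_)
open import Data.Maybe using (just)
open import Data.Product using (_,_)

-- Products of symmetrizers over rows or columns

module ProductsOfSymmetrizers {f ℓf c ℓ} {F : Field f ℓf} {V : Set} (𝔸 : TranspositionAlgebra F V c ℓ)
  (ρ : V → ℕ) (ε : TranspositionAlgebra.K.Carrier 𝔸)
  (ε² : TranspositionAlgebra.K._≈_ 𝔸 (TranspositionAlgebra.K._*_ 𝔸 ε ε) (TranspositionAlgebra.K.1# 𝔸)) where

  open TranspositionAlgebra 𝔸
  open Stars 𝔸
  open Symmetrizers 𝔸
  open Symmetrizer ρ ε ε²
  open ListLemmas
  open import Data.List using ([]; _∷_; _++_; concat; map; foldr)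
  open import Data.List.Properties using (filter-all; filter-none; filter-++; ++-identityʳ)
  open import Data.List.Membership.Propositional using (_∈_)
  open import Data.List.Membership.Propositional.Properties using (∈-++⁺ˡ; ∈-++⁻)
  open import Data.List.Relation.Unary.All as All using (All)
  open import Data.List.Relation.Unary.Any using (here; there)
  open import Data.List.Relation.Unary.Unique.Propositional using (Unique)
  open import Data.Nat using (_≟_)
  import Data.Nat.Properties as ℕ
  open import Data.Sum using (inj₁; inj₂)
  open import Relation.Binary.Reasoning.Setoid setoid

  -- Labels increase along the list of lists, so different lists form different classes.
  data Labelled : ℕ → List (List V) → Set where
    []  : ∀ {k} → Labelled k []
    _∷_ : ∀ {k X Xs} → (∀ {x} → x ∈ X → ρ x ≡ k) → Labelled (suc k) Xs → Labelled k (X ∷ Xs)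

  labelled-≥ : ∀ {k Xs x} → Labelled k Xs → x ∈ concat Xs → k ≤ ρ x
  labelled-≥ (_∷_ {X = X} own rest) x∈ with ∈-++⁻ X x∈
  ... | inj₁ x∈X = ℕ.≤-reflexive (≡.sym (own x∈X))
  ... | inj₂ x∈R = ℕ.<⇒≤ (labelled-≥ rest x∈R)

  -- Here s stands for `𝔞` or `𝔟`, known only through its recursion on the first entry.
  module _ (s : List V → Carrier) (s-[] : s [] ≈ 1#) (s-∷ : ∀ {x X} → x # X → s (x ∷ X) ≈ (1# + e * ⋆ x X) * s X) where

    -- No entry of M has the label of X, so the star in the factor of each entry of X runs over the
    -- rest of X only.
    Sym-++ : ∀ {k} X {M} → Unique (X ++ M) → (∀ {x} → x ∈ X → ρ x ≡ k) → (∀ {y} → y ∈ M → ρ y ≢ k) → s X * Sym M ≈ Sym (X ++ M)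
    Sym-++ []      U own other = trans (*-congʳ s-[]) (*-identityˡ _)
    Sym-++ {k} (x ∷ X) {M} U own other = begin
      s (x ∷ X) * Sym M                   ≈⟨ *-congʳ (s-∷ λ e∈ → head# U (∈-++⁺ˡ e∈)) ⟩
      (1# + e * ⋆ x X) * s X * Sym M      ≈⟨ *-assoc _ _ _ ⟩
      (1# + e * ⋆ x X) * (s X * Sym M)    ≈⟨ *-cong (+-congˡ (*-congˡ (reflexive (≡.cong (⋆ x) (≡.sym own-class))))) (Sym-++ X (tail-unique U) (λ x∈ → own (there x∈)) other) ⟩
      Sym (x ∷ X ++ M)                    ∎
      where
      own-class : class ρ (ρ x) (X ++ M) ≡ X
      own-class = ≡.trans (≡.cong (λ k → class ρ k (X ++ M)) (own (here ≡.refl)))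
        (≡.trans (filter-++ (λ e → ρ e ≟ k) X M)
          (≡.trans (≡.cong₂ _++_ (filter-all _ (All.tabulate λ x∈ → own (there x∈))) (filter-none _ (All.tabulate other))) (++-identityʳ X)))

    product≈Sym : ∀ {k Xs} → Unique (concat Xs) → Labelled k Xs → foldr _*_ 1# (map s Xs) ≈ Sym (concat Xs)
    product≈Sym U []           = refl
    product≈Sym U (_∷_ {k} {X} {Xs} own rest) = trans (*-congˡ (product≈Sym (unique-++⁻ʳ X U) rest))
      (Sym-++ X U own λ y∈ ρy≡k → ℕ.<-irrefl (≡.sym ρy≡k) (labelled-≥ rest y∈))

-- The Young symmetrizer of a tableau

module TableauSymmetrizer {c ℓ} (F : Field c ℓ) (charZero : CharZero F) (n : ℕ)
  (row col : Fin n → ℕ) (E : ℕ → ℕ → Fin n) (R : Tableau n) {ν : List ℕ} where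

  open import Data.List using ([]; _∷_; map; length; concat; applyUpTo; _++_)
  open import Data.List.Properties using (map-upTo; reverse-applyUpTo)
  open import Data.List.Membership.Propositional using (_∈_)
  open import Data.List.Membership.Propositional.Properties using (∈-applyUpTo⁻)
  open import Data.List.Relation.Binary.Permutation.Propositional using (_↭_; ↭-sym; ↭-trans; ↭-reflexive)
  open import Data.List.Relation.Binary.Permutation.Propositional.Properties using (↭-reverse)
  open import Data.List.Relation.Unary.Unique.Propositional using (Unique)
  open import Data.Fin.Properties using (_≟_)
  open import Data.Maybe.Properties using (just-injective)
  open import Data.Nat using (zero; _+_; _∸_; z≤n)
  import Data.Nat.Properties as ℕ
  open import Data.Product using (_,_)
  open GroupAlgebra F charZero n
  open GroupAlgebraRing F charZero n
  open SymmetrizerRecursion F charZero n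
  open Signs F charZero n
  open ColumnHeights
  open TableauCells
  open ListLemmas
  open Stacks
  open TranspositionAlgebra group-algebra using (*-cong; *-congˡ; *-congʳ; trans; sym; refl)
  open YoungSymmetrizer charZero _≟_ group-algebra row col

  module _ (lengths : map length R ≡ ν) (d : Decreasing ν)
    (entries : ∀ i j → j < part ν i → entry R i j ≡ just (E i j)) (U : Unique (concat R))
    (row-entry : ∀ i j {x} → entry R i j ≡ just x → row x ≡ i) (col-entry : ∀ i j {x} → entry R i j ≡ just x → col x ≡ j) where

    row-E : ∀ {i j} → i < height ν j → row (E i j) ≡ i
    row-E {i} {j} i<h = row-entry i j (entries i j (<height⇒<part ν i<h))

    col-E : ∀ {i j} → i < height ν j → col (E i j) ≡ j
    col-E {i} {j} i<h = col-entry i j (entries i j (<height⇒<part ν i<h))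

    open Shape charZero _≟_ group-algebra row col E (height ν) row-E col-E using (chain; Cell; cell; ∈-chain⁻; ∈-chain⁺; chain-unique; Col) renaming (column to shape-column)

    entry-cell : ∀ i j {x} → entry R i j ≡ just x → x ≡ E i j
    entry-cell i j eq = just-injective (≡.trans (≡.sym eq) (entries i j (≡.subst (λ ν → j < part ν i) lengths (entry-bound R i eq))))

    entry-height : ∀ i j {x} → entry R i j ≡ just x → i < height ν j
    entry-height i j eq = <part⇒<height d (≡.subst (λ ν → j < part ν i) lengths (entry-bound R i eq))

    rows↭chain : ∀ {J} → part ν 0 ≤ J → concat R ↭ chain J
    rows↭chain {J} w≤J = unique-same-elements U (chain-unique J) to from
      where
      to : ∀ {x} → x ∈ concat R → x ∈ chain J
      to x∈ with ∈-entry R x∈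
      ... | i , j , eq with entry-cell i j eq
      ...   | ≡.refl = ∈-chain⁺ (ℕ.<-≤-trans (<height⇒<part ν (entry-height i j eq)) (ℕ.≤-trans (part-antitone d z≤n) w≤J)) (entry-height i j eq)
      from : ∀ {x} → x ∈ chain J → x ∈ concat R
      from x∈ with ∈-chain⁻ J x∈
      ... | cell {i} {j} _ i<h = entry-∈ R i (entries i j (<height⇒<part ν i<h))

    column≡ : ∀ j → column R j ≡ applyUpTo (λ i → E i j) (height ν j)
    column≡ j = ≡.trans (column-entries R E (≡.subst Decreasing (≡.sym lengths) d) (λ i p → entries i j (≡.subst (λ ν → j < part ν i) lengths p)))
      (≡.cong (λ ν → applyUpTo (λ i → E i j) (height ν j)) lengths)

    column↭ : ∀ j → column R j ↭ shape-column j
    column↭ j = ↭-trans (↭-sym (↭-reverse (column R j)))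
      (↭-reflexive (≡.trans (≡.cong Data.List.reverse (column≡ j)) (reverse-applyUpTo (λ i → E i j) (height ν j))))

    columns≡ : columns R ≡ columnsFrom (column R) 0 (part ν 0)
    columns≡ = ≡.trans (map-upTo (column R) (part (map length R) 0))
      (≡.trans (≡.cong (λ ν → applyUpTo (column R) (part ν 0)) lengths) (applyUpTo-columnsFrom (column R) (column R) 0 (part ν 0) λ _ → ≡.refl))

    stack≡chain : ∀ J → stack shape-column 0 J ≡ chain J
    stack≡chain zero    = ≡.refl
    stack≡chain (suc J) = ≡.cong (shape-column J ++_) (stack≡chain J)

    -- Columns beyond the first row are empty. This allows T and S to share one number J of columns.
    chain-beyond : ∀ m → chain (part ν 0 + m) ≡ chain (part ν 0)
    chain-beyond zero    = ≡.cong chain (ℕ.+-identityʳ (part ν 0))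
    chain-beyond (suc m) = ≡.trans (≡.cong chain (ℕ.+-suc (part ν 0) m))
      (≡.trans (≡.cong (λ l → Col (part ν 0 + m) l ++ chain (part ν 0 + m)) empty) (chain-beyond m))
      where
      empty : height ν (part ν 0 + m) ≡ 0
      empty = ℕ.n≤0⇒n≡0 (ℕ.≮⇒≥ λ 0<h → ℕ.<⇒≱ (<height⇒<part ν 0<h) (ℕ.m≤m+n (part ν 0) m))

    columns↭chain : ∀ {J} → part ν 0 ≤ J → concat (columns R) ↭ chain J
    columns↭chain {J} w≤J = ↭-trans (↭-reflexive (≡.cong concat columns≡))
      (↭-trans (concat-columnsFrom column↭ 0 (part ν 0))
        (↭-reflexive (≡.trans (stack≡chain (part ν 0)) (≡.trans (≡.sym (chain-beyond (J ∸ part ν 0))) (≡.cong chain (ℕ.m+[n∸m]≡n w≤J))))))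

    private
      module Rows = ProductsOfSymmetrizers group-algebra row (Field.1# F) 1²
      module Columns = ProductsOfSymmetrizers group-algebra col -1K -1²

    rows-labelled : ∀ (R : Tableau n) k → (∀ i j {x} → entry R i j ≡ just x → row x ≡ k + i) → Rows.Labelled k R
    rows-labelled []      k lab = Rows.[]
    rows-labelled (r ∷ R) k lab = (λ x∈ → let j , eq = ∈-at x∈ in ≡.trans (lab 0 j eq) (ℕ.+-identityʳ k))
      Rows.∷ rows-labelled R (suc k) (λ i j eq → ≡.trans (lab (suc i) j eq) (ℕ.+-suc k i))

    columns-labelled : ∀ j l → Columns.Labelled j (columnsFrom (column R) j l)
    columns-labelled j zero    = Columns.[]
    columns-labelled j (suc l) = own Columns.∷ columns-labelled (suc j) l
      where
      own : ∀ {x} → x ∈ column R j → col x ≡ j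
      own x∈ with ∈-applyUpTo⁻ (λ i → E i j) (≡.subst (_ ∈_) (column≡ j) x∈)
      ... | i , i<h , ≡.refl = col-E i<h

    -- The two products list the cells by rows and by columns. Both listings are permutations of the
    -- chain, and `Sym` does not depend on the order.
    symmetrizer≋cc : ∀ {J} → part ν 0 ≤ J → 𝔠 R ≋ cc (chain J)
    symmetrizer≋cc {J} w≤J = *-cong {prod (map 𝔞 R)} {A.Sym (chain J)} {prod (map 𝔟 (columns R))} {B.Sym (chain J)}
      (trans {prod (map 𝔞 R)} {A.Sym (concat R)} {A.Sym (chain J)}
        (Rows.product≈Sym 𝔞 (λ _ → Field.refl F) 𝔞-∷ U (rows-labelled R 0 row-entry)) (A.Sym-↭ U (rows↭chain w≤J)))
      (trans {prod (map 𝔟 (columns R))} {B.Sym (concat (columns R))} {B.Sym (chain J)}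
        (Columns.product≈Sym 𝔟 (single-cong sgn-id λ _ → ≡.refl) 𝔟-∷ UC (≡.subst (Columns.Labelled 0) (≡.sym columns≡) (columns-labelled 0 (part ν 0))))
        (B.Sym-↭ UC (columns↭chain w≤J)))
      where
      UC : Unique (concat (columns R))
      UC = Unique-resp-↭ (↭-sym (columns↭chain w≤J)) (chain-unique J)

-- The formula for T and its subtableau S

module Branching {c ℓ} (F : Field c ℓ) (charZero : CharZero F) (k : ℕ) (mu : List ℕ) (T : Tableau (suc k))
  (lam-partition : IsPartition (suc k) (map length T)) (mu-partition : IsPartition k mu)
  (mu⊂lam : mu ⊂ᴰ map length T)
  (T↭ : concat T ↭ allFin (suc k))
  (u v : ℕ) (lam-u : part (map length T) u ≡ suc v) (mu-u : part mu u ≡ v)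
  (others : ∀ i → i ≢ u → part (map length T) i ≡ part mu i)
  (a : Fin (suc k)) (entry-a : entry T u v ≡ just a) where

  open import Data.List using ([]; _∷_; _++_; [_])
  open import Data.List.Properties using (length-applyUpTo)
  open import Data.List.Relation.Binary.Permutation.Propositional using (↭-sym)
  open import Data.List.Relation.Unary.Unique.Propositional using (Unique)
  open import Data.List.Relation.Unary.Unique.Propositional.Properties using (allFin⁺)
  open import Data.Fin using (zero)
  open import Data.Fin.Properties using (_≟_)
  open import Data.Fin.Permutation using (transpose) renaming (id to idₚ)
  open import Data.Maybe using (fromMaybe)
  open import Data.Nat using (_+_; _∸_) renaming (_≟_ to _≟ℕ_; zero to zeroℕ)
  import Data.Nat.Properties as ℕ
  open import Data.Product using (_×_; proj₁; proj₂)
  open import Relation.Nullary using (yes; no)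
  open GroupAlgebra F charZero (suc k)
  open GroupAlgebraRing F charZero (suc k)
  open ColumnHeights
  open TableauCells
  open ListLemmas
  open Stacks
  open HookLengths
  open TranspositionAlgebra group-algebra using (setoid; *-congˡ; *-congʳ; +-congˡ; ι; ι-cong)
  open Stars group-algebra using (⋆; ∑-↭)
  open import Relation.Binary.Reasoning.Setoid setoid

  private
    lam : List ℕ
    lam = map length T

    S : Tableau (suc k)
    S = restrict mu T

    lam-decreasing : Decreasing lam
    lam-decreasing = proj₁ (proj₂ lam-partition)

    mu-decreasing : Decreasing mu
    mu-decreasing = proj₁ (proj₂ mu-partition)

    S-lengths : map length S ≡ mu
    S-lengths = restrict-lengths mu T (proj₁ mu-partition) mu⊂lam

    -- The default value occurs only outside the shape of T.
    E : ℕ → ℕ → Fin (suc k)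
    E i j = fromMaybe zero (entry T i j)

    row col : Fin (suc k) → ℕ
    row = rowOf T
    col = colOf T

    T-unique : Unique (concat T)
    T-unique = Unique-resp-↭ (↭-sym T↭) (allFin⁺ (suc k))

    T-entries : ∀ i j → j < part lam i → entry T i j ≡ just (E i j)
    T-entries i j j<p with entry T i j | entry-defined T i j<p
    ... | _ | _ , ≡.refl = ≡.refl

    S-entries : ∀ i j → j < part mu i → entry S i j ≡ just (E i j)
    S-entries i j j<p = ≡.trans (restrict-entry mu T i j<p) (T-entries i j (ℕ.<-≤-trans j<p (mu⊂lam i)))

    S-entry : ∀ i j {x} → entry S i j ≡ just x → entry T i j ≡ just x
    S-entry i j eq = ≡.trans (≡.sym (restrict-entry mu T i (≡.subst (λ ν → j < part ν i) S-lengths (entry-bound S i eq)))) eq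

    T-row : ∀ i j {x} → entry T i j ≡ just x → row x ≡ i
    T-row i j = rowOf-entry {R = T} {i} T-unique

    T-col : ∀ i j {x} → entry T i j ≡ just x → col x ≡ j
    T-col i j = colOf-entry {R = T} {i} T-unique

    open AddedCell lam-decreasing mu-decreasing {u} {v} lam-u mu-u others

    -- J covers the widths of both S and T. The truncated subtraction gives m = 0, that is no block
    -- at all, when S has at most v + 1 columns.
    m J : ℕ
    m = part mu 0 ∸ suc v
    J = suc v + m

    mu-0≤J : part mu 0 ≤ J
    mu-0≤J = ℕ.m≤n+m∸n (part mu 0) (suc v)

    lam-0≤J : part lam 0 ≤ J
    lam-0≤J with u ≟ℕ 0
    ... | yes ≡.refl = ≡.subst (_≤ J) (≡.sym lam-u) (ℕ.m≤m+n (suc v) m)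
    ... | no u≢0     = ≡.subst (_≤ J) (≡.sym (others 0 (≢-sym u≢0))) mu-0≤J

    module OfT = TableauSymmetrizer F charZero (suc k) row col E T
    module OfS = TableauSymmetrizer F charZero (suc k) row col E S

    module P = ProductFormula charZero _≟_ group-algebra row col E (height mu) (height lam) u v J
      (OfT.row-E ≡.refl lam-decreasing T-entries T-unique T-row T-col) (OfT.col-E ≡.refl lam-decreasing T-entries T-unique T-row T-col)
      (height-antitone mu) (height-antitone lam) height-mu height-lam height-other (ℕ.m≤m+n (suc v) m)

    𝔠T : 𝔠 T ≋ P.cᵀ
    𝔠T = OfT.symmetrizer≋cc ≡.refl lam-decreasing T-entries T-unique T-row T-col lam-0≤J

    S-row : ∀ i j {x} → entry S i j ≡ just x → row x ≡ i
    S-row i j eq = T-row i j (S-entry i j eq)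

    S-col : ∀ i j {x} → entry S i j ≡ just x → col x ≡ j
    S-col i j eq = T-col i j (S-entry i j eq)

    S-unique : Unique (concat S)
    S-unique = unique-⊆ (restrict-⊆ mu T) T-unique

    𝔠S : 𝔠 S ≋ P.cˢ
    𝔠S = OfS.symmetrizer≋cc S-lengths mu-decreasing S-entries S-unique S-row S-col mu-0≤J

    a≡E : a ≡ E u v
    a≡E = ≡.cong (fromMaybe zero) (≡.sym entry-a)

    length-column : ∀ j → length (column S j) ≡ height mu j
    length-column j = ≡.trans (≡.cong length (OfS.column≡ S-lengths mu-decreasing S-entries S-unique S-row S-col j)) (length-applyUpTo _ (height mu j))

    Blocks : ℕ → List (ℕ × List (List (Fin (suc k)))) → Set
    Blocks = BlocksFrom (column S) (height mu) length-column J

    widths : List (ℕ × List (List (Fin (suc k)))) → List ℕ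
    widths = map (λ b → length (proj₂ b))

    length-columnsFrom : ∀ (C : ℕ → List (Fin (suc k))) j l → length (columnsFrom C j l) ≡ l
    length-columnsFrom C j zeroℕ  = ≡.refl
    length-columnsFrom C j (suc l) = ≡.cong suc (length-columnsFrom C (suc j) l)

    levels : ∀ {j bs} → Blocks j bs → P.Levels j (widths bs)
    levels done = P.done
    levels (next {j} {l} {bs} level rest) = ≡.subst (λ l′ → P.Levels j (suc l′ ∷ widths bs)) (≡.sym (length-columnsFrom (column S) (suc j) l)) (P.next level (levels rest))

    star≡∑ : ∀ x L → ∑ (map (λ e → ⟦ transpose x e ⟧) L) ≡ ⋆ x L
    star≡∑ x []      = ≡.refl
    star≡∑ x (e ∷ L) = ≡.cong (⟦ transpose x e ⟧ ++_) (star≡∑ x L)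

    module Kᶠ = Field F

    -- A block preceded by L columns of the truncated tableau starts at column v + 1 + L of S. The
    -- two occurrences of v cancel, and `inv` at a successor is `recip` at the predecessor.
    scalar≡ : ∀ L l {H} → H ≤ u → inv (L + l + suc u ∸ H) ≡ CharacteristicZero.recip {F = F} charZero (suc v + L + l + u ∸ suc (H + v))
    scalar≡ L l {H} H≤u = ≡.trans (≡.cong inv (≡.trans (≡.cong (_∸ H) (ℕ.+-suc (L + l) u)) (ℕ.+-∸-assoc 1 (ℕ.≤-trans H≤u (ℕ.m≤n+m u (L + l))))))
      (≡.cong (CharacteristicZero.recip {F = F} charZero) (≡.sym (≡.trans (≡.cong₂ (λ p q → p ∸ suc q) shuffle (ℕ.+-comm H v)) (ℕ.[m+n]∸[m+o]≡n∸o v (L + l + u) H))))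
      where
      shuffle : suc v + L + l + u ≡ suc (v + (L + l + u))
      shuffle = ≡.cong suc (≡.trans (≡.cong (_+ u) (ℕ.+-assoc v L l)) (ℕ.+-assoc v (L + l) u))

    factor≋ : ∀ L l → 1ₐ ⊕ (Kᶠ.- inv (L + length (columnsFrom (column S) (suc v + L) l) + suc u ∸ height mu (suc v + L)))
        ⊙ ∑ (map (λ e → ⟦ transpose a e ⟧) (concat (columnsFrom (column S) (suc v + L) l)))
      ≋ P.blockFactor (suc v + L) l
    factor≋ L l = +-congˡ {1ₐ} {r ⊙ X} {ι s ⊗ ⋆ P.a (P.block j l)} λ σ →
      Kᶠ.trans (⊙-scalar r X σ) (*-cong′ σ)
      where
      j = suc v + L
      C = columnsFrom (column S) j l
      r s : Kᶠ.Carrier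
      r = Kᶠ.- inv (L + length C + suc u ∸ height mu j)
      s = P.blockScalar j l
      X = ∑ (map (λ e → ⟦ transpose a e ⟧) (concat C))
      h≤u : height mu j ≤ u
      h≤u = ≡.subst (height mu j ≤_) height-mu (height-antitone mu (ℕ.≤-trans (ℕ.n≤1+n v) (ℕ.m≤m+n (suc v) L)))
      r≡s : r ≡ s
      r≡s = ≡.trans (≡.cong (λ l → Kᶠ.- inv (L + l + suc u ∸ height mu j)) (length-columnsFrom (column S) j l)) (≡.cong Kᶠ.-_ (scalar≡ L l h≤u))
      *-cong′ : [ (r , idₚ) ] ⊗ X ≋ ι s ⊗ ⋆ P.a (P.block j l)
      *-cong′ = begin
        [ (r , idₚ) ] ⊗ X           ≡⟨ ≡.cong₂ (λ r X → [ (r , idₚ) ] ⊗ X) r≡s (star≡∑ a (concat C)) ⟩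
        ι s ⊗ ⋆ a (concat C)        ≡⟨ ≡.cong (λ b → ι s ⊗ ⋆ b (concat C)) a≡E ⟩
        ι s ⊗ ⋆ P.a (concat C)
          ≈⟨ *-congˡ {ι s} {⋆ P.a (concat C)} {⋆ P.a (P.block j l)} (∑-↭ _ (concat-columnsFrom (OfS.column↭ S-lengths mu-decreasing S-entries S-unique S-row S-col) j l)) ⟩
        ι s ⊗ ⋆ P.a (P.block j l)   ∎

    factors≋ : ∀ {j bs} L → j ≡ suc v + L → Blocks j bs → prod (factors a u L bs) ≋ P.blockProduct j (widths bs)
    factors≋ L j≡ done σ = Kᶠ.refl
    factors≋ {_} {(_ , b) ∷ bs} L ≡.refl (next {l = l} level rest) = begin
      factor ⊗ prod (factors a u (L + length b) bs)
        ≈⟨ *-congˡ {factor} {prod (factors a u (L + length b) bs)} {P.blockProduct (j + suc l) (widths bs)} (factors≋ (L + length b) next-column rest) ⟩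
      factor ⊗ P.blockProduct (j + suc l) (widths bs)
        ≈⟨ *-congʳ {P.blockProduct (j + suc l) (widths bs)} {factor} {P.blockFactor j (suc l)} (factor≋ L (suc l)) ⟩
      P.blockProduct j (suc l ∷ widths bs)
        ≡⟨ ≡.cong (λ l → P.blockProduct j (l ∷ widths bs)) (length-columnsFrom (column S) j (suc l)) ⟨
      P.blockProduct j (length b ∷ widths bs) ∎
      where
      j = suc v + L
      factor = 1ₐ ⊕ (Kᶠ.- inv (L + length b + suc u ∸ height mu j)) ⊙ ∑ (map (λ e → ⟦ transpose a e ⟧) (concat b))
      next-column : j + suc l ≡ suc v + (L + length b)
      next-column = ≡.trans (ℕ.+-assoc (suc v) L (suc l)) (≡.cong (λ l → suc v + (L + l)) (≡.sym (length-columnsFrom (column S) j (suc l))))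

    rest-blocks : Blocks (suc v) (blocks (drop (suc v) (columns S)))
    rest-blocks = ≡.subst (λ C → Blocks (suc v) (blocks C))
      (≡.sym (≡.trans (≡.cong (drop (suc v)) (OfS.columns≡ S-lengths mu-decreasing S-entries S-unique S-row S-col)) (drop-columnsFrom (column S) 0 (part mu 0) (suc v))))
      (blocks-columnsFrom (column S) (height mu) length-column J (suc v) m ≡.refl)

    bs : List (ℕ × List (List (Fin (suc k))))
    bs = blocks (drop (suc v) (columns S))

    α-weight : HookWeights.weight {F = F} charZero (height mu) (length mu) J Kᶠ.≈ embed F (α mu)
    α-weight = Kᶠ.trans (HookFormula.weight-hooks {F = F} charZero (height mu) (length mu) (height≤length mu) (height-antitone mu) J)
      (Kᶠ.reflexive (≡.cong (embed F) (≡.sym (α-hooks mu-decreasing J mu-0≤J))))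

  theorem : 𝔠 T ⊗ 𝔠 S ≋ 𝔠 T ⊗ (embed F (α mu) ⊙ prod (factors a u 0 bs))
  theorem = begin
    𝔠 T ⊗ 𝔠 S         ≈⟨ *-congˡ {𝔠 T} {𝔠 S} {P.cˢ} 𝔠S ⟩
    𝔠 T ⊗ P.cˢ        ≈⟨ *-congʳ {P.cˢ} {𝔠 T} {P.cᵀ} 𝔠T ⟩
    P.cᵀ ⊗ P.cˢ       ≈⟨ P.product-formula (length mu) (height≤length mu) (levels rest-blocks) ⟩
    P.cᵀ ⊗ (ι w ⊗ Z)  ≈⟨ *-congʳ {ι w ⊗ Z} {𝔠 T} {P.cᵀ} 𝔠T ⟨
    𝔠 T ⊗ (ι w ⊗ Z)
      ≈⟨ *-congˡ {𝔠 T} {ι w ⊗ Z} {ι (embed F (α mu)) ⊗ Z} (*-congʳ {Z} {ι w} {ι (embed F (α mu))} (ι-cong α-weight)) ⟩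
    𝔠 T ⊗ (ι (embed F (α mu)) ⊗ Z)
      ≈⟨ *-congˡ {𝔠 T} {ι (embed F (α mu)) ⊗ prod (factors a u 0 bs)} {ι (embed F (α mu)) ⊗ Z}
           (*-congˡ {ι (embed F (α mu))} {prod (factors a u 0 bs)} {Z} (factors≋ 0 (≡.sym (ℕ.+-identityʳ (suc v))) rest-blocks)) ⟨
    𝔠 T ⊗ (ι (embed F (α mu)) ⊗ prod (factors a u 0 bs))
      ≈⟨ *-congˡ {𝔠 T} {embed F (α mu) ⊙ prod (factors a u 0 bs)} {ι (embed F (α mu)) ⊗ prod (factors a u 0 bs)} (⊙-scalar (embed F (α mu)) (prod (factors a u 0 bs))) ⟨
    𝔠 T ⊗ (embed F (α mu) ⊙ prod (factors a u 0 bs)) ∎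
    where
    w = HookWeights.weight {F = F} charZero (height mu) (length mu) J
    Z = P.blockProduct (suc v) (widths bs)

theorem1p2 : ∀ {c ℓ} (F : Field c ℓ) (charZero : CharZero F) (k : ℕ)
    (lam mu : List ℕ) → IsPartition (suc k) lam → IsPartition k mu → mu ⊂ᴰ lam →
    (T : Tableau (suc k)) → IsTableau lam T →
    (u v : ℕ) → part lam u ≡ suc v → part mu u ≡ v → (∀ i → i ≢ u → part lam i ≡ part mu i) →
    (a : Fin (suc k)) → entry T u v ≡ just a →
    let open GroupAlgebra F charZero (suc k) in
    𝔠 T ⊗ 𝔠 (restrict mu T)
    ≋ 𝔠 T ⊗ (embed F (α mu) ⊙ prod (factors a u 0 (blocks (drop (suc v) (columns (restrict mu T))))))
theorem1p2 F charZero k _ mu lam-partition mu-partition mu⊂lam T (≡.refl , T↭) u v lam-u mu-u others a entry-a =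
  Branching.theorem F charZero k mu T lam-partition mu-partition mu⊂lam T↭ u v lam-u mu-u others a entry-a
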